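{- Let $N\in\mathbb{N}$, $d\in\mathbb{N}$, and let $\{b_n:1\le n\le d\}$, $\{s_n:1\le n\le d\}$ be a solution to the Covering Problem for $N$ and $d$. Run the Algorithm with $\mathcal{B}=\{b_n:1\le n\le d\}$, $f_b=X-b$ for $b\in\mathcal{B}$, and $\mathcal{S}=\{s_n:1\le n\le d\}$. Then the Algorithm runs in $\mathcal{O}(d^{1+\epsilon})$ (for every $\epsilon>0$; counting arithmetic operations modulo $N$ and gcd computations with $N$). If $N$ is composite, it outputs a nontrivial factor of $N$; if $N$ is prime, it prints 'Error A'.
   Context: $Z_N=\{0,\dots,N-1\}$. Covering Problem: for $N$ and $d$, a solution is a pair of disjoint subsets $\{b_n:1\le n\le d\}$ and $\{s_n:1\le n\le d\}$ of $Z_N$ such that, if $N$ is composite, there exist $i,j\in\{1,\dots,d\}$ and a prime factor $p$ of $N$ with $b_i\equiv s_j\pmod p$. The Algorithm (input $N$, $\mathcal{B}=\{b_1,\dots,b_d\}$, polynomials $f_b$ for $b\in\mathcal{B}$, $\mathcal{S}=\{s_1,\dots,s_d\}$): set $a_1=1$, $a_2=1$. Step 1: compute $g:=\prod_{b\in\mathcal{B}}f_b \bmod N$. Step 2: for $n=1,\dots,d$ compute $y_n:=g(s_n)\bmod N$. Step 3: set $j:=a_1$. Step 4: if $j>d$ print 'Error A' and stop; otherwise compute $G_j:=\gcd(y_j,N)$; if $G_j=1$ set $a_1=j+1$ and go to Step 3; if $1<G_j<N$ output $G_j$ and stop; if $G_j=N$ go to Step 5. Step 5: set $i:=a_2$.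 Step 6: if $i>d$ print 'Error B' and stop; otherwise compute $H_i:=\gcd(f_{b_i}(s_j),N)$; if $H_i\in\{1,N\}$ set $a_2=i+1$ and go to Step 5; if $1<H_i<N$ output $H_i$ and stop. -}

module Defs where

open import Data.Bool.Base using (if_then_else_)
open import Data.Fin.Base using (Fin; zero; suc; toℕ; fromℕ<)
open import Data.Integer.Base as ℤ using (ℤ; +_)
import Data.Integer.Divisibility as ℤ
open import Data.Integer.DivMod using (n%ℕd<d)
open import Data.List.Base using (List; []; _∷_; map; allFin)
open import Data.Nat.Base using (ℕ; zero; suc; _+_; _*_; _^_; _≤_; NonZero)
open import Data.Nat.Divisibility using (_∣_)
open import Data.Nat.GCD using (gcd)
open import Data.Nat.Primality using (Prime; Composite)
open import Data.Nat.Properties using (_≟_)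
open import Data.Product.Base using (_×_; _,_; proj₁; proj₂; ∃-syntax)
open import Data.Rational.Base using (ℚ; ↥_; ↧ₙ_)
open import Relation.Binary.PropositionalEquality using (_≡_; _≢_)
open import Relation.Nullary.Decidable using (does)

module _ {N : ℕ} .{{_ : NonZero N}} where

  residue : ℤ → Fin N
  residue z = fromℕ< (n%ℕd<d z N)

  private
    rep : Fin N → ℤ
    rep x = + toℕ x

  0ᴺ 1ᴺ : Fin N
  0ᴺ = residue (+ 0)
  1ᴺ = residue (+ 1)

  infixl 6 _⊕_ _⊝_
  infixl 7 _⊗_
  _⊕_ _⊝_ _⊗_ : Fin N → Fin N → Fin N
  x ⊕ y = residue (rep x ℤ.+ rep y)
  x ⊝ y = residue (rep x ℤ.- rep y)
  x ⊗ y = residue (rep x ℤ.* rep y)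

-- Coefficient lists, constant term first.  Trailing zeros are allowed, so
-- polynomials are compared through `coeff`.
Poly : Set → Set
Poly = List

module _ {N : ℕ} .{{_ : NonZero N}} where

  coeff : Poly (Fin N) → ℕ → Fin N
  coeff []      _       = 0ᴺ
  coeff (a ∷ p) zero    = a
  coeff (a ∷ p) (suc k) = coeff p k

  evaluate : Poly (Fin N) → Fin N → Fin N
  evaluate []      x = 0ᴺ
  evaluate (a ∷ p) x = a ⊕ x ⊗ evaluate p x

  infixl 6 _+ₚ_
  infixl 7 _*ₚ_
  _+ₚ_ _*ₚ_ : Poly (Fin N) → Poly (Fin N) → Poly (Fin N)
  []      +ₚ q       = q
  (a ∷ p) +ₚ []      = a ∷ p
  (a ∷ p) +ₚ (c ∷ q) = a ⊕ c ∷ p +ₚ q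
  []      *ₚ q = []
  (a ∷ p) *ₚ q = map (a ⊗_) q +ₚ (0ᴺ ∷ p *ₚ q)

  ∏ₚ : ∀ {d} → (Fin d → Poly (Fin N)) → Poly (Fin N)
  ∏ₚ {zero}  f = 1ᴺ ∷ []
  ∏ₚ {suc d} f = f zero *ₚ ∏ₚ (λ i → f (suc i))

  X-_ : Fin N → Poly (Fin N)
  X- b = (0ᴺ ⊝ b) ∷ 1ᴺ ∷ []

infix 4 _≡_[mod_]
_≡_[mod_] : ℕ → ℕ → ℕ → Set
a ≡ b [mod p ] = + p ℤ.∣ (+ a ℤ.- + b)

record CoveringSolution (N d : ℕ) (b s : Fin d → Fin N) : Set where
  field
    disjoint : ∀ i j → b i ≢ s j
    covering : Composite N →
               ∃[ i ] ∃[ j ] ∃[ p ]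
                 (Prime p × p ∣ N × toℕ (b i) ≡ toℕ (s j) [mod p ])

-- Counted computations: a result together with the number of arithmetic
-- operations modulo N and gcd computations with N spent on it.
Counted : Set → Set
Counted A = A × ℕ

result : ∀ {A} → Counted A → A
result = proj₁

cost : ∀ {A} → Counted A → ℕ
cost = proj₂

return : ∀ {A} → A → Counted A
return a = a , 0

infixl 1 _>>=_
_>>=_ : ∀ {A B} → Counted A → (A → Counted B) → Counted B
(a , m) >>= k = result (k a) , m + cost (k a)

one-op : ∀ {A} → A → Counted A
one-op a = a , 1

-- Programs are used polymorphically in V, the type of the residues they
-- compute with.  Hence a program knows neither N nor the values of the
-- residues: only the operations below can produce new ones, and which
-- operations are performed depends only on the shape of the input (number
-- of points, lengths of coefficient lists).  Index bookkeeping and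
-- the constants 0 and 1 are not counted.
data Program (V A : Set) : Set where
  done          : A → Program V A
  lit0 lit1     : (V → Program V A) → Program V A
  add sub mul   : V → V → (V → Program V A) → Program V A

run : ∀ {N A} .{{_ : NonZero N}} → Program (Fin N) A → Counted A
run (done a)    = return a
run (lit0 k)    = run (k 0ᴺ)
run (lit1 k)    = run (k 1ᴺ)
run (add x y k) = one-op (x ⊕ y) >>= λ z → run (k z)
run (sub x y k) = one-op (x ⊝ y) >>= λ z → run (k z)
run (mul x y k) = one-op (x ⊗ y) >>= λ z → run (k z)

-- Steps 1 and 2 say what has to be computed but not how.  This is a choice
-- of methods for polynomial multiplication and multipoint evaluation that is
-- correct for every modulus and all inputs.
record PolynomialArithmetic : Set₁ where
  field
    productOf : ∀ {V d} → (Fin d → Poly V) → Program V (Poly V)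
    valuesOf  : ∀ {V d} → Poly V → (Fin d → V) → Program V (Fin d → V)

    productOf-correct :
      ∀ {N d} .{{_ : NonZero N}} (f : Fin d → Poly (Fin N)) k →
      coeff (result (run (productOf f))) k ≡ coeff (∏ₚ f) k
    valuesOf-correct :
      ∀ {N d} .{{_ : NonZero N}} (g : Poly (Fin N)) (s : Fin d → Fin N) j →
      result (run (valuesOf g s)) j ≡ evaluate g (s j)

data Output : Set where
  factor        : ℕ → Output
  errorA errorB : Output

module _ {N : ℕ} .{{_ : NonZero N}} where

  gcdᴺ : Fin N → Counted ℕ
  gcdᴺ x = one-op (gcd (toℕ x) N)

  horner : Poly (Fin N) → Fin N → Counted (Fin N)
  horner []      x = return 0ᴺ
  horner (a ∷ p) x =
    horner p x       >>= λ v →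
    one-op (x ⊗ v)   >>= λ w →
    one-op (a ⊕ w)

  -- The loops over j and i carry the list of indices still to be treated,
  -- in increasing order; it is empty exactly when the index exceeds d.

  steps5-6 : ∀ {d} → (Fin d → Poly (Fin N)) → Fin N → List (Fin d) →
             Counted Output
  steps5-6 f sⱼ []       = return errorB
  steps5-6 f sⱼ (i ∷ is) =
    horner (f i) sⱼ >>= λ v →
    gcdᴺ v          >>= λ H →
    if does (H ≟ 1) then steps5-6 f sⱼ is else
    if does (H ≟ N) then steps5-6 f sⱼ is else
    return (factor H)

  steps3-6 : ∀ {d} → (Fin d → Poly (Fin N)) → (s y : Fin d → Fin N) →
             List (Fin d) → Counted Output
  steps3-6     f s y []       = return errorA
  steps3-6 {d} f s y (j ∷ js) =
    gcdᴺ (y j) >>= λ G →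
    if does (G ≟ 1) then steps3-6 f s y js else
    if does (G ≟ N) then steps5-6 f (s j) (allFin d) else
    return (factor G)

  -- f i is the polynomial attached to the i-th element of ℬ.
  algorithm : PolynomialArithmetic → ∀ {d} →
              (f : Fin d → Poly (Fin N)) (s : Fin d → Fin N) →
              Counted Output
  algorithm P {d} f s =
    run (productOf f)  >>= λ g →
    run (valuesOf g s) >>= λ y →
    steps3-6 f s y (allFin d)
    where open PolynomialArithmetic P

-- c ≤ C · d ^ (1 + ε), where ε = p / q: both sides are raised to the power q.
_≤_·_^1+_ : ℕ → ℕ → ℕ → ℚ → Set
c ≤ C · d ^1+ ε = c ^ q ≤ C ^ q * d ^ (q + p)
  where
  p = ℤ.∣ ↥ ε ∣
  q = ↧ₙ ε

{-# OPTIONS --safe #-}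

-- The value y_j is the product of the s_j - b_i modulo N, so a prime factor p of N
-- with b_i ≡ s_j mod p shows up in gcd(y_j, N); disjointness of the two sets keeps
-- every gcd(s_j - b_i, N) below N, and all gcds are 1 when N is prime.
--
-- The quasilinear bound needs an arithmetic that never divides.  Schönhage's
-- multiplication of radix p cuts polynomials into about √n blocks and multiplies
-- these by a Fourier transform over R[y]/(∑_{i<p} y^(i m)), whose roots of unity are
-- powers of y; it yields p^e f g.  Doing this for p = 2 and p = 3 and combining
-- u 2^a + v 3^b = 1 removes the denominators.  Since the recursion has depth
-- log log n, a constant factor per level costs only a power of log n.
--
-- Products are then computed along a binary tree.  For evaluation let E be the shift
-- of sequences.  By Horner's scheme, (1 - s E) τ = g implies τ 0 = g(s).  So one
-- computes Q(E)⁻¹ g for Q = ∏ (1 - s_j x), where 1/Q comes from (1 + e)(1 + e²)(1 + e⁴)⋯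
-- with e = 1 - Q, and descends the tree, applying at each node the sibling's factor.
--
-- Polynomials are always tested against sequences: h = f g means that
-- ∑ h_i t_i = ∑ f_i g_j t_(i+j) for all t, and an identity modulo an ideal is one for
-- all t annihilated by that ideal.  This avoids polynomial and quotient rings.
module Submission where

-- A program sees neither N nor the residues, so 2 and 3 may be zero divisors and no roots of unity
-- are at hand: they have to be adjoined, and denominators cannot be cancelled afterwards, only
-- combined away. Working modulo y^M - 1 alone would not do. Interpolation at powers of the p-th
-- root of unity y^m requires that ∑_(i<p) y^(r i m) vanish for 0 < r < p, and this holds only
-- modulo Φ(y) = ∑_(i<p) y^(i m). Nothing is lost by passing to this quotient, because products of
-- two blocks are shorter than the degree of Φ. Evaluation uses the reversed factors 1 - s x rather
-- than x - s: their product has constant coefficient 1, hence a power series inverse over every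
-- commutative ring. A coefficient sequence is zero from some n on, so the shift acts nilpotently on
-- it, and an inverse modulo x^n is already exact.

open import Defs
open import Algebra.Bundles using (CommutativeRing; CommutativeSemiring)
import Algebra.Properties.AbelianGroup
import Algebra.Properties.Ring
import Algebra.Solver.Ring.NaturalCoefficients.Default
open import Algebra.Structures using (IsCommutativeRing)
open import Data.Bool.Base using (true; false; if_then_else_)
open import Data.Empty using (⊥-elim)
open import Data.Fin.Base using (Fin; zero; suc; toℕ)
open import Data.Fin.Properties using (toℕ<n; toℕ-fromℕ<; toℕ-injective)
open import Data.Integer.Base as ℤ using (ℤ) renaming (+_ to pos)
import Data.Integer.Divisibility.Signed as ℤ∣
open import Data.Integer.DivMod using (n%ℕd<d; a≡a%ℕn+[a/ℕn]*n)
import Data.Integer.Properties as ℤ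
import Data.Integer.Tactic.RingSolver as ℤSolver
open import Data.List.Base using (List; []; _∷_; map; allFin; length; applyUpTo)
open import Data.List.Membership.Propositional using (_∈_)
open import Data.List.Membership.Propositional.Properties using (∈-allFin)
open import Data.List.Properties using (length-applyUpTo; length-tabulate)
open import Data.List.Relation.Unary.Any using (here; there)
open import Data.Nat.Base
open import Data.Nat.Divisibility using (_∣_; ∣-refl; ∣-trans; ∣⇒≤; ∣1⇒≡1; 0∣⇒≡0; ∣m⇒∣m*n; divides-refl)
open import Data.Nat.DivMod hiding (result)
open import Data.Nat.GCD using (gcd; gcd[m,n]∣m; gcd[m,n]∣n; gcd-greatest)
open import Data.Nat.Primality using (Prime; Composite; euclidsLemma; prime⇒irreducible; prime⇒nonTrivial)
open import Data.Nat.Properties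
import Data.Nat.Tactic.RingSolver as ℕSolver
open import Data.Product.Base using (_×_; _,_; proj₁; proj₂; ∃-syntax)
open import Data.Rational.Base using (ℚ; mkℚ; Positive)
open import Data.Sum.Base using (_⊎_; inj₁; inj₂; [_,_]′)
open import Function.Base using (_∘_; id)
open import Level using (0ℓ)
open import Relation.Binary.PropositionalEquality
open import Relation.Nullary.Decidable using (Dec; yes; no; does)
open import Relation.Nullary.Negation using (¬_)

-- The ring ℤ/N

module _ {N : ℕ} .{{_ : NonZero N}} where

  rep : Fin N → ℤ
  rep x = pos (toℕ x)

  residue-rep : (x : Fin N) → residue (rep x) ≡ x
  residue-rep x = toℕ-injective (trans (toℕ-fromℕ< (n%ℕd<d (rep x) N)) (m<n⇒m%n≡m (toℕ<n x)))

  residue-split : (z : ℤ) → ∃[ k ] z ≡ rep (residue z) ℤ.+ k ℤ.* pos N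
  residue-split z = z ℤ./ℕ N , trans (a≡a%ℕn+[a/ℕn]*n z N)
    (cong (λ r → pos r ℤ.+ (z ℤ./ℕ N) ℤ.* pos N) (sym (toℕ-fromℕ< (n%ℕd<d z N))))

  private
    small-multiple : ∀ m n k → m < N → n < N → pos m ℤ.- pos n ≡ k ℤ.* pos N → m ≡ n
    small-multiple m n k m<N n<N eq = ℤ.+-injective (ℤ.i-j≡0⇒i≡j (pos m) (pos n)
      (trans eq (cong (ℤ._* pos N) (ℤ.∣i∣≡0⇒i≡0 {k} ∣k∣≡0))))
      where
      ∣k∣*N<N : ℤ.∣ k ∣ * N < N
      ∣k∣*N<N = begin-strict
        ℤ.∣ k ∣ * N        ≡⟨ ℤ.∣i*j∣≡∣i∣*∣j∣ k (pos N) ⟨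
        ℤ.∣ k ℤ.* pos N ∣    ≡⟨ cong ℤ.∣_∣ eq ⟨
        ℤ.∣ pos m ℤ.- pos n ∣  ≡⟨ cong ℤ.∣_∣ (ℤ.[+m]-[+n]≡m⊖n m n) ⟩
        ℤ.∣ m ℤ.⊖ n ∣      ≤⟨ ℤ.∣m⊝n∣≤m⊔n m n ⟩
        m ⊔ n              <⟨ ⊔-lub m<N n<N ⟩
        N                  ∎
        where open ≤-Reasoning
      ∣k∣≡0 : ℤ.∣ k ∣ ≡ 0
      ∣k∣≡0 = n<1⇒n≡0 (*-cancelʳ-< N ℤ.∣ k ∣ 1 (subst (ℤ.∣ k ∣ * N <_) (sym (*-identityˡ N)) ∣k∣*N<N))

  residue-cong : ∀ a b k → a ≡ b ℤ.+ k ℤ.* pos N → residue a ≡ residue b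
  residue-cong a b k eq with residue-split a | residue-split b
  ... | l , a≡ | m , b≡ = toℕ-injective
    (small-multiple _ _ (m ℤ.+ k ℤ.- l) (toℕ<n (residue a)) (toℕ<n (residue b)) (begin
      ra ℤ.- rb
        ≡⟨ rearrange ra rb (pos N) k l m ⟩
      (ra ℤ.+ l ℤ.* pos N) ℤ.- (rb ℤ.+ m ℤ.* pos N ℤ.+ k ℤ.* pos N) ℤ.+ (m ℤ.+ k ℤ.- l) ℤ.* pos N
        ≡⟨ cong (λ u → u ℤ.- (rb ℤ.+ m ℤ.* pos N ℤ.+ k ℤ.* pos N) ℤ.+ (m ℤ.+ k ℤ.- l) ℤ.* pos N) (sym a≡) ⟩
      a ℤ.- (rb ℤ.+ m ℤ.* pos N ℤ.+ k ℤ.* pos N) ℤ.+ (m ℤ.+ k ℤ.- l) ℤ.* pos N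
        ≡⟨ cong (λ u → a ℤ.- (u ℤ.+ k ℤ.* pos N) ℤ.+ (m ℤ.+ k ℤ.- l) ℤ.* pos N) (sym b≡) ⟩
      a ℤ.- (b ℤ.+ k ℤ.* pos N) ℤ.+ (m ℤ.+ k ℤ.- l) ℤ.* pos N
        ≡⟨ cong (λ u → a ℤ.- u ℤ.+ (m ℤ.+ k ℤ.- l) ℤ.* pos N) (sym eq) ⟩
      a ℤ.- a ℤ.+ (m ℤ.+ k ℤ.- l) ℤ.* pos N
        ≡⟨ cong (ℤ._+ (m ℤ.+ k ℤ.- l) ℤ.* pos N) (ℤ.+-inverseʳ a) ⟩
      ℤ.0ℤ ℤ.+ (m ℤ.+ k ℤ.- l) ℤ.* pos N
        ≡⟨ ℤ.+-identityˡ _ ⟩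
      (m ℤ.+ k ℤ.- l) ℤ.* pos N ∎))
    where
    open ≡-Reasoning
    ra = rep (residue a)
    rb = rep (residue b)
    rearrange : ∀ x y n k l m → x ℤ.- y ≡
      (x ℤ.+ l ℤ.* n) ℤ.- (y ℤ.+ m ℤ.* n ℤ.+ k ℤ.* n) ℤ.+ (m ℤ.+ k ℤ.- l) ℤ.* n
    rearrange = ℤSolver.solve-∀

  residue-+ : ∀ a b → residue a ⊕ residue b ≡ residue (a ℤ.+ b)
  residue-+ a b with residue-split a | residue-split b
  ... | k , a≡ | l , b≡ = sym (residue-cong _ (rep (residue a) ℤ.+ rep (residue b)) (k ℤ.+ l)
    (trans (cong₂ ℤ._+_ a≡ b≡) (rearrange (rep (residue a)) (rep (residue b)) (pos N) k l)))
    where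
    rearrange : ∀ x y n k l → x ℤ.+ k ℤ.* n ℤ.+ (y ℤ.+ l ℤ.* n) ≡ x ℤ.+ y ℤ.+ (k ℤ.+ l) ℤ.* n
    rearrange = ℤSolver.solve-∀

  residue-- : ∀ a b → residue a ⊝ residue b ≡ residue (a ℤ.- b)
  residue-- a b with residue-split a | residue-split b
  ... | k , a≡ | l , b≡ = sym (residue-cong _ (rep (residue a) ℤ.- rep (residue b)) (k ℤ.- l)
    (trans (cong₂ ℤ._-_ a≡ b≡) (rearrange (rep (residue a)) (rep (residue b)) (pos N) k l)))
    where
    rearrange : ∀ x y n k l → x ℤ.+ k ℤ.* n ℤ.- (y ℤ.+ l ℤ.* n) ≡ x ℤ.- y ℤ.+ (k ℤ.- l) ℤ.* n
    rearrange = ℤSolver.solve-∀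

  residue-* : ∀ a b → residue a ⊗ residue b ≡ residue (a ℤ.* b)
  residue-* a b with residue-split a | residue-split b
  ... | k , a≡ | l , b≡ = sym (residue-cong _ (rep (residue a) ℤ.* rep (residue b)) (k ℤ.* rep (residue b) ℤ.+ rep (residue a) ℤ.* l ℤ.+ k ℤ.* l ℤ.* pos N)
    (trans (cong₂ ℤ._*_ a≡ b≡) (rearrange (rep (residue a)) (rep (residue b)) (pos N) k l)))
    where
    rearrange : ∀ x y n k l → (x ℤ.+ k ℤ.* n) ℤ.* (y ℤ.+ l ℤ.* n) ≡
      x ℤ.* y ℤ.+ (k ℤ.* y ℤ.+ x ℤ.* l ℤ.+ k ℤ.* l ℤ.* n) ℤ.* n
    rearrange = ℤSolver.solve-∀

  infix 8 ⊖_
  ⊖_ : Fin N → Fin N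
  ⊖ x = 0ᴺ ⊝ x

  residue-neg : ∀ a → ⊖ residue a ≡ residue (ℤ.- a)
  residue-neg a = trans (residue-- (pos 0) a) (cong residue (ℤ.+-identityˡ (ℤ.- a)))

  ⊕-assoc : ∀ x y z → (x ⊕ y) ⊕ z ≡ x ⊕ (y ⊕ z)
  ⊕-assoc x y z = begin
    (x ⊕ y) ⊕ z                            ≡⟨ cong ((x ⊕ y) ⊕_) (residue-rep z) ⟨
    (x ⊕ y) ⊕ residue (rep z)              ≡⟨ residue-+ (rep x ℤ.+ rep y) (rep z) ⟩
    residue (rep x ℤ.+ rep y ℤ.+ rep z)    ≡⟨ cong residue (ℤ.+-assoc (rep x) (rep y) (rep z)) ⟩
    residue (rep x ℤ.+ (rep y ℤ.+ rep z))  ≡⟨ residue-+ (rep x) (rep y ℤ.+ rep z) ⟨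
    residue (rep x) ⊕ (y ⊕ z)              ≡⟨ cong (_⊕ (y ⊕ z)) (residue-rep x) ⟩
    x ⊕ (y ⊕ z)                            ∎
    where open ≡-Reasoning

  ⊕-comm : ∀ x y → x ⊕ y ≡ y ⊕ x
  ⊕-comm x y = cong residue (ℤ.+-comm (rep x) (rep y))

  ⊕-identityˡ : ∀ x → 0ᴺ ⊕ x ≡ x
  ⊕-identityˡ x = begin
    0ᴺ ⊕ x                    ≡⟨ cong (0ᴺ ⊕_) (residue-rep x) ⟨
    0ᴺ ⊕ residue (rep x)      ≡⟨ residue-+ (pos 0) (rep x) ⟩
    residue (pos 0 ℤ.+ rep x)   ≡⟨ cong residue (ℤ.+-identityˡ (rep x)) ⟩
    residue (rep x)           ≡⟨ residue-rep x ⟩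
    x                         ∎
    where open ≡-Reasoning

  ⊖-inverseˡ : ∀ x → ⊖ x ⊕ x ≡ 0ᴺ
  ⊖-inverseˡ x = begin
    ⊖ x ⊕ x                                    ≡⟨ cong (λ u → ⊖ u ⊕ u) (residue-rep x) ⟨
    ⊖ residue (rep x) ⊕ residue (rep x)        ≡⟨ cong (_⊕ residue (rep x)) (residue-neg (rep x)) ⟩
    residue (ℤ.- rep x) ⊕ residue (rep x)      ≡⟨ residue-+ (ℤ.- rep x) (rep x) ⟩
    residue (ℤ.- rep x ℤ.+ rep x)              ≡⟨ cong residue (ℤ.+-inverseˡ (rep x)) ⟩
    0ᴺ                                         ∎
    where open ≡-Reasoning

  ⊗-assoc : ∀ x y z → (x ⊗ y) ⊗ z ≡ x ⊗ (y ⊗ z)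
  ⊗-assoc x y z = begin
    (x ⊗ y) ⊗ z                            ≡⟨ cong ((x ⊗ y) ⊗_) (residue-rep z) ⟨
    (x ⊗ y) ⊗ residue (rep z)              ≡⟨ residue-* (rep x ℤ.* rep y) (rep z) ⟩
    residue (rep x ℤ.* rep y ℤ.* rep z)    ≡⟨ cong residue (ℤ.*-assoc (rep x) (rep y) (rep z)) ⟩
    residue (rep x ℤ.* (rep y ℤ.* rep z))  ≡⟨ residue-* (rep x) (rep y ℤ.* rep z) ⟨
    residue (rep x) ⊗ (y ⊗ z)              ≡⟨ cong (_⊗ (y ⊗ z)) (residue-rep x) ⟩
    x ⊗ (y ⊗ z)                            ∎
    where open ≡-Reasoning

  ⊗-comm : ∀ x y → x ⊗ y ≡ y ⊗ x
  ⊗-comm x y = cong residue (ℤ.*-comm (rep x) (rep y))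

  ⊗-identityˡ : ∀ x → 1ᴺ ⊗ x ≡ x
  ⊗-identityˡ x = begin
    1ᴺ ⊗ x                    ≡⟨ cong (1ᴺ ⊗_) (residue-rep x) ⟨
    1ᴺ ⊗ residue (rep x)      ≡⟨ residue-* (pos 1) (rep x) ⟩
    residue (pos 1 ℤ.* rep x)   ≡⟨ cong residue (ℤ.*-identityˡ (rep x)) ⟩
    residue (rep x)           ≡⟨ residue-rep x ⟩
    x                         ∎
    where open ≡-Reasoning

  ⊗-distribˡ-⊕ : ∀ x y z → x ⊗ (y ⊕ z) ≡ x ⊗ y ⊕ x ⊗ z
  ⊗-distribˡ-⊕ x y z = begin
    x ⊗ (y ⊕ z)                                    ≡⟨ cong (_⊗ (y ⊕ z)) (residue-rep x) ⟨
    residue (rep x) ⊗ (y ⊕ z)                      ≡⟨ residue-* (rep x) (rep y ℤ.+ rep z) ⟩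
    residue (rep x ℤ.* (rep y ℤ.+ rep z))          ≡⟨ cong residue (ℤ.*-distribˡ-+ (rep x) (rep y) (rep z)) ⟩
    residue (rep x ℤ.* rep y ℤ.+ rep x ℤ.* rep z)  ≡⟨ residue-+ (rep x ℤ.* rep y) (rep x ℤ.* rep z) ⟨
    x ⊗ y ⊕ x ⊗ z                                  ∎
    where open ≡-Reasoning

  ⊗-distribʳ-⊕ : ∀ z x y → (x ⊕ y) ⊗ z ≡ x ⊗ z ⊕ y ⊗ z
  ⊗-distribʳ-⊕ z x y = trans (⊗-comm (x ⊕ y) z)
    (trans (⊗-distribˡ-⊕ z x y) (cong₂ _⊕_ (⊗-comm z x) (⊗-comm z y)))

  residue-isCommutativeRing : IsCommutativeRing _≡_ _⊕_ _⊗_ ⊖_ 0ᴺ 1ᴺ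
  residue-isCommutativeRing = record
    { isRing = record
      { +-isAbelianGroup = record
        { isGroup = record
          { isMonoid = record
            { isSemigroup = record
              { isMagma = record { isEquivalence = isEquivalence ; ∙-cong = cong₂ _⊕_ }
              ; assoc = ⊕-assoc
              }
            ; identity = ⊕-identityˡ , λ x → trans (⊕-comm x 0ᴺ) (⊕-identityˡ x)
            }
          ; inverse = ⊖-inverseˡ , λ x → trans (⊕-comm x (⊖ x)) (⊖-inverseˡ x)
          ; ⁻¹-cong = cong ⊖_
          }
        ; comm = ⊕-comm
        }
      ; *-cong = cong₂ _⊗_
      ; *-assoc = ⊗-assoc
      ; *-identity = ⊗-identityˡ , λ x → trans (⊗-comm x 1ᴺ) (⊗-identityˡ x)
      ; distrib = ⊗-distribˡ-⊕ , ⊗-distribʳ-⊕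
      }
    ; *-comm = ⊗-comm
    }

  open IsCommutativeRing residue-isCommutativeRing public
    using () renaming (+-identityʳ to ⊕-identityʳ; zeroˡ to ⊗-zeroˡ; zeroʳ to ⊗-zeroʳ; *-identityʳ to ⊗-identityʳ)

module _ {N : ℕ} .{{_ : NonZero N}} where

  ⊝≡⊕⊖ : (x y : Fin N) → x ⊝ y ≡ x ⊕ ⊖ y
  ⊝≡⊕⊖ x y = begin
    residue (rep x ℤ.- rep y)                    ≡⟨ residue-+ (rep x) (ℤ.- rep y) ⟨
    residue (rep x) ⊕ residue (ℤ.- rep y)        ≡⟨ cong₂ _⊕_ (residue-rep x) (sym (residue-neg (rep y))) ⟩
    x ⊕ ⊖ residue (rep y)                        ≡⟨ cong (λ u → x ⊕ ⊖ u) (residue-rep y) ⟩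
    x ⊕ ⊖ y                                      ∎
    where open ≡-Reasoning

-- Finite sums over a ring

-- Everything before the arithmetic over ℤ/N is proved for an arbitrary commutative ring.
-- Subtraction is a separate operation because programs have it as a primitive; `⊟-def` ties it to
-- the ring structure.
record RingOn (V : Set) : Set where
  infixl 6 _⊞_ _⊟_
  infixl 7 _⊠_
  infix  8 -ᵣ_
  field
    _⊞_ _⊟_ _⊠_       : V → V → V
    -ᵣ_               : V → V
    𝟘 𝟙               : V
    isCommutativeRing : IsCommutativeRing _≡_ _⊞_ _⊠_ -ᵣ_ 𝟘 𝟙
    ⊟-def             : ∀ x y → x ⊟ y ≡ x ⊞ -ᵣ y

  open IsCommutativeRing isCommutativeRing public
    using (isCommutativeSemiring)
    renaming (+-assoc to ⊞-assoc; +-comm to ⊞-comm; +-identityˡ to ⊞-identityˡ; +-identityʳ to ⊞-identityʳ;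
              *-assoc to ⊠-assoc; *-comm to ⊠-comm; *-identityˡ to ⊠-identityˡ; *-identityʳ to ⊠-identityʳ;
              distribˡ to ⊠-distribˡ; distribʳ to ⊠-distribʳ; zeroˡ to ⊠-zeroˡ; zeroʳ to ⊠-zeroʳ;
              -‿inverseˡ to -ᵣ-inverseˡ; -‿inverseʳ to -ᵣ-inverseʳ)

  commutativeSemiring : CommutativeSemiring 0ℓ 0ℓ
  commutativeSemiring = record { isCommutativeSemiring = isCommutativeSemiring }

  commutativeRing : CommutativeRing 0ℓ 0ℓ
  commutativeRing = record { isCommutativeRing = isCommutativeRing }

  ⊟-self : ∀ x → x ⊟ x ≡ 𝟘
  ⊟-self x = trans (⊟-def x x) (-ᵣ-inverseʳ x)

  ⊟-identityʳ : ∀ x → x ⊟ 𝟘 ≡ x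
  ⊟-identityʳ x = trans (⊟-def x 𝟘) (trans (cong (x ⊞_) ε⁻¹≈ε) (⊞-identityʳ x))
    where open Algebra.Properties.AbelianGroup (CommutativeRing.+-abelianGroup commutativeRing)

  ⊠-distribˡ-⊟ : ∀ x y z → x ⊠ (y ⊟ z) ≡ x ⊠ y ⊟ x ⊠ z
  ⊠-distribˡ-⊟ x y z = trans (cong (x ⊠_) (⊟-def y z)) (trans (⊠-distribˡ x y (-ᵣ z))
    (trans (cong (x ⊠ y ⊞_) (sym (-‿distribʳ-* x z))) (sym (⊟-def (x ⊠ y) (x ⊠ z)))))
    where open Algebra.Properties.Ring (CommutativeRing.ring commutativeRing)

  ⊠-distribʳ-⊟ : ∀ x y z → (y ⊟ z) ⊠ x ≡ y ⊠ x ⊟ z ⊠ x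
  ⊠-distribʳ-⊟ x y z = trans (⊠-comm (y ⊟ z) x) (trans (⊠-distribˡ-⊟ x y z) (cong₂ _⊟_ (⊠-comm x y) (⊠-comm x z)))

  module RingSolver = Algebra.Solver.Ring.NaturalCoefficients.Default commutativeSemiring

  infixr 8 _^ᵣ_
  _^ᵣ_ : V → ℕ → V
  x ^ᵣ zero  = 𝟙
  x ^ᵣ suc n = x ⊠ x ^ᵣ n

module Sums {V : Set} (R : RingOn V) where
  open RingOn R
  open RingSolver using (solve; _:=_; _:+_; _:*_; con)

  ∑ : ℕ → (ℕ → V) → V
  ∑ zero    f = 𝟘
  ∑ (suc n) f = f 0 ⊞ ∑ n (f ∘ suc)

  ∑-cong : ∀ n {f g} → (∀ i → i < n → f i ≡ g i) → ∑ n f ≡ ∑ n g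
  ∑-cong zero    eq = refl
  ∑-cong (suc n) eq = cong₂ _⊞_ (eq 0 z<s) (∑-cong n (λ i i<n → eq (suc i) (s<s i<n)))

  ∑-ext : ∀ n {f g} → (∀ i → f i ≡ g i) → ∑ n f ≡ ∑ n g
  ∑-ext n eq = ∑-cong n (λ i _ → eq i)

  ∑-zero : ∀ n {f} → (∀ i → i < n → f i ≡ 𝟘) → ∑ n f ≡ 𝟘
  ∑-zero zero    eq = refl
  ∑-zero (suc n) eq = trans (cong₂ _⊞_ (eq 0 z<s) (∑-zero n (λ i i<n → eq (suc i) (s<s i<n)))) (⊞-identityˡ 𝟘)

  ∑-⊞ : ∀ n f g → ∑ n (λ i → f i ⊞ g i) ≡ ∑ n f ⊞ ∑ n g
  ∑-⊞ zero    f g = sym (⊞-identityˡ 𝟘)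
  ∑-⊞ (suc n) f g = trans (cong (f 0 ⊞ g 0 ⊞_) (∑-⊞ n (f ∘ suc) (g ∘ suc)))
    (solve 4 (λ a b c d → (a :+ b) :+ (c :+ d) := (a :+ c) :+ (b :+ d)) refl (f 0) (g 0) _ _)

  ∑-⊟ : ∀ n f g → ∑ n (λ i → f i ⊟ g i) ≡ ∑ n f ⊟ ∑ n g
  ∑-⊟ zero    f g = sym (⊟-self 𝟘)
  ∑-⊟ (suc n) f g = begin
    (f 0 ⊟ g 0) ⊞ ∑ n (λ i → f (suc i) ⊟ g (suc i))
      ≡⟨ cong₂ _⊞_ (⊟-def (f 0) (g 0)) (trans (∑-⊟ n (f ∘ suc) (g ∘ suc)) (⊟-def F G)) ⟩
    (f 0 ⊞ -ᵣ g 0) ⊞ (F ⊞ -ᵣ G)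
      ≡⟨ solve 4 (λ a b c d → (a :+ b) :+ (c :+ d) := (a :+ c) :+ (b :+ d)) refl (f 0) (-ᵣ g 0) F (-ᵣ G) ⟩
    (f 0 ⊞ F) ⊞ (-ᵣ g 0 ⊞ -ᵣ G)
      ≡⟨ cong (f 0 ⊞ F ⊞_) (⁻¹-∙-comm (g 0) G) ⟩
    (f 0 ⊞ F) ⊞ -ᵣ (g 0 ⊞ G)
      ≡⟨ ⊟-def (f 0 ⊞ F) (g 0 ⊞ G) ⟨
    (f 0 ⊞ F) ⊟ (g 0 ⊞ G) ∎
    where
    open ≡-Reasoning
    open Algebra.Properties.AbelianGroup (CommutativeRing.+-abelianGroup commutativeRing)
    F = ∑ n (f ∘ suc)
    G = ∑ n (g ∘ suc)

  ∑-⊠ˡ : ∀ n c f → c ⊠ ∑ n f ≡ ∑ n (λ i → c ⊠ f i)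
  ∑-⊠ˡ zero    c f = ⊠-zeroʳ c
  ∑-⊠ˡ (suc n) c f = trans (⊠-distribˡ c (f 0) _) (cong (c ⊠ f 0 ⊞_) (∑-⊠ˡ n c (f ∘ suc)))

  ∑-⊠ʳ : ∀ n c f → ∑ n f ⊠ c ≡ ∑ n (λ i → f i ⊠ c)
  ∑-⊠ʳ n c f = trans (⊠-comm _ c) (trans (∑-⊠ˡ n c f) (∑-ext n (λ i → ⊠-comm c (f i))))

  ∑-swap : ∀ m n (f : ℕ → ℕ → V) → ∑ m (λ i → ∑ n (f i)) ≡ ∑ n (λ j → ∑ m (λ i → f i j))
  ∑-swap zero    n f = sym (∑-zero n (λ _ _ → refl))
  ∑-swap (suc m) n f = trans (cong (∑ n (f 0) ⊞_) (∑-swap m n (f ∘ suc)))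
    (sym (∑-⊞ n (f 0) (λ j → ∑ m (λ i → f (suc i) j))))

  ∑-+ : ∀ m n f → ∑ (m + n) f ≡ ∑ m f ⊞ ∑ n (λ i → f (m + i))
  ∑-+ zero    n f = sym (⊞-identityˡ _)
  ∑-+ (suc m) n f = trans (cong (f 0 ⊞_) (∑-+ m n (f ∘ suc))) (sym (⊞-assoc (f 0) _ _))

  ∑-* : ∀ m n f → ∑ (m * n) f ≡ ∑ m (λ i → ∑ n (λ j → f (i * n + j)))
  ∑-* zero    n f = refl
  ∑-* (suc m) n f = trans (∑-+ n (m * n) f) (cong (∑ n f ⊞_)
    (trans (∑-* m n (λ i → f (n + i)))
      (∑-ext m (λ i → ∑-ext n (λ j → cong f (sym (+-assoc n (i * n) j)))))))

  ∑-last : ∀ n f → ∑ (suc n) f ≡ ∑ n f ⊞ f n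
  ∑-last zero    f = ⊞-comm (f 0) 𝟘
  ∑-last (suc n) f = trans (cong (f 0 ⊞_) (∑-last n (f ∘ suc))) (sym (⊞-assoc (f 0) _ _))

  ∑-reverse : ∀ n f → ∑ n f ≡ ∑ n (λ i → f (n ∸ suc i))
  ∑-reverse zero    f = refl
  ∑-reverse (suc n) f = trans (∑-last n f) (trans (⊞-comm _ (f n)) (cong (f n ⊞_) (∑-reverse n f)))

  ∑-shift : ∀ n {f} → f n ≡ f 0 → ∑ n (f ∘ suc) ≡ ∑ n f
  ∑-shift zero    eq = refl
  ∑-shift (suc n) {f} eq = trans (∑-last n (f ∘ suc)) (trans (⊞-comm _ _) (cong (_⊞ ∑ n (f ∘ suc)) eq))

  ∑-rotate : ∀ n s {f} → (∀ i → f (i + n) ≡ f i) → ∑ n (λ i → f (i + s)) ≡ ∑ n f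
  ∑-rotate n zero    {f} per = ∑-ext n (λ i → cong f (+-identityʳ i))
  ∑-rotate n (suc s) {f} per = begin
    ∑ n (λ i → f (i + suc s))    ≡⟨ ∑-ext n (λ i → cong f (+-suc i s)) ⟩
    ∑ n (λ i → f (suc i + s))    ≡⟨ ∑-rotate n s (λ i → per (suc i)) ⟩
    ∑ n (f ∘ suc)                ≡⟨ ∑-shift n (per 0) ⟩
    ∑ n f                        ∎
    where open ≡-Reasoning

  -- True for all primes p.
  DilationInvariant : ℕ → Set
  DilationInvariant p = ∀ r → 0 < r → r < p → ∀ (θ : ℕ → V) → (∀ i → θ (i + p) ≡ θ i) → ∑ p (λ i → θ (r * i)) ≡ ∑ p θ

  δ : ℕ → ℕ → V
  δ zero    zero    = 𝟙
  δ zero    (suc j) = 𝟘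
  δ (suc i) zero    = 𝟘
  δ (suc i) (suc j) = δ i j

  δ-refl : ∀ i → δ i i ≡ 𝟙
  δ-refl zero    = refl
  δ-refl (suc i) = δ-refl i

  δ-≢ : ∀ {i j} → i ≢ j → δ i j ≡ 𝟘
  δ-≢ {zero}  {zero}  i≢j = ⊥-elim (i≢j refl)
  δ-≢ {zero}  {suc j} i≢j = refl
  δ-≢ {suc i} {zero}  i≢j = refl
  δ-≢ {suc i} {suc j} i≢j = δ-≢ (i≢j ∘ cong suc)

  δ-+ : ∀ k i j → δ (k + i) (k + j) ≡ δ i j
  δ-+ zero    i j = refl
  δ-+ (suc k) i j = δ-+ k i j

  ∑-δ : ∀ n k (f : ℕ → V) → k < n → ∑ n (λ i → f i ⊠ δ k i) ≡ f k
  ∑-δ (suc n) zero    f _ = trans (cong₂ _⊞_ (⊠-identityʳ (f 0)) (∑-zero n (λ i _ → ⊠-zeroʳ (f (suc i))))) (⊞-identityʳ (f 0))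
  ∑-δ (suc n) (suc k) f k<n = trans (cong₂ _⊞_ (⊠-zeroʳ (f 0)) (∑-δ n k (f ∘ suc) (s<s⁻¹ k<n))) (⊞-identityˡ _)

  δ-sym : ∀ i j → δ i j ≡ δ j i
  δ-sym zero    zero    = refl
  δ-sym zero    (suc j) = refl
  δ-sym (suc i) zero    = refl
  δ-sym (suc i) (suc j) = δ-sym i j

  -- This is the pairing of the product f g with t, written without forming the product. Taking t =
  -- `δ q` reads off a coefficient, so `conv` needs no bookkeeping of index ranges.
  ∑₂ : ℕ → (f g t : ℕ → V) → V
  ∑₂ n f g t = ∑ n (λ i → f i ⊠ ∑ n (λ j → g j ⊠ t (i + j)))

  conv : ℕ → (f g : ℕ → V) → ℕ → V
  conv n f g q = ∑₂ n f g (δ q)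

  ∑-conv : ∀ {n l} f g t → n + n ≤ l → ∑ l (λ q → conv n f g q ⊠ t q) ≡ ∑₂ n f g t
  ∑-conv {n} {l} f g t n+n≤l = begin
    ∑ l (λ q → ∑ n (λ i → f i ⊠ ∑ n (λ j → g j ⊠ δ q (i + j))) ⊠ t q)
      ≡⟨ ∑-ext l (λ q → trans (∑-⊠ʳ n (t q) _) (∑-ext n (λ i → ⊠-assoc (f i) _ (t q)))) ⟩
    ∑ l (λ q → ∑ n (λ i → f i ⊠ (∑ n (λ j → g j ⊠ δ q (i + j)) ⊠ t q)))
      ≡⟨ trans (∑-swap l n _) (∑-ext n (λ i → sym (∑-⊠ˡ l (f i) _))) ⟩
    ∑ n (λ i → f i ⊠ ∑ l (λ q → ∑ n (λ j → g j ⊠ δ q (i + j)) ⊠ t q))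
      ≡⟨ ∑-cong n (λ i i<n → cong (f i ⊠_) (begin
           ∑ l (λ q → ∑ n (λ j → g j ⊠ δ q (i + j)) ⊠ t q)
             ≡⟨ ∑-ext l (λ q → trans (∑-⊠ʳ n (t q) _) (∑-ext n (λ j → ⊠-assoc (g j) _ (t q)))) ⟩
           ∑ l (λ q → ∑ n (λ j → g j ⊠ (δ q (i + j) ⊠ t q)))
             ≡⟨ trans (∑-swap l n _) (∑-ext n (λ j → sym (∑-⊠ˡ l (g j) _))) ⟩
           ∑ n (λ j → g j ⊠ ∑ l (λ q → δ q (i + j) ⊠ t q))
             ≡⟨ ∑-cong n (λ j j<n → cong (g j ⊠_) (trans
                  (∑-ext l (λ q → trans (⊠-comm _ (t q)) (cong (t q ⊠_) (δ-sym q (i + j)))))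
                  (∑-δ l (i + j) t (<-≤-trans (+-mono-<-≤ i<n (<⇒≤ j<n)) n+n≤l)))) ⟩
           ∑ n (λ j → g j ⊠ t (i + j)) ∎)) ⟩
    ∑₂ n f g t ∎
    where open ≡-Reasoning

-- Programs and their cost

infixl 1 _≫_
_≫_ : ∀ {V A B : Set} → Program V A → (A → Program V B) → Program V B
done a    ≫ k = k a
lit0 l    ≫ k = lit0 (λ z → l z ≫ k)
lit1 l    ≫ k = lit1 (λ z → l z ≫ k)
add x y l ≫ k = add x y (λ z → l z ≫ k)
sub x y l ≫ k = sub x y (λ z → l z ≫ k)
mul x y l ≫ k = mul x y (λ z → l z ≫ k)

-- A vector is a function on ℕ of which only the indices below its length matter. The default `a`
-- fills the rest and must be supplied, since a program cannot produce an element of an arbitrary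
-- type.
collect : ∀ {V A : Set} → A → ℕ → (ℕ → Program V A) → Program V (ℕ → A)
collect {V} {A} a zero    c = done (λ _ → a)
collect {V} {A} a (suc n) c = c 0 ≫ λ x → collect a n (c ∘ suc) ≫ λ xs → done (x ◂ xs)
  where
  _◂_ : A → (ℕ → A) → ℕ → A
  (x ◂ xs) zero    = x
  (x ◂ xs) (suc i) = xs i

opaque

  -- With offset 0 this cuts off or pads a vector, with a larger offset it multiplies by a power of
  -- x. Neither use costs an operation.
  slice : {A : Set} → A → ℕ → ℕ → (ℕ → A) → ℕ → A
  slice a o n f i with i <? o
  ... | yes _ = a
  ... | no _ with i <? o + n
  ...   | yes _ = f (i ∸ o)
  ...   | no _  = a

  slice-below : ∀ {A : Set} {a : A} {o n f i} → i < o → slice a o n f i ≡ a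
  slice-below {o = o} {i = i} i<o with i <? o
  ... | yes _  = refl
  ... | no i≮o = ⊥-elim (i≮o i<o)

  slice-inside : ∀ {A : Set} {a : A} {o n f i} → i < n → slice a o n f (o + i) ≡ f i
  slice-inside {o = o} {n} {f} {i} i<n with o + i <? o
  ... | yes lt = ⊥-elim (m+n≮m o i lt)
  ... | no _ with o + i <? o + n
  ...   | yes _ = cong f (m+n∸m≡n o i)
  ...   | no ≮  = ⊥-elim (≮ (+-monoʳ-< o i<n))

  slice-above : ∀ {A : Set} {a : A} {o n f i} → n ≤ i → slice a o n f (o + i) ≡ a
  slice-above {o = o} {n} {f} {i} n≤i with o + i <? o
  ... | yes lt = refl
  ... | no _ with o + i <? o + n
  ...   | yes lt = ⊥-elim (≤⇒≯ n≤i (+-cancelˡ-< o i n lt))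
  ...   | no _   = refl

module _ {V : Set} where

  add′ sub′ mul′ : V → V → Program V V
  add′ x y = add x y done
  sub′ x y = sub x y done
  mul′ x y = mul x y done

  sumᴾ : ℕ → (ℕ → V) → Program V V
  sumᴾ zero    f = lit0 done
  sumᴾ (suc n) f = sumᴾ n (f ∘ suc) ≫ add′ (f 0)

  tabulateᴾ : ℕ → (ℕ → Program V V) → Program V (ℕ → V)
  tabulateᴾ n c = lit0 (λ z → collect z n c)

  tabulate₂ᴾ : ℕ → ℕ → (ℕ → ℕ → Program V V) → Program V (ℕ → ℕ → V)
  tabulate₂ᴾ m n c = lit0 (λ z → collect (λ _ → z) m (λ i → tabulateᴾ n (c i)))

  -- x ^ o · f, where f has length n
  shiftᴾ : ℕ → ℕ → (ℕ → V) → Program V (ℕ → V)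
  shiftᴾ o n f = lit0 (λ z → done (slice z o n f))

module Semantics {V : Set} (R : RingOn V) where
  open RingOn R
  open Sums R

  value : ∀ {A} → Program V A → A
  value (done a)    = a
  value (lit0 k)    = value (k 𝟘)
  value (lit1 k)    = value (k 𝟙)
  value (add x y k) = value (k (x ⊞ y))
  value (sub x y k) = value (k (x ⊟ y))
  value (mul x y k) = value (k (x ⊠ y))

  ops : ∀ {A} → Program V A → ℕ
  ops (done a)    = 0
  ops (lit0 k)    = ops (k 𝟘)
  ops (lit1 k)    = ops (k 𝟙)
  ops (add x y k) = suc (ops (k (x ⊞ y)))
  ops (sub x y k) = suc (ops (k (x ⊟ y)))
  ops (mul x y k) = suc (ops (k (x ⊠ y)))

  value-≫ : ∀ {A B} (p : Program V A) (k : A → Program V B) → value (p ≫ k) ≡ value (k (value p))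
  value-≫ (done a)    k = refl
  value-≫ (lit0 l)    k = value-≫ (l 𝟘) k
  value-≫ (lit1 l)    k = value-≫ (l 𝟙) k
  value-≫ (add x y l) k = value-≫ (l (x ⊞ y)) k
  value-≫ (sub x y l) k = value-≫ (l (x ⊟ y)) k
  value-≫ (mul x y l) k = value-≫ (l (x ⊠ y)) k

  ops-≫ : ∀ {A B} (p : Program V A) (k : A → Program V B) → ops (p ≫ k) ≡ ops p + ops (k (value p))
  ops-≫ (done a)    k = refl
  ops-≫ (lit0 l)    k = ops-≫ (l 𝟘) k
  ops-≫ (lit1 l)    k = ops-≫ (l 𝟙) k
  ops-≫ (add x y l) k = cong suc (ops-≫ (l (x ⊞ y)) k)
  ops-≫ (sub x y l) k = cong suc (ops-≫ (l (x ⊟ y)) k)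
  ops-≫ (mul x y l) k = cong suc (ops-≫ (l (x ⊠ y)) k)

  record Spec {A : Set} (p : Program V A) (Q : A → Set) (c : ℕ) : Set where
    constructor spec
    field
      correct : Q (value p)
      bounded : ops p ≤ c
  open Spec public

  spec-done : ∀ {A} {a : A} {Q : A → Set} → Q a → Spec (done a) Q 0
  spec-done q = spec q z≤n

  spec-lit0 : ∀ {A} {k : V → Program V A} {Q c} → Spec (k 𝟘) Q c → Spec (lit0 k) Q c
  spec-lit0 (spec q b) = spec q b

  spec-lit1 : ∀ {A} {k : V → Program V A} {Q c} → Spec (k 𝟙) Q c → Spec (lit1 k) Q c
  spec-lit1 (spec q b) = spec q b

  spec-add : ∀ x y → Spec (add′ x y) (_≡ x ⊞ y) 1
  spec-add x y = spec refl ≤-refl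

  spec-sub : ∀ x y → Spec (sub′ x y) (_≡ x ⊟ y) 1
  spec-sub x y = spec refl ≤-refl

  spec-mul : ∀ x y → Spec (mul′ x y) (_≡ x ⊠ y) 1
  spec-mul x y = spec refl ≤-refl

  infixl 1 _⟫_
  -- The sequencing rule of a Hoare logic with costs. The continuation is verified for every `a`
  -- satisfying `Q`, so correctness proofs follow the shape of the programs.
  _⟫_ : ∀ {A B} {p : Program V A} {k : A → Program V B} {Q Q′ c c′} →
        Spec p Q c → (∀ a → Q a → Spec (k a) Q′ c′) → Spec (p ≫ k) Q′ (c + c′)
  _⟫_ {p = p} {k} {Q′ = Q′} (spec q b) s = spec
    (subst Q′ (sym (value-≫ p k)) (correct (s (value p) q)))
    (≤-trans (≤-reflexive (ops-≫ p k)) (+-mono-≤ b (bounded (s (value p) q))))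

  weaken : ∀ {A} {p : Program V A} {Q Q′ c c′} → (∀ a → Q a → Q′ a) → c ≤ c′ → Spec p Q c → Spec p Q′ c′
  weaken imp c≤c′ (spec q b) = spec (imp _ q) (≤-trans b c≤c′)

  spec-collect : ∀ {A} (a : A) n {c : ℕ → Program V A} {Q : ℕ → A → Set} {b} →
                 (∀ i → i < n → Spec (c i) (Q i) b) →
                 Spec (collect a n c) (λ v → ∀ i → i < n → Q i (v i)) (n * b)
  spec-collect a zero    s = spec-done (λ _ ())
  spec-collect a (suc n) {c} {Q} {b} s = weaken (λ _ q → q) (≤-reflexive (cong (b +_) (+-identityʳ (n * b))))
    (s 0 z<s ⟫ λ x qx → spec-collect a n (λ i i<n → s (suc i) (s<s i<n)) ⟫ λ xs qxs →
      spec-done λ { zero _ → qx ; (suc i) i<n → qxs i (s<s⁻¹ i<n) })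

  spec-sum : ∀ n f → Spec (sumᴾ n f) (_≡ ∑ n f) n
  spec-sum zero    f = spec-lit0 (spec-done refl)
  spec-sum (suc n) f = weaken (λ _ q → q) (≤-reflexive (+-comm n 1))
    (spec-sum n (f ∘ suc) ⟫ λ { _ refl → spec-add (f 0) _ })

  spec-tabulate : ∀ n {c : ℕ → Program V V} {v : ℕ → V} {b} → (∀ i → i < n → Spec (c i) (_≡ v i) b) →
                  Spec (tabulateᴾ n c) (λ w → ∀ i → i < n → w i ≡ v i) (n * b)
  spec-tabulate n s = spec-lit0 (spec-collect 𝟘 n s)

  spec-tabulate₂ : ∀ m n {c : ℕ → ℕ → Program V V} {v : ℕ → ℕ → V} {b} →
                   (∀ i j → i < m → j < n → Spec (c i j) (_≡ v i j) b) →
                   Spec (tabulate₂ᴾ m n c) (λ w → ∀ i → i < m → ∀ j → j < n → w i j ≡ v i j) (m * (n * b))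
  spec-tabulate₂ m n s = spec-lit0 (spec-collect (λ _ → 𝟘) m
    (λ i i<m → spec-tabulate n (λ j j<n → s i j i<m j<n)))

  -- The entries may have any type `A` because in `pair-blocks` the sliced vector consists of whole
  -- blocks rather than ring elements.
  ∑-slice : ∀ {A : Set} (F : A → ℕ → V) {a o n l} f → o + n ≤ l → (∀ i → F a i ≡ 𝟘) →
            ∑ l (λ i → F (slice a o n f i) i) ≡ ∑ n (λ i → F (f i) (o + i))
  ∑-slice F {a} {o} {n} {l} f o+n≤l Fa≡𝟘 = begin
    ∑ l G                          ≡⟨ cong (λ l → ∑ l G) (trans (sym (m+[n∸m]≡n o+n≤l)) (+-assoc o n r)) ⟩
    ∑ (o + (n + r)) G              ≡⟨ ∑-+ o (n + r) G ⟩
    ∑ o G ⊞ ∑ (n + r) (λ i → G (o + i))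
      ≡⟨ cong₂ _⊞_ (∑-zero o (λ i i<o → trans (cong (λ v → F v i) (slice-below {n = n} {f} i<o)) (Fa≡𝟘 i))) (∑-+ n r _) ⟩
    𝟘 ⊞ (∑ n (λ i → G (o + i)) ⊞ ∑ r (λ i → G (o + (n + i))))
      ≡⟨ ⊞-identityˡ _ ⟩
    ∑ n (λ i → G (o + i)) ⊞ ∑ r (λ i → G (o + (n + i)))
      ≡⟨ cong₂ _⊞_ (∑-cong n (λ i i<n → cong (λ v → F v (o + i)) (slice-inside {o = o} {f = f} i<n)))
           (∑-zero r (λ i _ → trans (cong (λ v → F v (o + (n + i))) (slice-above {o = o} {f = f} (m≤m+n n i))) (Fa≡𝟘 _))) ⟩
    ∑ n (λ i → F (f i) (o + i)) ⊞ 𝟘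
      ≡⟨ ⊞-identityʳ _ ⟩
    ∑ n (λ i → F (f i) (o + i)) ∎
    where
    open ≡-Reasoning
    r = l ∸ (o + n)
    G : ℕ → V
    G i = F (slice a o n f i) i

-- The Fourier transform

[m*n+o]/n≡m : ∀ m n o .{{_ : NonZero n}} → o < n → (m * n + o) / n ≡ m
[m*n+o]/n≡m m n o o<n = begin
  (m * n + o) / n    ≡⟨ cong (_/ n) (+-comm (m * n) o) ⟩
  (o + m * n) / n    ≡⟨ [m+kn]/n≡m/n+k ⟩
  o / n + m          ≡⟨ cong (_+ m) (m<n⇒m/n≡0 o<n) ⟩
  m                  ∎
  where
  open ≡-Reasoning
  [m+kn]/n≡m/n+k : (o + m * n) / n ≡ o / n + m
  [m+kn]/n≡m/n+k = trans (+-distrib-/-∣ʳ o (divides-refl m)) (cong (o / n +_) (m*n/n≡m m n))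

[m*n+o]%n≡o : ∀ m n o .{{_ : NonZero n}} → o < n → (m * n + o) % n ≡ o
[m*n+o]%n≡o m n o o<n = trans (cong (_% n) (+-comm (m * n) o)) (trans ([m+kn]%n≡m%n o m n) (m<n⇒m%n≡m o<n))

module FFTProgram {V : Set} (p M : ℕ) .{{_ : NonZero p}} .{{_ : NonZero M}} where

  -- Vectors of length M stand for elements of R[y]/(y^M - 1); this is y^n · v.
  rotate : ℕ → (ℕ → V) → ℕ → V
  rotate n v i = v ((i + n * pred M) % M)

  -- Reduction modulo z^L - y^e: z^(q L + j) becomes y^(q e) z^j, and multiplying by a power of y is
  -- a mere rotation.
  foldᴾ : ℕ → ℕ → (ℕ → ℕ → V) → Program V (ℕ → ℕ → V)
  foldᴾ L e f = tabulate₂ᴾ L M (λ j a → sumᴾ p (λ q → rotate (q * e) (f (q * L + j)) a))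

  -- When M = p^(s+1) D, the element y^(p^s D) = y^m is a p-th root of unity, so z^(p^(s+1)) -
  -- y^(p^(s+1) x) splits into the factors z^(p^s) - y^(p^s (x + i D)), one for each branch i.
  branchExponent : ℕ → ℕ → ℕ → ℕ → ℕ
  branchExponent s D x i = p ^ s * (x + i * D)

  -- y ^ unbranchExponent is the inverse of the q-th power of y ^ branchExponent, since y^M = 1.
  unbranchExponent : ℕ → ℕ → ℕ → ℕ → ℕ → ℕ
  unbranchExponent s D x i q = q * (p ^ s * x) * pred M + (p ∸ q) * i * (p ^ s * D)

  -- Chinese remaindering without its division by p. The polynomial ∑_q (z^L / y^e)^q, where L = p^s
  -- and e is the exponent of branch i, equals p modulo the i-th factor and 0 modulo the others.
  unfoldᴾ : ℕ → ℕ → ℕ → (ℕ → ℕ → ℕ → V) → Program V (ℕ → ℕ → V)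
  unfoldᴾ s D x h = tabulate₂ᴾ (p ^ suc s) M (λ J a → sumᴾ p (λ i →
    rotate (unbranchExponent s D x i (J / p ^ s)) (h i (J % p ^ s)) a))
    where instance _ = m^n≢0 p s

  module _ (mulA : (ℕ → V) → (ℕ → V) → Program V (ℕ → V)) where

    -- p^s times the product modulo z ^ p^s - y ^ (p^s · x), where M = p^s · D.
    fftᴾ : ℕ → ℕ → ℕ → (f g : ℕ → ℕ → V) → Program V (ℕ → ℕ → V)
    branchᴾ : ℕ → ℕ → ℕ → (f g : ℕ → ℕ → V) → ℕ → Program V (ℕ → ℕ → V)

    fftᴾ zero    D x f g = mulA (f 0) (g 0) ≫ λ h → done (λ _ → h)
    fftᴾ (suc s) D x f g = collect f p (branchᴾ s D x f g) ≫ unfoldᴾ s D x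

    branchᴾ s D x f g i =
      foldᴾ (p ^ s) (branchExponent s D x i) f ≫ λ f′ →
      foldᴾ (p ^ s) (branchExponent s D x i) g ≫ λ g′ →
      fftᴾ s (p * D) (x + i * D) f′ g′

-- Correctness of the transform, by pairing with test functions.

module FFT {V : Set} (R : RingOn V) (p m M : ℕ) .{{_ : NonZero p}} .{{_ : NonZero M}} (M≡pm : M ≡ p * m) where
  open RingOn R
  open Sums R
  open Semantics R
  open FFTProgram {V} p M

  pair : ℕ → (ℕ → ℕ → V) → (ℕ → ℕ → V) → V
  pair L h κ = ∑ L (λ j → ∑ M (λ a → h j a ⊠ κ a j))

  -- The test function κ applied to the product f g of two polynomials in y and z; κ a j is its
  -- value at y^a z^j.
  pairing₂ : ℕ → (f g κ : ℕ → ℕ → V) → V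
  pairing₂ L f g κ = pair L f (λ a j → pair L g (λ a′ j′ → κ (a + a′) (j + j′)))

  pair-cong : ∀ L {h h′ κ κ′} → (∀ j → j < L → ∀ a → a < M → h j a ≡ h′ j a) →
              (∀ a j → κ a j ≡ κ′ a j) → pair L h κ ≡ pair L h′ κ′
  pair-cong L h≡ κ≡ = ∑-cong L (λ j j<L → ∑-cong M (λ a a<M → cong₂ _⊠_ (h≡ j j<L a a<M) (κ≡ a j)))

  pair-ext : ∀ L {h κ κ′} → (∀ a j → κ a j ≡ κ′ a j) → pair L h κ ≡ pair L h κ′
  pair-ext L = pair-cong L (λ _ _ _ _ → refl)

  pair-∑ : ∀ L n h (κ : ℕ → ℕ → ℕ → V) → pair L h (λ a j → ∑ n (λ i → κ i a j)) ≡ ∑ n (λ i → pair L h (κ i))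
  pair-∑ L n h κ = begin
    ∑ L (λ j → ∑ M (λ a → h j a ⊠ ∑ n (λ i → κ i a j)))
      ≡⟨ ∑-ext L (λ j → trans (∑-ext M (λ a → ∑-⊠ˡ n (h j a) _)) (∑-swap M n _)) ⟩
    ∑ L (λ j → ∑ n (λ i → ∑ M (λ a → h j a ⊠ κ i a j)))
      ≡⟨ ∑-swap L n _ ⟩
    ∑ n (λ i → pair L h (κ i)) ∎
    where open ≡-Reasoning

  pair-⊠ : ∀ L c h κ → pair L h (λ a j → c ⊠ κ a j) ≡ c ⊠ pair L h κ
  pair-⊠ L c h κ = sym (trans (∑-⊠ˡ L c _) (∑-ext L (λ j → trans (∑-⊠ˡ M c _) (∑-ext M (λ a →
    solve 3 (λ c x y → c :* (x :* y) := x :* (c :* y)) refl c (h j a) (κ a j))))))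
    where open RingSolver using (solve; _:=_; _:*_)

  pairing₂-∑ : ∀ L n f g (κ : ℕ → ℕ → ℕ → V) →
               pairing₂ L f g (λ a j → ∑ n (λ i → κ i a j)) ≡ ∑ n (λ i → pairing₂ L f g (κ i))
  pairing₂-∑ L n f g κ = trans
    (pair-ext L (λ a j → pair-∑ L n g (λ i a′ j′ → κ i (a + a′) (j + j′))))
    (pair-∑ L n f _)

  pairing₂-⊠ : ∀ L c f g κ → pairing₂ L f g (λ a j → c ⊠ κ a j) ≡ c ⊠ pairing₂ L f g κ
  pairing₂-⊠ L c f g κ = trans
    (pair-ext L (λ a j → pair-⊠ L c g (λ a′ j′ → κ (a + a′) (j + j′))))
    (pair-⊠ L c f _)

  pairing₂-ext : ∀ L {f g κ κ′} → (∀ a j → κ a j ≡ κ′ a j) → pairing₂ L f g κ ≡ pairing₂ L f g κ′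
  pairing₂-ext L κ≡ = pair-ext L (λ a j → pair-ext L (λ a′ j′ → κ≡ (a + a′) (j + j′)))

  Periodic : (ℕ → V) → Set
  Periodic φ = ∀ a → φ (a + M) ≡ φ a

  periodic-* : ∀ {φ} → Periodic φ → ∀ k a → φ (a + k * M) ≡ φ a
  periodic-* {φ} per zero    a = cong φ (+-identityʳ a)
  periodic-* {φ} per (suc k) a = trans (cong φ (sym (+-assoc a M (k * M)))) (trans (periodic-* per k (a + M)) (per a))

  periodic-≡ : ∀ {φ} → Periodic φ → ∀ k {a b} → a ≡ b + k * M → φ a ≡ φ b
  periodic-≡ {φ} per k {a} {b} eq = trans (cong φ eq) (periodic-* per k b)

  private
    -- Adding n (M - 1) stands for subtracting n modulo M, which avoids truncated subtraction.
    pred-shift : ∀ i n → i + n * pred M + n ≡ i + n * M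
    pred-shift i n = trans (rearrange i n (pred M)) (cong (λ k → i + n * k) (suc-pred M))
      where
      rearrange : ∀ i n k → i + n * k + n ≡ i + n * suc k
      rearrange = ℕSolver.solve-∀

  -- Multiplication by y^n moves from the vector to the test function, where it is a shift. Both
  -- factors have period M, so the sum may be rotated.
  ∑-rotate-pair : ∀ n v {κ} → Periodic κ → ∑ M (λ i → rotate n v i ⊠ κ i) ≡ ∑ M (λ i → v i ⊠ κ (i + n))
  ∑-rotate-pair n v {κ} per = begin
    ∑ M (λ i → v ((i + n * pred M) % M) ⊠ κ i)
      ≡⟨ ∑-ext M (λ i → cong (v ((i + n * pred M) % M) ⊠_) (sym (periodic-≡ per n (pred-shift i n)))) ⟩
    ∑ M (λ i → φ (i + n * pred M))
      ≡⟨ ∑-rotate M (n * pred M) (λ i → cong₂ _⊠_ (cong v ([m+n]%n≡m%n i M))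
           (trans (cong κ (swap i M n)) (per (i + n)))) ⟩
    ∑ M φ
      ≡⟨ ∑-cong M (λ i i<M → cong (λ k → v k ⊠ κ (i + n)) (m<n⇒m%n≡m i<M)) ⟩
    ∑ M (λ i → v i ⊠ κ (i + n)) ∎
    where
    open ≡-Reasoning
    φ : ℕ → V
    φ i = v (i % M) ⊠ κ (i + n)
    swap : ∀ i M n → i + M + n ≡ i + n + M
    swap = ℕSolver.solve-∀

  Wraps : ℕ → ℕ → (ℕ → ℕ → V) → Set
  Wraps L e κ = ∀ a j → κ a (j + L) ≡ κ (a + e) j

  wraps-* : ∀ {L e κ} → Wraps L e κ → ∀ q a j → κ a (q * L + j) ≡ κ (a + q * e) j
  wraps-* {L} {e} {κ} w zero    a j = cong (λ a → κ a j) (sym (+-identityʳ a))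
  wraps-* {L} {e} {κ} w (suc q) a j = begin
    κ a (L + q * L + j)      ≡⟨ cong (κ a) (rearrange L (q * L) j) ⟩
    κ a (q * L + j + L)      ≡⟨ w a (q * L + j) ⟩
    κ (a + e) (q * L + j)    ≡⟨ wraps-* {L} {e} {κ} w q (a + e) j ⟩
    κ (a + e + q * e) j      ≡⟨ cong (λ a → κ a j) (+-assoc a e (q * e)) ⟩
    κ (a + (e + q * e)) j    ∎
    where
    open ≡-Reasoning
    rearrange : ∀ x y z → x + y + z ≡ y + z + x
    rearrange = ℕSolver.solve-∀

  -- A test function annihilated by z^L - y^e cannot notice reduction modulo z^L - y^e.
  pair-fold : ∀ L e f {κ} → (∀ j → Periodic (λ a → κ a j)) → Wraps L e κ →
              pair L (λ j a → ∑ p (λ q → rotate (q * e) (f (q * L + j)) a)) κ ≡ pair (p * L) f κ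
  pair-fold L e f {κ} per wraps = begin
    ∑ L (λ j → ∑ M (λ a → ∑ p (λ q → rotate (q * e) (f (q * L + j)) a) ⊠ κ a j))
      ≡⟨ ∑-ext L (λ j → trans (∑-ext M (λ a → ∑-⊠ʳ p (κ a j) _)) (∑-swap M p _)) ⟩
    ∑ L (λ j → ∑ p (λ q → ∑ M (λ a → rotate (q * e) (f (q * L + j)) a ⊠ κ a j)))
      ≡⟨ ∑-swap L p _ ⟩
    ∑ p (λ q → ∑ L (λ j → ∑ M (λ a → rotate (q * e) (f (q * L + j)) a ⊠ κ a j)))
      ≡⟨ ∑-ext p (λ q → ∑-ext L (λ j → trans (∑-rotate-pair (q * e) (f (q * L + j)) (per j))
           (∑-ext M (λ a → cong (f (q * L + j) a ⊠_) (sym (wraps-* {L} {e} {κ} wraps q a j)))))) ⟩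
    ∑ p (λ q → ∑ L (λ j → ∑ M (λ a → f (q * L + j) a ⊠ κ a (q * L + j))))
      ≡⟨ ∑-* p L _ ⟨
    pair (p * L) f κ ∎
    where open ≡-Reasoning

  -- Test functions on the powers y^a z^j that vanish on the ideal generated by
  -- Φ(y) = ∑_{i<p} y^(i m) (and its conjugates) and z ^ L - y ^ e.
  record Kernel (L e : ℕ) (κ : ℕ → ℕ → V) : Set where
    field
      periodic : ∀ j → Periodic (λ a → κ a j)
      wraps    : Wraps L e κ
      roots    : ∀ r → 0 < r → r < p → ∀ a j → ∑ p (λ i → κ (a + r * i * m) j) ≡ 𝟘

  P : V
  P = ∑ p (λ _ → 𝟙)

  IsCyclicProduct : V → (f g h : ℕ → V) → Set
  IsCyclicProduct c f g h = ∀ κ → Periodic κ →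
    ∑ M (λ a → h a ⊠ κ a) ≡ c ⊠ ∑ M (λ a → f a ⊠ ∑ M (λ b → g b ⊠ κ (a + b)))

  module Step (s D x : ℕ) (M≡ : M ≡ p ^ suc s * D) {κ : ℕ → ℕ → V} (kernel : Kernel (p ^ suc s) (p ^ suc s * x) κ) where
    open Kernel kernel

    private
      L e′ : ℕ
      L  = p ^ s
      e′ = L * x
      e : ℕ → ℕ
      e = branchExponent s D x
      n : ℕ → ℕ → ℕ
      n = unbranchExponent s D x

      m≡ : L * D ≡ m
      m≡ = *-cancelˡ-≡ (L * D) m p (trans (sym (*-assoc p L D)) (trans (sym M≡) M≡pm))

      M≡pLD : M ≡ p * (L * D)
      M≡pLD = trans M≡ (*-assoc p L D)

    -- κ multiplied by the Lagrange polynomial ∑_q (z^L / y^(e i))^q of the i-th factor.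
    κᵢ : ℕ → ℕ → ℕ → V
    κᵢ i a j = ∑ p (λ q → κ (a + n i q) (q * L + j))

    private
      -- Modulo M, passing from q to q + 1 divides by one more y^(e i). Together with the two end
      -- cases below this makes the sum over q in `κᵢ` cyclic.
      n-suc : ∀ i q a → q < p → a + n i q + e′ * M ≡ a + e i + n i (suc q)
      n-suc i q a q<p = begin
        a + n i q + e′ * M
          ≡⟨ cong₂ (λ k r → a + (q * e′ * pred M + r * i * (L * D)) + e′ * k) (sym (suc-pred M)) p∸q ⟩
        a + (q * e′ * pred M + suc (p ∸ suc q) * i * (L * D)) + e′ * suc (pred M)
          ≡⟨ rearrange a q L x D (pred M) i (p ∸ suc q) ⟩
        a + e i + n i (suc q) ∎
        where
        open ≡-Reasoning
        p∸q : p ∸ q ≡ suc (p ∸ suc q)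
        p∸q = +-∸-assoc 1 q<p
        rearrange : ∀ a q L x D M₁ i r →
          a + (q * (L * x) * M₁ + suc r * i * (L * D)) + L * x * suc M₁ ≡
          a + L * (x + i * D) + (suc q * (L * x) * M₁ + r * i * (L * D))
        rearrange = ℕSolver.solve-∀

      n-zero : ∀ i a → a + n i 0 ≡ a + i * M
      n-zero i a = trans (rearrange a p i (L * D)) (cong (λ k → a + i * k) (sym M≡pLD))
        where
        rearrange : ∀ a p i k → a + (0 + p * i * k) ≡ a + i * (p * k)
        rearrange = ℕSolver.solve-∀

      n-last : ∀ i a → a + n i p + p ^ suc s * x ≡ a + (p * e′) * M
      n-last i a = begin
        a + (p * e′ * pred M + (p ∸ p) * i * (L * D)) + p * L * x
          ≡⟨ cong (λ r → a + (p * e′ * pred M + r * i * (L * D)) + p * L * x) (n∸n≡0 p) ⟩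
        a + (p * e′ * pred M + 0) + p * L * x
          ≡⟨ rearrange a p L x (pred M) ⟩
        a + (p * e′) * suc (pred M)
          ≡⟨ cong (λ k → a + (p * e′) * k) (suc-pred M) ⟩
        a + (p * e′) * M ∎
        where
        open ≡-Reasoning
        rearrange : ∀ a p L x M₁ → a + (p * (L * x) * M₁ + 0) + p * L * x ≡ a + (p * (L * x)) * suc M₁
        rearrange = ℕSolver.solve-∀

    -- Since p · `e i` = p L x + i M, multiplying the Lagrange polynomial by z^L - y^(e i) gives, up
    -- to a power of y, z^(p L) - y^(p L x), which κ annihilates. On the level of sums, raising j by
    -- L moves q to q + 1 cyclically.
    κᵢ-kernel : ∀ i → Kernel L (L * (x + i * D)) (κᵢ i)
    κᵢ-kernel i = record
      { periodic = λ j a → ∑-ext p (λ q → trans (cong (λ b → κ b (q * L + j)) (swap a M (n i q))) (periodic _ _))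
      ; wraps = λ a j → trans
          (∑-cong p (λ q q<p → trans
            (cong (κ (a + n i q)) (swap′ (q * L) j L))
            (sym (periodic-≡ (periodic _) e′ (sym (n-suc i q a q<p))))))
          (∑-shift p (trans
            (trans (cong (κ (a + e i + n i p)) (+-comm (p * L) j))
              (trans (wraps (a + e i + n i p) j) (periodic-≡ (periodic j) (p * e′) (n-last i (a + e i)))))
            (sym (periodic-≡ (periodic j) i (n-zero i (a + e i))))))
      ; roots = λ r 0<r r<p a j → trans (∑-swap p p _) (∑-zero p (λ q _ → trans
          (∑-ext p (λ k → cong (λ b → κ b (q * L + j)) (swap a (r * k * m) (n i q))))
          (roots r 0<r r<p (a + n i q) (q * L + j))))
      }
      where
      swap : ∀ a b c → a + b + c ≡ a + c + b
      swap = ℕSolver.solve-∀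
      swap′ : ∀ a j l → a + (j + l) ≡ l + a + j
      swap′ = ℕSolver.solve-∀

    -- For q > 0 the sum over i runs through the powers of y^((p - q) m) and is killed by `roots`
    -- with r = p - q. The terms with q = 0 are p copies of κ.
    ∑-κᵢ : ∀ a j → ∑ p (λ i → κᵢ i a j) ≡ P ⊠ κ a j
    ∑-κᵢ a j = begin
      ∑ p (λ i → ∑ p (λ q → κ (a + n i q) (q * L + j)))
        ≡⟨ ∑-swap p p _ ⟩
      ∑ p (λ q → ∑ p (λ i → κ (a + n i q) (q * L + j)))
        ≡⟨ head p (λ q 0<q q<p → trans
             (∑-ext p (λ i → cong (λ b → κ b (q * L + j)) (n-split i q)))
             (roots (p ∸ q) (m<n⇒0<n∸m q<p) (∸-monoʳ-< 0<q (<⇒≤ q<p)) (a + q * e′ * pred M) (q * L + j))) ⟩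
      ∑ p (λ i → κ (a + n i 0) j)
        ≡⟨ ∑-ext p (λ i → trans (periodic-≡ (periodic j) i (n-zero i a)) (sym (⊠-identityˡ _))) ⟩
      ∑ p (λ i → 𝟙 ⊠ κ a j)
        ≡⟨ ∑-⊠ʳ p (κ a j) (λ _ → 𝟙) ⟨
      P ⊠ κ a j ∎
      where
      open ≡-Reasoning
      n-split : ∀ i q → a + n i q ≡ a + q * e′ * pred M + (p ∸ q) * i * m
      n-split i q = trans (sym (+-assoc a _ _)) (cong (λ k → a + q * e′ * pred M + (p ∸ q) * i * k) m≡)
      head : ∀ k .{{_ : NonZero k}} {f} → (∀ q → 0 < q → q < k → f q ≡ 𝟘) → ∑ k f ≡ f 0
      head (suc k) {f} z = trans (cong (f 0 ⊞_) (∑-zero k (λ i i<k → z (suc i) z<s (s<s i<k)))) (⊞-identityʳ (f 0))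

    module _ (f g : ℕ → ℕ → V) where

      fold : (ℕ → ℕ → V) → ℕ → ℕ → ℕ → V
      fold f i j a = ∑ p (λ q → rotate (q * e i) (f (q * L + j)) a)

      pairing₂-fold : ∀ i → pairing₂ L (fold f i) (fold g i) (κᵢ i) ≡ pairing₂ (p * L) f g (κᵢ i)
      pairing₂-fold i = trans
        (pair-ext L (λ a j → pair-fold L (e i) g
          (λ j′ a′ → trans (cong (λ b → κᵢ i b (j + j′)) (sym (+-assoc a a′ M))) (per _ (a + a′)))
          (λ a′ j′ → trans (cong (κᵢ i (a + a′)) (sym (+-assoc j j′ L)))
            (trans (wr (a + a′) (j + j′)) (cong (λ b → κᵢ i b (j + j′)) (+-assoc a a′ (e i)))))))
        (pair-fold L (e i) f
          (λ j a → pair-ext (p * L) (λ a′ j′ → trans (cong (λ b → κᵢ i b (j + j′)) (swap a M a′)) (per _ (a + a′))))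
          (λ a j → pair-ext (p * L) (λ a′ j′ → trans (cong (κᵢ i (a + a′)) (swap j L j′))
            (trans (wr (a + a′) (j + j′)) (cong (λ b → κᵢ i b (j + j′)) (swap a a′ (e i)))))))
        where
        open Kernel (κᵢ-kernel i) using () renaming (periodic to per; wraps to wr)
        swap : ∀ a b c → a + b + c ≡ a + c + b
        swap = ℕSolver.solve-∀

    -- `unfoldᴾ` is the transpose of κ ↦ `κᵢ`: the Lagrange polynomial moves from the results of the
    -- branches to the test function.
    pair-unfold : ∀ (h : ℕ → ℕ → ℕ → V) {w} →
      (∀ J → J < p ^ suc s → ∀ a → a < M →
        w J a ≡ ∑ p (λ i → rotate (n i ((J / L) {{m^n≢0 p s}})) (h i ((J % L) {{m^n≢0 p s}})) a)) →
      pair (p ^ suc s) w κ ≡ ∑ p (λ i → pair L (h i) (κᵢ i))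
    pair-unfold h {w} w≡ = begin
      ∑ (p * L) (λ J → ∑ M (λ a → w J a ⊠ κ a J))
        ≡⟨ ∑-cong (p * L) (λ J J<L → ∑-cong M (λ a a<M → cong (_⊠ κ a J) (w≡ J J<L a a<M))) ⟩
      ∑ (p * L) (λ J → ∑ M (λ a → ∑ p (λ i → rotate (n i (J / L)) (h i (J % L)) a) ⊠ κ a J))
        ≡⟨ ∑-* p L _ ⟩
      ∑ p (λ q → ∑ L (λ j → ∑ M (λ a →
        ∑ p (λ i → rotate (n i ((q * L + j) / L)) (h i ((q * L + j) % L)) a) ⊠ κ a (q * L + j))))
        ≡⟨ ∑-ext p (λ q → ∑-cong L (λ j j<L → ∑-ext M (λ a → cong (_⊠ κ a (q * L + j)) (∑-ext p (λ i →
             cong₂ (λ u v → rotate (n i u) (h i v) a) ([m*n+o]/n≡m q L j j<L) ([m*n+o]%n≡o q L j j<L)))))) ⟩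
      ∑ p (λ q → ∑ L (λ j → ∑ M (λ a → ∑ p (λ i → rotate (n i q) (h i j) a) ⊠ κ a (q * L + j))))
        ≡⟨ ∑-ext p (λ q → trans (∑-ext L (λ j → trans (∑-ext M (λ a → ∑-⊠ʳ p _ _)) (∑-swap M p _))) (∑-swap L p _)) ⟩
      ∑ p (λ q → ∑ p (λ i → ∑ L (λ j → ∑ M (λ a → rotate (n i q) (h i j) a ⊠ κ a (q * L + j)))))
        ≡⟨ ∑-swap p p _ ⟩
      ∑ p (λ i → ∑ p (λ q → ∑ L (λ j → ∑ M (λ a → rotate (n i q) (h i j) a ⊠ κ a (q * L + j)))))
        ≡⟨ ∑-ext p (λ i → ∑-ext p (λ q → ∑-ext L (λ j → ∑-rotate-pair (n i q) (h i j) (periodic (q * L + j))))) ⟩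
      ∑ p (λ i → ∑ p (λ q → ∑ L (λ j → ∑ M (λ a → h i j a ⊠ κ (a + n i q) (q * L + j)))))
        ≡⟨ ∑-ext p (λ i → sym (pair-∑ L p (h i) (λ q a j → κ (a + n i q) (q * L + j)))) ⟩
      ∑ p (λ i → pair L (h i) (κᵢ i)) ∎
      where
      open ≡-Reasoning
      instance _ = m^n≢0 p s

  module _ {mulA : (ℕ → V) → (ℕ → V) → Program V (ℕ → V)} {c₀ : V} {b : ℕ}
           (spec-mulA : ∀ f g → Spec (mulA f g) (IsCyclicProduct c₀ f g) b) where

    IsProductModulo : ℕ → ℕ → V → (f g h : ℕ → ℕ → V) → Set
    IsProductModulo L e c f g h = ∀ κ → Kernel L e κ → pair L h κ ≡ c ⊠ pairing₂ L f g κ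

    spec-fold : ∀ L e f → Spec (foldᴾ L e f)
      (λ w → ∀ j → j < L → ∀ a → a < M → w j a ≡ ∑ p (λ q → rotate (q * e) (f (q * L + j)) a)) (L * (M * p))
    spec-fold L e f = spec-tabulate₂ L M (λ j a _ _ → spec-sum p _)

    -- Each level performs two folds and one unfold, which explains `3 * p * M` for each of the p^s
    -- rows, and contributes one factor `P`, which interpolation does not divide out.
    spec-fft : ∀ s D x f g → M ≡ p ^ s * D →
      Spec (fftᴾ mulA s D x f g) (IsProductModulo (p ^ s) (p ^ s * x) (P ^ᵣ s ⊠ c₀) f g) (p ^ s * (b + s * (3 * p * M)))
    spec-fft zero D x f g M≡ = weaken (λ _ q → q) (≤-reflexive (solve-bound b))
      (spec-mulA (f 0) (g 0) ⟫ λ h h-ok → spec-done λ κ κ-ker → begin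
        ∑ M (λ a → h a ⊠ κ a 0) ⊞ 𝟘
          ≡⟨ ⊞-identityʳ _ ⟩
        ∑ M (λ a → h a ⊠ κ a 0)
          ≡⟨ h-ok (λ a → κ a 0) (Kernel.periodic κ-ker 0) ⟩
        c₀ ⊠ ∑ M (λ a → f 0 a ⊠ ∑ M (λ b → g 0 b ⊠ κ (a + b) 0))
          ≡⟨ cong₂ _⊠_ (sym (⊠-identityˡ c₀)) (trans
               (∑-ext M (λ a → cong (f 0 a ⊠_) (sym (⊞-identityʳ _)))) (sym (⊞-identityʳ _))) ⟩
        (𝟙 ⊠ c₀) ⊠ pairing₂ 1 f g κ ∎)
      where
      open ≡-Reasoning
      solve-bound : ∀ b → b + 0 ≡ (b + 0) + 0
      solve-bound = ℕSolver.solve-∀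
    spec-fft (suc s) D x f g M≡ = weaken (λ _ q → q) (≤-reflexive (solve-bound p L M b s))
      (spec-collect f p {Q = λ i h → IsProductModulo L (L * (x + i * D)) C (fold′ f i) (fold′ g i) h} (λ i _ →
          spec-fold L (e i) f ⟫ λ f′ f′≡ →
          spec-fold L (e i) g ⟫ λ g′ g′≡ →
          weaken (λ h h-ok κ κ-ker → trans (h-ok κ κ-ker) (cong (C ⊠_)
                   (pair-cong L f′≡ (λ a j → pair-cong L g′≡ (λ _ _ → refl)))))
            ≤-refl (spec-fft s (p * D) (x + i * D) f′ g′ (trans M≡ (rearrange p L D))))
        ⟫ λ hs hs-ok → weaken (λ w w≡ κ κ-ker → let open Step s D x M≡ κ-ker in begin
          pair (p * L) w κ
            ≡⟨ pair-unfold hs w≡ ⟩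
          ∑ p (λ i → pair L (hs i) (κᵢ i))
            ≡⟨ ∑-cong p (λ i i<p → hs-ok i i<p (κᵢ i) (κᵢ-kernel i)) ⟩
          ∑ p (λ i → C ⊠ pairing₂ L (fold′ f i) (fold′ g i) (κᵢ i))
            ≡⟨ ∑-ext p (λ i → cong (C ⊠_) (pairing₂-fold f g i)) ⟩
          ∑ p (λ i → C ⊠ pairing₂ (p * L) f g (κᵢ i))
            ≡⟨ ∑-⊠ˡ p C _ ⟨
          C ⊠ ∑ p (λ i → pairing₂ (p * L) f g (κᵢ i))
            ≡⟨ cong (C ⊠_) (pairing₂-∑ (p * L) p f g κᵢ) ⟨
          C ⊠ pairing₂ (p * L) f g (λ a j → ∑ p (λ i → κᵢ i a j))
            ≡⟨ cong (C ⊠_) (pairing₂-ext (p * L) ∑-κᵢ) ⟩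
          C ⊠ pairing₂ (p * L) f g (λ a j → P ⊠ κ a j)
            ≡⟨ cong (C ⊠_) (pairing₂-⊠ (p * L) P f g κ) ⟩
          C ⊠ (P ⊠ pairing₂ (p * L) f g κ)
            ≡⟨ regroup (P ^ᵣ s) c₀ P _ ⟩
          (P ⊠ P ^ᵣ s ⊠ c₀) ⊠ pairing₂ (p * L) f g κ ∎)
          ≤-refl (spec-tabulate₂ (p * L) M (λ J a _ _ → spec-sum p _)))
      where
      open ≡-Reasoning
      open RingSolver using (solve; _:=_; _:*_)
      L = p ^ s
      e = branchExponent s D x
      C = P ^ᵣ s ⊠ c₀
      fold′ : (ℕ → ℕ → V) → ℕ → ℕ → ℕ → V
      fold′ f i j a = ∑ p (λ q → rotate (q * e i) (f (q * L + j)) a)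
      rearrange : ∀ p L D → p * L * D ≡ L * (p * D)
      rearrange = ℕSolver.solve-∀
      regroup : ∀ a c P z → (a ⊠ c) ⊠ (P ⊠ z) ≡ (P ⊠ a ⊠ c) ⊠ z
      regroup = solve 4 (λ a c P z → (a :* c) :* (P :* z) := (P :* a :* c) :* z) refl
      solve-bound : ∀ p L M b s →
        p * (L * (M * p) + (L * (M * p) + L * (b + s * (3 * p * M)))) + p * L * (M * p) ≡
        p * L * (b + suc s * (3 * p * M))
      solve-bound = ℕSolver.solve-∀

-- Schönhage's multiplication

schoolbookᴾ : {V : Set} → ℕ → ℕ → (f g : ℕ → V) → Program V (ℕ → V)
schoolbookᴾ n l f g =
  collect g n (λ i → tabulateᴾ n (λ j → mul′ (f i) (g j)) ≫ shiftᴾ i n) ≫ λ rows →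
  tabulateᴾ l (λ a → sumᴾ n (λ i → rows i a))

-- A polynomial of length p^k is cut into p^k₁ blocks of length B, which are
-- multiplied in R[y]/(∑_{i<p} y^(i m)), where y has order M = p m; their products
-- have length at most m, and K is more than the number of blocks of the product.
module SplitParameters (p k : ℕ) where
  k₁ k₂ s B m M D K : ℕ
  k₁ = ⌊ k /2⌋
  k₂ = ⌈ k /2⌉
  s  = suc k₁
  B  = p ^ k₂
  K  = p ^ s
  m  = p ^ (1 + k₂)
  M  = p ^ (2 + k₂)
  D  = p ^ (suc k₂ ∸ k₁)

schönhageExponent : ℕ → ℕ → ℕ
schönhageExponent zero    k = 0
schönhageExponent (suc t) k = suc ⌊ k /2⌋ + schönhageExponent t (2 + ⌈ k /2⌉)

schönhageCost : ℕ → ℕ → ℕ → ℕ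
schönhageCost p zero    k = p ^ k * p ^ k + p ^ (2 + k) * p ^ k
schönhageCost p (suc t) k =
  K * (schönhageCost p t (2 + k₂) + M * (p * p) + s * (3 * p * M)) + (K * (m * 1) + p ^ (2 + k) * p)
  where open SplitParameters p k

module SchönhageProgram {V : Set} (p : ℕ) .{{_ : NonZero p}} where

  module Split (k : ℕ) where
    open SplitParameters p k public

    blocks : V → (ℕ → V) → ℕ → ℕ → V
    blocks z f = slice (λ _ → z) 0 (p ^ k₁) (λ j → slice z 0 B (λ a → f (j * B + a)))

    instance
      nonZero-B : NonZero B
      nonZero-B = m^n≢0 p k₂
      nonZero-M : NonZero M
      nonZero-M = m^n≢0 p (2 + k₂)

    -- Reduction modulo y^M - 1 of a recursive product, whose length p^(2 + (2 + k₂)) is p p M.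
    wrapᴾ : (ℕ → V) → Program V (ℕ → V)
    wrapᴾ h = tabulateᴾ M (λ a → sumᴾ (p * p) (λ c → h (c * M + a)))

    -- Modulo Φ(y) the power y^((p-1) m + a) is minus the sum of the y^(i m + a) with i < p - 1.
    -- Coefficients from m on are not computed, because products of two blocks have length at most
    -- m.
    reduceᴾ : (ℕ → ℕ → V) → Program V (ℕ → ℕ → V)
    reduceᴾ h = tabulate₂ᴾ K m (λ j a → sub′ (h j a) (h j (pred p * m + a)))

    -- Substitutes y = x and z = x^B. The products of blocks have length p B and overlap. Cut into p
    -- pieces of length B, their q-th pieces lie side by side and form one row, so each coefficient
    -- is a sum over only p rows.
    recombineᴾ : (ℕ → ℕ → V) → Program V (ℕ → V)
    recombineᴾ r =
      collect (r 0) p (λ q → shiftᴾ (q * B) (K * B) (λ i → r (i / B) (q * B + i % B))) ≫ λ rows →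
      tabulateᴾ (p ^ (2 + k)) (λ n → sumᴾ p (λ q → rows q n))

  -- p^e f g, where e = schönhageExponent t k, for f and g of length p^k; the fuel t bounds the recursion depth.
  schönhageᴾ : ℕ → ℕ → (f g : ℕ → V) → Program V (ℕ → V)
  schönhageᴾ zero    k f g = schoolbookᴾ (p ^ k) (p ^ (2 + k)) f g
  schönhageᴾ (suc t) k f g =
    lit0 λ z →
    FFTProgram.fftᴾ p M (λ u v → schönhageᴾ t (2 + k₂) u v ≫ wrapᴾ) s D 0 (blocks z f) (blocks z g) ≫ λ h →
    reduceᴾ h ≫ recombineᴾ
    where open Split k

-- Correctness of Schönhage's multiplication.

module Schönhage {V : Set} (R : RingOn V) (p : ℕ) .{{_ : NonZero p}} (1<p : 1 < p)
  (∑-dilate : Sums.DilationInvariant R p) where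
  open RingOn R
  open Sums R
  open Semantics R
  open SchönhageProgram {V} p

  IsProduct : ℕ → ℕ → V → (f g h : ℕ → V) → Set
  IsProduct n l c f g h = ∀ t → ∑ l (λ i → h i ⊠ t i) ≡ c ⊠ ∑₂ n f g t

  spec-schoolbook : ∀ n l f g → n + n ≤ l → Spec (schoolbookᴾ n l f g) (IsProduct n l 𝟙 f g) (n * n + l * n)
  spec-schoolbook n l f g n+n≤l = weaken (λ _ q → q)
    (≤-reflexive (cong (_+ l * n) (cong (n *_) (trans (+-identityʳ (n * 1)) (*-identityʳ n)))))
    (spec-collect g n {Q = λ i r → ∀ t → ∑ l (λ a → r a ⊠ t a) ≡ f i ⊠ ∑ n (λ j → g j ⊠ t (i + j))} (λ i i<n →
       spec-tabulate n (λ j _ → spec-mul (f i) (g j)) ⟫ λ u u≡ → spec-lit0 (spec-done λ t → begin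
         ∑ l (λ a → slice 𝟘 i n u a ⊠ t a)
           ≡⟨ ∑-slice (λ v a → v ⊠ t a) u (≤-trans (+-monoˡ-≤ n (<⇒≤ i<n)) n+n≤l) (λ a → ⊠-zeroˡ (t a)) ⟩
         ∑ n (λ j → u j ⊠ t (i + j))
           ≡⟨ ∑-cong n (λ j j<n → trans (cong (_⊠ t (i + j)) (u≡ j j<n)) (⊠-assoc (f i) (g j) _)) ⟩
         ∑ n (λ j → f i ⊠ (g j ⊠ t (i + j)))
           ≡⟨ ∑-⊠ˡ n (f i) _ ⟨
         f i ⊠ ∑ n (λ j → g j ⊠ t (i + j)) ∎))
     ⟫ λ rows rows-ok → weaken (λ h h≡ t → begin
         ∑ l (λ a → h a ⊠ t a)
           ≡⟨ ∑-cong l (λ a a<l → trans (cong (_⊠ t a) (h≡ a a<l)) (∑-⊠ʳ n (t a) _)) ⟩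
         ∑ l (λ a → ∑ n (λ i → rows i a ⊠ t a))
           ≡⟨ ∑-swap l n _ ⟩
         ∑ n (λ i → ∑ l (λ a → rows i a ⊠ t a))
           ≡⟨ ∑-cong n (λ i i<n → rows-ok i i<n t) ⟩
         ∑₂ n f g t
           ≡⟨ ⊠-identityˡ _ ⟨
         𝟙 ⊠ ∑₂ n f g t ∎)
       ≤-refl (spec-tabulate l (λ a _ → spec-sum n _)))
    where open ≡-Reasoning

  P : V
  P = ∑ p (λ _ → 𝟙)

  ^ᵣ-+ : ∀ x i j → x ^ᵣ (i + j) ≡ x ^ᵣ i ⊠ x ^ᵣ j
  ^ᵣ-+ x zero    j = sym (⊠-identityˡ _)
  ^ᵣ-+ x (suc i) j = trans (cong (x ⊠_) (^ᵣ-+ x i j)) (sym (⊠-assoc x _ _))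

  module SplitCorrect (k : ℕ) where
    open Split k

    k₁+k₂≡k : k₁ + k₂ ≡ k
    k₁+k₂≡k = ⌊n/2⌋+⌈n/2⌉≡n k

    M≡p^s*D : M ≡ p ^ s * D
    M≡p^s*D = trans (cong (p ^_) (sym (cong suc (m+[n∸m]≡n {k₁} {suc k₂} (≤-trans (⌊n/2⌋≤⌈n/2⌉ k) (n≤1+n k₂))))))
      (^-distribˡ-+-* p s (suc k₂ ∸ k₁))

    open FFT R p m M refl using (pair; pairing₂; pair-cong; Kernel; IsCyclicProduct)

    spec-wrap : ∀ {c f g h} → IsProduct M (p ^ (4 + k₂)) c f g h →
                Spec (wrapᴾ h) (IsCyclicProduct c f g) (M * (p * p))
    spec-wrap {c} {f} {g} {h} h-ok = weaken (λ w w≡ κ per → begin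
      ∑ M (λ a → w a ⊠ κ a)
        ≡⟨ ∑-cong M (λ a a<M → trans (cong (_⊠ κ a) (w≡ a a<M)) (∑-⊠ʳ (p * p) (κ a) _)) ⟩
      ∑ M (λ a → ∑ (p * p) (λ q → h (q * M + a) ⊠ κ a))
        ≡⟨ ∑-swap M (p * p) _ ⟩
      ∑ (p * p) (λ q → ∑ M (λ a → h (q * M + a) ⊠ κ a))
        ≡⟨ ∑-ext (p * p) (λ q → ∑-ext M (λ a → cong (h (q * M + a) ⊠_)
             (sym (FFT.periodic-≡ R p m M refl per q (+-comm (q * M) a))))) ⟩
      ∑ (p * p) (λ q → ∑ M (λ a → h (q * M + a) ⊠ κ (q * M + a)))
        ≡⟨ ∑-* (p * p) M _ ⟨
      ∑ (p * p * M) (λ a → h a ⊠ κ a)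
        ≡⟨ cong (λ n → ∑ n (λ a → h a ⊠ κ a)) (*-assoc p p M) ⟩
      ∑ (p ^ (4 + k₂)) (λ a → h a ⊠ κ a)
        ≡⟨ h-ok κ ⟩
      c ⊠ ∑₂ M f g κ ∎)
      ≤-refl (spec-tabulate M (λ a _ → spec-sum (p * p) _))
      where open ≡-Reasoning

    M≡ : M ≡ m + pred p * m
    M≡ = cong (_* m) (sym (suc-pred p))

    pred-p*m+m : pred p * m + m ≡ M
    pred-p*m+m = trans (+-comm (pred p * m) m) (sym M≡)

    module TestFunction (t : ℕ → V) where

      window : ℕ → ℕ → V
      window j a = slice 𝟘 0 m (λ b → t (j * B + b)) (a % M)

      -- A test sequence `t` for polynomials in x is turned into a test function on the quotient
      -- ring. `window` is `t` on m consecutive powers of y, continued by 0 with period M;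
      -- subtracting its translate by m makes it annihilate Φ(y). For a < m the translate falls
      -- outside the window, so there κ still agrees with `t`.
      κ : ℕ → ℕ → V
      κ a j = window (j % K) a ⊟ window (j % K) (a + m)
        where instance _ = m^n≢0 p s

      private
        instance
          nonZero-K : NonZero K
          nonZero-K = m^n≢0 p s
          nonZero-m : NonZero m
          nonZero-m = m^n≢0 p (1 + k₂)

      window-periodic : ∀ j a → window j (a + M) ≡ window j a
      window-periodic j a = cong (slice 𝟘 0 m _) ([m+n]%n≡m%n a M)

      m<M : m < M
      m<M = begin-strict
        m       <⟨ m<m+n m {m} (>-nonZero⁻¹ m) ⟩
        m + m   ≡⟨ cong (m +_) (+-identityʳ m) ⟨
        2 * m   ≤⟨ *-monoˡ-≤ m 1<p ⟩
        M       ∎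
        where open ≤-Reasoning

      window-inside : ∀ j a → a < m → window j a ≡ t (j * B + a)
      window-inside j a a<m = trans (cong (slice 𝟘 0 m _) (m<n⇒m%n≡m (<-trans a<m m<M))) (slice-inside {o = 0} a<m)

      window-outside : ∀ j a → m ≤ a → a < M → window j a ≡ 𝟘
      window-outside j a m≤a a<M = trans (cong (slice 𝟘 0 m _) (m<n⇒m%n≡m a<M)) (slice-above {o = 0} m≤a)

      κ-inside : ∀ a j → a < m → j < K → κ a j ≡ t (j * B + a)
      κ-inside a j a<m j<K = begin
        window (j % K) a ⊟ window (j % K) (a + m)
          ≡⟨ cong₂ _⊟_ (window-inside (j % K) a a<m) (window-outside (j % K) (a + m) (m≤n+m m a) (<-≤-trans (+-monoˡ-< m a<m) m+m≤M)) ⟩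
        t (j % K * B + a) ⊟ 𝟘
          ≡⟨ ⊟-identityʳ _ ⟩
        t (j % K * B + a)
          ≡⟨ cong (λ j → t (j * B + a)) (m<n⇒m%n≡m j<K) ⟩
        t (j * B + a) ∎
        where
        open ≡-Reasoning
        m+m≤M : m + m ≤ M
        m+m≤M = ≤-trans (≤-reflexive (cong (m +_) (sym (+-identityʳ m)))) (*-monoˡ-≤ m 1<p)

      -- `reduceᴾ` is the transpose of the passage from `t` to κ. The translated window is met
      -- exactly at the indices (p - 1) m + a, where adding m wraps around.
      ∑-κ : ∀ (h : ℕ → V) j → j < K →
        ∑ M (λ a → h a ⊠ κ a j) ≡ ∑ m (λ a → (h a ⊟ h (pred p * m + a)) ⊠ t (j * B + a))
      ∑-κ h j j<K = begin
        ∑ M (λ a → h a ⊠ (w a ⊟ w (a + m)))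
          ≡⟨ ∑-ext M (λ a → ⊠-distribˡ-⊟ (h a) _ _) ⟩
        ∑ M (λ a → h a ⊠ w a ⊟ h a ⊠ w (a + m))
          ≡⟨ ∑-⊟ M _ _ ⟩
        ∑ M (λ a → h a ⊠ w a) ⊟ ∑ M (λ a → h a ⊠ w (a + m))
          ≡⟨ cong₂ _⊟_ low high ⟩
        ∑ m (λ a → h a ⊠ t′ a) ⊟ ∑ m (λ a → h (pred p * m + a) ⊠ t′ a)
          ≡⟨ ∑-⊟ m _ _ ⟨
        ∑ m (λ a → h a ⊠ t′ a ⊟ h (pred p * m + a) ⊠ t′ a)
          ≡⟨ ∑-ext m (λ a → sym (⊠-distribʳ-⊟ (t′ a) _ _)) ⟩
        ∑ m (λ a → (h a ⊟ h (pred p * m + a)) ⊠ t′ a)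
          ∎
        where
        open ≡-Reasoning
        w : ℕ → V
        w = window (j % K)
        t′ : ℕ → V
        t′ a = t (j * B + a)
        w-inside : ∀ a → a < m → w a ≡ t′ a
        w-inside a a<m = trans (window-inside (j % K) a a<m) (cong (λ j → t (j * B + a)) (m<n⇒m%n≡m j<K))
        low : ∑ M (λ a → h a ⊠ w a) ≡ ∑ m (λ a → h a ⊠ t′ a)
        low = begin
          ∑ M (λ a → h a ⊠ w a)
            ≡⟨ cong (λ n → ∑ n (λ a → h a ⊠ w a)) M≡ ⟩
          ∑ (m + pred p * m) (λ a → h a ⊠ w a)
            ≡⟨ ∑-+ m (pred p * m) _ ⟩
          ∑ m (λ a → h a ⊠ w a) ⊞ ∑ (pred p * m) (λ a → h (m + a) ⊠ w (m + a))
            ≡⟨ cong₂ _⊞_ (∑-cong m (λ a a<m → cong (h a ⊠_) (w-inside a a<m)))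
                 (∑-zero (pred p * m) (λ a a< → trans (cong (h (m + a) ⊠_)
                   (window-outside (j % K) (m + a) (m≤m+n m a) (subst (m + a <_) (sym M≡) (+-monoʳ-< m a<)))) (⊠-zeroʳ _))) ⟩
          ∑ m (λ a → h a ⊠ t′ a) ⊞ 𝟘
            ≡⟨ ⊞-identityʳ _ ⟩
          ∑ m (λ a → h a ⊠ t′ a) ∎
        high : ∑ M (λ a → h a ⊠ w (a + m)) ≡ ∑ m (λ a → h (pred p * m + a) ⊠ t′ a)
        high = begin
          ∑ M (λ a → h a ⊠ w (a + m))
            ≡⟨ cong (λ n → ∑ n (λ a → h a ⊠ w (a + m))) pred-p*m+m ⟨
          ∑ (pred p * m + m) (λ a → h a ⊠ w (a + m))
            ≡⟨ ∑-+ (pred p * m) m _ ⟩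
          ∑ (pred p * m) (λ a → h a ⊠ w (a + m)) ⊞ ∑ m (λ a → h (pred p * m + a) ⊠ w (pred p * m + a + m))
            ≡⟨ cong₂ _⊞_
                 (∑-zero (pred p * m) (λ a a< → trans (cong (h a ⊠_)
                   (window-outside (j % K) (a + m) (m≤n+m m a) (subst (a + m <_) pred-p*m+m (+-monoˡ-< m a<)))) (⊠-zeroʳ _)))
                 (∑-cong m (λ a a<m → cong (h (pred p * m + a) ⊠_) (trans
                   (cong w (trans (swap (pred p * m) a m) (cong (a +_) pred-p*m+m)))
                   (trans (window-periodic (j % K) a) (w-inside a a<m))))) ⟩
          𝟘 ⊞ ∑ m (λ a → h (pred p * m + a) ⊠ t′ a)
            ≡⟨ ⊞-identityˡ _ ⟩
          ∑ m (λ a → h (pred p * m + a) ⊠ t′ a) ∎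
          where
          swap : ∀ x a m → x + a + m ≡ a + (x + m)
          swap = ℕSolver.solve-∀

      -- Multiplication by r permutes the residues modulo p, which reduces `roots` to r = 1. There
      -- the sums over the window and over its translate are cyclic shifts of each other and cancel.
      κ-kernel : Kernel K (K * 0) κ
      κ-kernel = record
        { periodic = κ-periodic
        ; wraps = λ a j → trans (cong (λ j → window j a ⊟ window j (a + m)) ([m+n]%n≡m%n j K))
            (cong (λ a → κ a j) (trans (sym (+-identityʳ a)) (cong (a +_) (sym (*-zeroʳ K)))))
        ; roots = λ r 0<r r<p a j → let w = window (j % K) in begin
            ∑ p (λ i → κ (a + r * i * m) j)
              ≡⟨ ∑-dilate r 0<r r<p (λ i → κ (a + i * m) j) (λ i → trans
                   (cong (λ a → κ a j) (trans (cong (a +_) (*-distribʳ-+ m i p)) (sym (+-assoc a (i * m) M))))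
                   (κ-periodic j (a + i * m))) ⟩
            ∑ p (λ i → w (a + i * m) ⊟ w (a + i * m + m))
              ≡⟨ ∑-⊟ p _ _ ⟩
            ∑ p (λ i → w (a + i * m)) ⊟ ∑ p (λ i → w (a + i * m + m))
              ≡⟨ cong (∑ p (λ i → w (a + i * m)) ⊟_) (trans
                   (∑-ext p (λ i → cong w (swap a i m)))
                   (∑-shift p (trans (window-periodic (j % K) a) (cong w (sym (+-identityʳ a)))))) ⟩
            ∑ p (λ i → w (a + i * m)) ⊟ ∑ p (λ i → w (a + i * m))
              ≡⟨ ⊟-self _ ⟩
            𝟘 ∎
        }
        where
        open ≡-Reasoning
        swap : ∀ a i m → a + i * m + m ≡ a + suc i * m
        swap = ℕSolver.solve-∀
        swap′ : ∀ a b c → a + b + c ≡ a + c + b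
        swap′ = ℕSolver.solve-∀
        κ-periodic : ∀ j a → κ (a + M) j ≡ κ a j
        κ-periodic j a = cong₂ _⊟_ (window-periodic (j % K) a)
          (trans (cong (window (j % K)) (swap′ a M m)) (window-periodic (j % K) (a + m)))

    p^k≡ : p ^ k ≡ p ^ k₁ * B
    p^k≡ = trans (cong (p ^_) (sym k₁+k₂≡k)) (^-distribˡ-+-* p k₁ k₂)

    pair-blocks : ∀ f λ′ → pair K (blocks 𝟘 f) λ′ ≡ ∑ (p ^ k₁) (λ j → ∑ B (λ a → f (j * B + a) ⊠ λ′ a j))
    pair-blocks f λ′ = trans
      (∑-slice (λ (v : ℕ → V) j → ∑ M (λ a → v a ⊠ λ′ a j)) {o = 0} _ (^-monoʳ-≤ p (n≤1+n k₁)) (λ j → ∑-zero M (λ a _ → ⊠-zeroˡ _)))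
      (∑-ext (p ^ k₁) (λ j → ∑-slice (λ v a → v ⊠ λ′ a j) {o = 0} _ (^-monoʳ-≤ p (m≤n+m k₂ 2)) (λ a → ⊠-zeroˡ _)))

    pairing₂-blocks : ∀ f g t → pairing₂ K (blocks 𝟘 f) (blocks 𝟘 g) (TestFunction.κ t) ≡ ∑₂ (p ^ k) f g t
    pairing₂-blocks f g t = begin
      pairing₂ K (blocks 𝟘 f) (blocks 𝟘 g) κ
        ≡⟨ pair-blocks f _ ⟩
      ∑ (p ^ k₁) (λ j → ∑ B (λ a → f (j * B + a) ⊠ pair K (blocks 𝟘 g) (λ a′ j′ → κ (a + a′) (j + j′))))
        ≡⟨ ∑-cong (p ^ k₁) (λ j j< → ∑-cong B (λ a a< → cong (f (j * B + a) ⊠_) (begin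
             pair K (blocks 𝟘 g) (λ a′ j′ → κ (a + a′) (j + j′))
               ≡⟨ pair-blocks g _ ⟩
             ∑ (p ^ k₁) (λ j′ → ∑ B (λ a′ → g (j′ * B + a′) ⊠ κ (a + a′) (j + j′)))
               ≡⟨ ∑-cong (p ^ k₁) (λ j′ j′< → ∑-cong B (λ a′ a′< → cong (g (j′ * B + a′) ⊠_) (trans
                    -- Here a + a′ < 2 B ≤ m and j + j′ < 2 p^k₁ ≤ K: neither y nor z wraps around.
                    (κ-inside (a + a′) (j + j′) (double B a< a′<) (double (p ^ k₁) j< j′<))
                    (cong t (rearrange j j′ B a a′))))) ⟩
             ∑ (p ^ k₁) (λ j′ → ∑ B (λ a′ → g (j′ * B + a′) ⊠ t (j * B + a + (j′ * B + a′))))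
               ≡⟨ ∑-* (p ^ k₁) B (λ i → g i ⊠ t (j * B + a + i)) ⟨
             ∑ (p ^ k₁ * B) (λ i → g i ⊠ t (j * B + a + i)) ∎))) ⟩
      ∑ (p ^ k₁) (λ j → ∑ B (λ a → f (j * B + a) ⊠ ∑ (p ^ k₁ * B) (λ i → g i ⊠ t (j * B + a + i))))
        ≡⟨ ∑-* (p ^ k₁) B (λ i → f i ⊠ ∑ (p ^ k₁ * B) (λ j → g j ⊠ t (i + j))) ⟨
      ∑₂ (p ^ k₁ * B) f g t
        ≡⟨ cong (λ n → ∑₂ n f g t) p^k≡ ⟨
      ∑₂ (p ^ k) f g t ∎
      where
      open ≡-Reasoning
      open TestFunction t
      double : ∀ n {a b} → a < n → b < n → a + b < p * n
      double n a<n b<n = <-≤-trans (+-mono-<-≤ a<n (<⇒≤ b<n))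
        (≤-trans (≤-reflexive (cong (n +_) (sym (+-identityʳ n)))) (*-monoˡ-≤ n 1<p))
      rearrange : ∀ j j′ B a a′ → (j + j′) * B + (a + a′) ≡ j * B + a + (j′ * B + a′)
      rearrange = ℕSolver.solve-∀

    private
      rows-fit : ∀ q → q < p → q * B + K * B ≤ p ^ (2 + k)
      rows-fit q q<p = begin
        q * B + K * B                      ≤⟨ +-monoˡ-≤ (K * B) (*-monoˡ-≤ B (<⇒≤ q<p)) ⟩
        p * B + p * p ^ k₁ * B             ≡⟨ cong (p * B +_) (trans (*-assoc p (p ^ k₁) B) (cong (p *_) (sym p^k≡))) ⟩
        p * B + p * p ^ k                  ≤⟨ +-monoˡ-≤ (p * p ^ k) (*-monoʳ-≤ p (^-monoʳ-≤ p (⌈n/2⌉≤n k))) ⟩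
        p * p ^ k + p * p ^ k              ≡⟨ cong (p * p ^ k +_) (+-identityʳ (p * p ^ k)) ⟨
        2 * (p * p ^ k)                    ≤⟨ *-monoˡ-≤ (p * p ^ k) 1<p ⟩
        p ^ (2 + k)                        ∎
        where open ≤-Reasoning

    spec-recombine : ∀ r → Spec (recombineᴾ r)
      (λ h → ∀ t → ∑ (p ^ (2 + k)) (λ n → h n ⊠ t n) ≡ ∑ K (λ j → ∑ m (λ a → r j a ⊠ t (j * B + a))))
      (p ^ (2 + k) * p)
    spec-recombine r = weaken (λ _ q → q) (≤-reflexive (cong (_+ p ^ (2 + k) * p) (*-zeroʳ p)))
      (spec-collect (r 0) p {Q = λ q row → ∀ t → ∑ (p ^ (2 + k)) (λ n → row n ⊠ t n) ≡
                               ∑ K (λ j → ∑ B (λ b → r j (q * B + b) ⊠ t (j * B + (q * B + b))))}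
        (λ q q<p → spec-lit0 (spec-done λ t → begin
          ∑ (p ^ (2 + k)) (λ n → slice 𝟘 (q * B) (K * B) (λ i → r (i / B) (q * B + i % B)) n ⊠ t n)
            ≡⟨ ∑-slice (λ v n → v ⊠ t n) {o = q * B} _ (rows-fit q q<p) (λ n → ⊠-zeroˡ (t n)) ⟩
          ∑ (K * B) (λ i → r (i / B) (q * B + i % B) ⊠ t (q * B + i))
            ≡⟨ ∑-* K B _ ⟩
          ∑ K (λ j → ∑ B (λ b → r ((j * B + b) / B) (q * B + (j * B + b) % B) ⊠ t (q * B + (j * B + b))))
            ≡⟨ ∑-ext K (λ j → ∑-cong B (λ b b<B → cong₂ _⊠_
                 (cong₂ (λ u v → r u (q * B + v)) ([m*n+o]/n≡m j B b b<B) ([m*n+o]%n≡o j B b b<B))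
                 (cong t (swap (q * B) (j * B) b)))) ⟩
          ∑ K (λ j → ∑ B (λ b → r j (q * B + b) ⊠ t (j * B + (q * B + b)))) ∎))
        ⟫ λ rows rows-ok → weaken (λ h h≡ t → begin
          ∑ (p ^ (2 + k)) (λ n → h n ⊠ t n)
            ≡⟨ ∑-cong (p ^ (2 + k)) (λ n n< → trans (cong (_⊠ t n) (h≡ n n<)) (∑-⊠ʳ p (t n) _)) ⟩
          ∑ (p ^ (2 + k)) (λ n → ∑ p (λ q → rows q n ⊠ t n))
            ≡⟨ ∑-swap (p ^ (2 + k)) p _ ⟩
          ∑ p (λ q → ∑ (p ^ (2 + k)) (λ n → rows q n ⊠ t n))
            ≡⟨ ∑-cong p (λ q q<p → rows-ok q q<p t) ⟩
          ∑ p (λ q → ∑ K (λ j → ∑ B (λ b → r j (q * B + b) ⊠ t (j * B + (q * B + b)))))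
            ≡⟨ ∑-swap p K _ ⟩
          ∑ K (λ j → ∑ p (λ q → ∑ B (λ b → r j (q * B + b) ⊠ t (j * B + (q * B + b)))))
            ≡⟨ ∑-ext K (λ j → sym (∑-* p B (λ a → r j a ⊠ t (j * B + a)))) ⟩
          ∑ K (λ j → ∑ m (λ a → r j a ⊠ t (j * B + a))) ∎)
          ≤-refl (spec-tabulate (p ^ (2 + k)) (λ n _ → spec-sum p _)))
      where
      open ≡-Reasoning
      swap : ∀ x y z → x + (y + z) ≡ y + (x + z)
      swap = ℕSolver.solve-∀

  spec-schönhage : ∀ t k f g →
    Spec (schönhageᴾ t k f g) (IsProduct (p ^ k) (p ^ (2 + k)) (P ^ᵣ schönhageExponent t k) f g) (schönhageCost p t k)
  spec-schönhage zero    k f g = spec-schoolbook (p ^ k) (p ^ (2 + k)) f g (begin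
      p ^ k + p ^ k      ≡⟨ cong (p ^ k +_) (+-identityʳ (p ^ k)) ⟨
      2 * p ^ k          ≤⟨ *-monoˡ-≤ (p ^ k) 1<p ⟩
      p * p ^ k          ≤⟨ m≤n*m (p * p ^ k) p ⟩
      p ^ (2 + k)        ∎)
    where open ≤-Reasoning
  spec-schönhage (suc t) k f g = spec-lit0
    (spec-fft (λ u v → spec-schönhage t (2 + k₂) u v ⟫ λ h h-ok → spec-wrap {f = u} {v} {h} h-ok)
       s D 0 (blocks 𝟘 f) (blocks 𝟘 g) M≡p^s*D
     ⟫ λ h h-ok → spec-tabulate₂ K m (λ j a _ _ → spec-sub (h j a) (h j (pred p * m + a)))
     ⟫ λ r r≡ → weaken (λ w w-ok t′ → let open TestFunction t′ in begin
         ∑ (p ^ (2 + k)) (λ n → w n ⊠ t′ n)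
           ≡⟨ w-ok t′ ⟩
         ∑ K (λ j → ∑ m (λ a → r j a ⊠ t′ (j * B + a)))
           ≡⟨ ∑-cong K (λ j j<K → trans (∑-cong m (λ a a<m → cong (_⊠ t′ (j * B + a)) (r≡ j j<K a a<m))) (sym (∑-κ (h j) j j<K))) ⟩
         pair K h κ
           ≡⟨ h-ok κ κ-kernel ⟩
         (P ^ᵣ s ⊠ P ^ᵣ schönhageExponent t (2 + k₂)) ⊠ pairing₂ K (blocks 𝟘 f) (blocks 𝟘 g) κ
           ≡⟨ cong₂ _⊠_ (sym (^ᵣ-+ P s (schönhageExponent t (2 + k₂)))) (pairing₂-blocks f g t′) ⟩
         P ^ᵣ schönhageExponent (suc t) k ⊠ ∑₂ (p ^ k) f g t′ ∎)
       ≤-refl (spec-recombine r))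
    where
    open ≡-Reasoning
    open Split k
    open SplitCorrect k
    open FFT R p m M refl using (pair; pairing₂; spec-fft)

-- Ceiling logarithms and the cost of Schönhage's multiplication.

opaque

  ⌈log_⌉ : ℕ → ℕ → ℕ
  -- The value at 0 serves the empty family: its product tree is a single leaf and costs nothing.
  ⌈log p ⌉ zero = 0
  ⌈log p ⌉ (suc n) with suc n ≤? p ^ ⌈log p ⌉ n
  ... | yes _ = ⌈log p ⌉ n
  ... | no _  = suc (⌈log p ⌉ n)

  n≤p^⌈log⌉ : ∀ p n → 1 < p → n ≤ p ^ ⌈log p ⌉ n
  n≤p^⌈log⌉ p zero    1<p = z≤n
  n≤p^⌈log⌉ p (suc n) 1<p with suc n ≤? p ^ ⌈log p ⌉ n
  ... | yes le = le
  ... | no _   = begin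
    suc n                            ≤⟨ +-mono-≤ 1≤p^l (n≤p^⌈log⌉ p n 1<p) ⟩
    p ^ ⌈log p ⌉ n + p ^ ⌈log p ⌉ n  ≡⟨ cong (p ^ ⌈log p ⌉ n +_) (+-identityʳ _) ⟨
    2 * p ^ ⌈log p ⌉ n               ≤⟨ *-monoˡ-≤ (p ^ ⌈log p ⌉ n) 1<p ⟩
    p * p ^ ⌈log p ⌉ n               ∎
    where
    open ≤-Reasoning
    1≤p^l : 1 ≤ p ^ ⌈log p ⌉ n
    1≤p^l = m^n>0 p {{>-nonZero (<-trans z<s 1<p)}} (⌈log p ⌉ n)

  p^⌈log⌉≤p*n : ∀ p n → 1 < p → p ^ ⌈log p ⌉ (suc n) ≤ p * suc n
  p^⌈log⌉≤p*n p n 1<p with suc n ≤? p ^ ⌈log p ⌉ n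
  p^⌈log⌉≤p*n p zero    1<p | yes _ = ≤-trans (<⇒≤ 1<p) (≤-reflexive (sym (*-identityʳ p)))
  p^⌈log⌉≤p*n p (suc n) 1<p | yes _ = ≤-trans (p^⌈log⌉≤p*n p n 1<p) (*-monoʳ-≤ p (n≤1+n (suc n)))
  p^⌈log⌉≤p*n p n       1<p | no gt = *-monoʳ-≤ p (<⇒≤ (≰⇒> gt))

  ⌈log⌉-least : ∀ p n k → 1 < p → n ≤ p ^ k → ⌈log p ⌉ n ≤ k
  ⌈log⌉-least p zero    k 1<p n≤ = z≤n
  ⌈log⌉-least p (suc n) k 1<p n≤ with suc n ≤? p ^ ⌈log p ⌉ n
  ... | yes _ = ⌈log⌉-least p n k 1<p (≤-trans (n≤1+n n) n≤)
  ... | no ≰  with k ≤? ⌈log p ⌉ n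
  ...   | yes k≤ = ⊥-elim (≰ (≤-trans n≤ (^-monoʳ-≤ p {{>-nonZero (<-trans z<s 1<p)}} k≤)))
  ...   | no k≰  = ≰⇒> k≰

  ⌈log⌉-base : ⌈log 2 ⌉ 2 ≡ 1
  ⌈log⌉-base = refl

-- The recursion sends k to about 2 + k / 2, whose fixed point is 4, so the excess over 4 is halved.
-- With fuel 0 there remains k ≤ 5.
halve : ∀ t k → k ≤ 2 ^ suc t + 4 → ⌊ k /2⌋ ≤ 2 ^ t + 2 × 2 + ⌈ k /2⌉ ≤ 2 ^ t + 4
halve t k k≤ = low , (begin
    2 + ⌈ k /2⌉          ≤⟨ +-monoʳ-≤ 2 (⌈n/2⌉-mono k≤′) ⟩
    2 + ⌈ x + x /2⌉      ≡⟨ cong (2 +_) (n≡⌈n+n/2⌉ x) ⟨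
    2 + (2 ^ t + 2)      ≡⟨ rearrange (2 ^ t) ⟩
    2 ^ t + 4            ∎)
  where
  open ≤-Reasoning
  x = 2 ^ t + 2
  rearrange : ∀ u → 2 + (u + 2) ≡ u + 4
  rearrange = ℕSolver.solve-∀
  rearrange′ : ∀ u → 2 * u + 4 ≡ u + 2 + (u + 2)
  rearrange′ = ℕSolver.solve-∀
  k≤′ : k ≤ x + x
  k≤′ = ≤-trans k≤ (≤-reflexive (rearrange′ (2 ^ t)))
  low : ⌊ k /2⌋ ≤ x
  low = ≤-trans (⌊n/2⌋-mono k≤′) (≤-reflexive (sym (n≡⌊n+n/2⌋ x)))

-- A call with fuel t + 1 adds at most 2^t + 3, and these terms sum geometrically. The exponent
-- stays linear in 2^t, which keeps the Bézout coefficients cheap.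
schönhageExponent-bound : ∀ t k → k ≤ 2 ^ t + 4 → schönhageExponent t k ≤ 2 ^ suc t + 5 * t
schönhageExponent-bound zero    k k≤ = z≤n
schönhageExponent-bound (suc t) k k≤ = begin
  suc ⌊ k /2⌋ + schönhageExponent t (2 + ⌈ k /2⌉)
    ≤⟨ +-mono-≤ (s≤s (proj₁ (halve t k k≤))) (schönhageExponent-bound t _ (proj₂ (halve t k k≤))) ⟩
  suc (2 ^ t + 2) + (2 ^ suc t + 5 * t)
    ≤⟨ m≤m+n _ (2 ^ t + 2) ⟩
  suc (2 ^ t + 2) + (2 ^ suc t + 5 * t) + (2 ^ t + 2)
    ≡⟨ rearrange (2 ^ t) t ⟩
  2 ^ suc (suc t) + 5 * suc t ∎
  where
  open ≤-Reasoning
  rearrange : ∀ u t → suc (u + 2) + (2 * u + 5 * t) + (u + 2) ≡ 2 * (2 * u) + 5 * suc t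
  rearrange = ℕSolver.solve-∀

module SchönhageCost (p : ℕ) .{{_ : NonZero p}} (1<p : 1 < p) where
  -- The first summand pays for schoolbook products of length at most p^5. The others pay for one
  -- level: p^5 for wrapping, 12 p^4 for the transform, p^2 for reducing, p^3 for recombining.
  W : ℕ
  W = p ^ 5 * (1 + p * p) + (p * p * p * p * p + 12 * (p * p * p * p) + p * p + p * p * p)

  -- One level replaces the length p^k by K blocks of length M, and K M = p^3 p^k. The linear work
  -- of the level is at most as large as this recursive part, so a fourth factor p ≥ 2 absorbs it.
  schönhageCost-bound : ∀ t k → k ≤ 2 ^ t + 4 → schönhageCost p t k ≤ p ^ k * (p ^ (4 * t) * W)
  schönhageCost-bound zero    k k≤ = begin
    p ^ k * p ^ k + p * (p * p ^ k) * p ^ k   ≡⟨ rearrange p (p ^ k) ⟩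
    p ^ k * (p ^ k * (1 + p * p))             ≤⟨ *-monoʳ-≤ (p ^ k) (*-monoˡ-≤ (1 + p * p) (^-monoʳ-≤ p k≤)) ⟩
    p ^ k * (p ^ 5 * (1 + p * p))             ≤⟨ *-monoʳ-≤ (p ^ k) (m≤m+n _ _) ⟩
    p ^ k * W                                 ≡⟨ cong (p ^ k *_) (*-identityˡ W) ⟨
    p ^ k * (1 * W)                           ∎
    where
    open ≤-Reasoning
    rearrange : ∀ p x → x * x + p * (p * x) * x ≡ x * (x * (1 + p * p))
    rearrange = ℕSolver.solve-∀
  schönhageCost-bound (suc t) k k≤ = begin
    K * (schönhageCost p t (2 + k₂) + M * (p * p) + s * (3 * p * M)) + (K * (m * 1) + p ^ (2 + k) * p)
      ≤⟨ +-monoˡ-≤ _ (*-monoʳ-≤ K (+-monoˡ-≤ _ (+-monoˡ-≤ _ (schönhageCost-bound t (2 + k₂) (proj₂ (halve t k k≤)))))) ⟩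
    K * (M * (X * W) + M * (p * p) + s * (3 * p * M)) + (K * (m * 1) + p ^ (2 + k) * p)
      ≡⟨ cong (λ y → K * (M * (X * W) + M * (p * p) + s * (3 * p * M)) + (K * (m * 1) + p * (p * y) * p)) p^k≡ ⟩
    p * p ^ k₁ * (M * (X * W) + M * (p * p) + s * (3 * p * M)) + (p * p ^ k₁ * (m * 1) + p * (p * (p ^ k₁ * B)) * p)
      ≡⟨ regroup p (p ^ k₁) B (X * W) s ⟩
    p ^ k₁ * B * (p * p * p * (X * W) + (1 * (p * p * p * p * p) + 3 * s * (p * p * p * p) + 1 * (p * p) + 1 * (p * p * p)))
      ≡⟨ cong (λ y → y * (p * p * p * (X * W) + (1 * (p * p * p * p * p) + 3 * s * (p * p * p * p) + 1 * (p * p) + 1 * (p * p * p)))) p^k≡ ⟨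
    p ^ k * (p * p * p * (X * W) + (1 * (p * p * p * p * p) + 3 * s * (p * p * p * p) + 1 * (p * p) + 1 * (p * p * p)))
      ≤⟨ *-monoʳ-≤ (p ^ k) (+-monoʳ-≤ (p * p * p * (X * W)) (+-mono-≤ (+-mono-≤ (+-mono-≤
           (*-monoˡ-≤ (p * p * p * p * p) 1≤X) (*-monoˡ-≤ (p * p * p * p) 3s≤12X)) (*-monoˡ-≤ (p * p) 1≤X)) (*-monoˡ-≤ (p * p * p) 1≤X))) ⟩
    p ^ k * (p * p * p * (X * W) + (X * (p * p * p * p * p) + X * 12 * (p * p * p * p) + X * (p * p) + X * (p * p * p)))
      ≡⟨ cong (λ y → p ^ k * (p * p * p * (X * W) + y)) (collectX X p) ⟩
    p ^ k * (p * p * p * (X * W) + X * (p * p * p * p * p + 12 * (p * p * p * p) + p * p + p * p * p))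
      ≤⟨ *-monoʳ-≤ (p ^ k) (+-monoʳ-≤ (p * p * p * (X * W)) (*-monoʳ-≤ X (m≤n+m _ (p ^ 5 * (1 + p * p))))) ⟩
    p ^ k * (p * p * p * (X * W) + X * W)
      ≤⟨ *-monoʳ-≤ (p ^ k) (+-monoʳ-≤ (p * p * p * (X * W)) (m≤n*m (X * W) (p * p * p))) ⟩
    p ^ k * (p * p * p * (X * W) + p * p * p * (X * W))
      ≡⟨ cong (p ^ k *_) (cong (p * p * p * (X * W) +_) (+-identityʳ (p * p * p * (X * W)))) ⟨
    p ^ k * (2 * (p * p * p * (X * W)))
      ≤⟨ *-monoʳ-≤ (p ^ k) (*-monoˡ-≤ (p * p * p * (X * W)) 1<p) ⟩
    p ^ k * (p * (p * p * p * (X * W)))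
      ≡⟨ cong (p ^ k *_) (assemble p X W) ⟩
    p ^ k * (p ^ 4 * X * W)
      ≡⟨ cong (λ y → p ^ k * (y * W)) (trans (sym (^-distribˡ-+-* p 4 (4 * t))) (cong (p ^_) (sym (*-suc 4 t)))) ⟩
    p ^ k * (p ^ (4 * suc t) * W) ∎
    where
    open ≤-Reasoning
    open SplitParameters p k
    X = p ^ (4 * t)
    instance
      nz₂ : NonZero (p * p)
      nz₂ = m*n≢0 p p
      nz₃ : NonZero (p * p * p)
      nz₃ = m*n≢0 (p * p) p
    1≤X : 1 ≤ X
    1≤X = m^n>0 p (4 * t)
    2^t≤X : 2 ^ t ≤ X
    2^t≤X = ≤-trans (^-monoˡ-≤ t 1<p) (^-monoʳ-≤ p (m≤n*m t 4))
    p^k≡ : p ^ k ≡ p ^ k₁ * B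
    p^k≡ = trans (cong (p ^_) (sym (⌊n/2⌋+⌈n/2⌉≡n k))) (^-distribˡ-+-* p k₁ k₂)
    3s≤12X : 3 * s ≤ X * 12
    3s≤12X = begin
      3 * s                    ≤⟨ *-monoʳ-≤ 3 (s≤s (proj₁ (halve t k k≤))) ⟩
      3 * suc (2 ^ t + 2)      ≡⟨ re₁ (2 ^ t) ⟩
      3 * (2 ^ t) + 9 * 1      ≤⟨ +-mono-≤ (*-monoʳ-≤ 3 2^t≤X) (*-monoʳ-≤ 9 1≤X) ⟩
      3 * X + 9 * X            ≡⟨ re₂ X ⟩
      X * 12                   ∎
      where
      re₁ : ∀ u → 3 * suc (u + 2) ≡ 3 * u + 9 * 1
      re₁ = ℕSolver.solve-∀
      re₂ : ∀ u → 3 * u + 9 * u ≡ u * 12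
      re₂ = ℕSolver.solve-∀
    regroup : ∀ p a b y s →
      p * a * (p * (p * b) * y + p * (p * b) * (p * p) + s * (3 * p * (p * (p * b)))) + (p * a * (p * b * 1) + p * (p * (a * b)) * p) ≡
      a * b * (p * p * p * y + (1 * (p * p * p * p * p) + 3 * s * (p * p * p * p) + 1 * (p * p) + 1 * (p * p * p)))
    regroup = ℕSolver.solve-∀
    collectX : ∀ X p → X * (p * p * p * p * p) + X * 12 * (p * p * p * p) + X * (p * p) + X * (p * p * p) ≡
      X * (p * p * p * p * p + 12 * (p * p * p * p) + p * p + p * p * p)
    collectX = ℕSolver.solve-∀
    assemble : ∀ p X W → p * (p * p * p * (X * W)) ≡ p * (p * (p * (p * 1))) * X * W
    assemble = ℕSolver.solve-∀

-- Removing the denominators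

-- (3^b , s) with 2 s + 3^b = 1
oddBezoutᴾ : {V : Set} → ℕ → Program V (V × V)
oddBezoutᴾ zero    = lit0 λ z → lit1 λ o → done (o , z)
oddBezoutᴾ (suc b) = oddBezoutᴾ b ≫ λ (β , s) →
  add′ β β ≫ λ β₂ → add′ β₂ β ≫ λ β₃ → sub′ s β ≫ λ s′ → done (β₃ , s′)

-- (u , 2^a , v) with u 2^a + v β = 1, provided that 2 s + β = 1
evenBezoutᴾ : {V : Set} → V → ℕ → Program V (V × V × V)
evenBezoutᴾ s zero    = lit0 λ z → lit1 λ o → done (o , o , z)
evenBezoutᴾ s (suc a) = evenBezoutᴾ s a ≫ λ (u , w , v) →
  mul′ u s ≫ λ u′ → add′ w w ≫ λ w′ → mul′ u w ≫ λ x → add′ x v ≫ λ v′ → done (u′ , w′ , v′)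

bezoutᴾ : {V : Set} → ℕ → ℕ → Program V (V × V)
bezoutᴾ a b = oddBezoutᴾ b ≫ λ (β , s) → evenBezoutᴾ s a ≫ λ (u , w , v) → done (u , v)

-- For inputs of length 2^i the fuel is about log i, enough for both radices to come down to short
-- schoolbook products; `levels₃ i` is the exponent of the power of 3 to which the inputs are
-- padded.
fuel levels₃ : ℕ → ℕ
fuel i    = ⌈log 2 ⌉ (suc i)
levels₃ i = ⌈log 3 ⌉ (2 ^ i)

mulᴾ : {V : Set} → ℕ → (f g : ℕ → V) → Program V (ℕ → V)
mulᴾ i f g =
  bezoutᴾ (schönhageExponent (fuel i) i) (schönhageExponent (fuel i) (levels₃ i)) ≫ λ (u , v) →
  SchönhageProgram.schönhageᴾ 2 (fuel i) i f g ≫ λ h₂ →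
  lit0 λ z →
  -- The entries of f and g from 2^i on are arbitrary and must be cleared before the vectors are
  -- read at the longer length 3^(levels₃ i).
  SchönhageProgram.schönhageᴾ 3 (fuel i) (levels₃ i) (slice z 0 (2 ^ i) f) (slice z 0 (2 ^ i) g) ≫ λ h₃ →
  tabulateᴾ (2 ^ suc i) (λ q → mul′ u (h₂ q) ≫ λ x → mul′ v (h₃ q) ≫ λ y → add′ x y)

mulCost : ℕ → ℕ
mulCost i = schönhageExponent (fuel i) (levels₃ i) * 3 + schönhageExponent (fuel i) i * 4 +
  (schönhageCost 2 (fuel i) i + (schönhageCost 3 (fuel i) (levels₃ i) + 2 ^ suc i * 3))

module Multiplication {V : Set} (R : RingOn V) where
  open RingOn R
  open Sums R
  open Semantics R

  private
    2ᵣ 3ᵣ : V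
    2ᵣ = ∑ 2 (λ _ → 𝟙)
    3ᵣ = ∑ 3 (λ _ → 𝟙)

  dilate₂ : DilationInvariant 2
  dilate₂ 1 _ _ θ per = refl
  dilate₂ (suc (suc r)) _ (s<s (s<s ())) θ per

  dilate₃ : DilationInvariant 3
  dilate₃ 1 _ _ θ per = refl
  dilate₃ 2 _ _ θ per = cong (θ 0 ⊞_) (begin
    θ 2 ⊞ (θ 4 ⊞ 𝟘)    ≡⟨ cong (λ x → θ 2 ⊞ (x ⊞ 𝟘)) (per 1) ⟩
    θ 2 ⊞ (θ 1 ⊞ 𝟘)    ≡⟨ solve 2 (λ x y → x :+ (y :+ con 0) := y :+ (x :+ con 0)) refl (θ 2) (θ 1) ⟩
    θ 1 ⊞ (θ 2 ⊞ 𝟘)    ∎)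
    where
    open ≡-Reasoning
    open RingSolver
  dilate₃ (suc (suc (suc r))) _ (s<s (s<s (s<s ()))) θ per

  -- From 2 s + β = 1 follows 2 (s - β) + 3 β = 1.
  spec-oddBezout : ∀ b → Spec (oddBezoutᴾ b) (λ (β , s) → β ≡ 3ᵣ ^ᵣ b × 2ᵣ ⊠ s ⊞ β ≡ 𝟙) (b * 3)
  spec-oddBezout zero    = spec-lit0 (spec-lit1 (spec-done (refl , trans (cong (_⊞ 𝟙) (⊠-zeroʳ 2ᵣ)) (⊞-identityˡ 𝟙))))
  spec-oddBezout (suc b) = weaken (λ _ q → q) (≤-reflexive (+-comm (b * 3) 3))
    (spec-oddBezout b ⟫ λ (β , s) (β≡ , eq) →
     spec-add β β ⟫ λ { _ refl → spec-add (β ⊞ β) β ⟫ λ { _ refl → spec-sub s β ⟫ λ { _ refl → spec-done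
       ( trans (solve 1 (λ β → β :+ β :+ β := (con 1 :+ (con 1 :+ (con 1 :+ con 0))) :* β) refl β) (cong (3ᵣ ⊠_) β≡)
       , (begin
         2ᵣ ⊠ (s ⊟ β) ⊞ (β ⊞ β ⊞ β)
           ≡⟨ cong (λ x → 2ᵣ ⊠ x ⊞ (β ⊞ β ⊞ β)) (⊟-def s β) ⟩
         2ᵣ ⊠ (s ⊞ -ᵣ β) ⊞ (β ⊞ β ⊞ β)
           ≡⟨ solve 3 (λ s n β → (con 1 :+ (con 1 :+ con 0)) :* (s :+ n) :+ (β :+ β :+ β) :=
                ((con 1 :+ (con 1 :+ con 0)) :* s :+ β) :+ ((n :+ β) :+ (n :+ β))) refl s (-ᵣ β) β ⟩
         (2ᵣ ⊠ s ⊞ β) ⊞ ((-ᵣ β ⊞ β) ⊞ (-ᵣ β ⊞ β))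
           ≡⟨ cong₂ _⊞_ eq (trans (cong₂ _⊞_ (-ᵣ-inverseˡ β) (-ᵣ-inverseˡ β)) (⊞-identityˡ 𝟘)) ⟩
         𝟙 ⊞ 𝟘
           ≡⟨ ⊞-identityʳ 𝟙 ⟩
         𝟙 ∎)) } } })
    where
    open ≡-Reasoning
    open RingSolver

  -- In u w + v β = 1 the term u w is multiplied by 1 = 2 s + β, which gives (u s) (2 w) + (u w + v)
  -- β = 1.
  spec-evenBezout : ∀ {s β} a → 2ᵣ ⊠ s ⊞ β ≡ 𝟙 →
    Spec (evenBezoutᴾ s a) (λ (u , w , v) → w ≡ 2ᵣ ^ᵣ a × u ⊠ w ⊞ v ⊠ β ≡ 𝟙) (a * 4)
  spec-evenBezout {s} {β} zero    eq = spec-lit0 (spec-lit1 (spec-done (refl ,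
    trans (cong₂ _⊞_ (⊠-identityˡ 𝟙) (⊠-zeroˡ β)) (⊞-identityʳ 𝟙))))
  spec-evenBezout {s} {β} (suc a) eq = weaken (λ _ q → q) (≤-reflexive (+-comm (a * 4) 4))
    (spec-evenBezout a eq ⟫ λ (u , w , v) (w≡ , uw+vβ≡1) →
     spec-mul u s ⟫ λ { _ refl → spec-add w w ⟫ λ { _ refl → spec-mul u w ⟫ λ { _ refl → spec-add (u ⊠ w) v ⟫ λ { _ refl →
     spec-done
       ( trans (solve 1 (λ w → w :+ w := (con 1 :+ (con 1 :+ con 0)) :* w) refl w) (cong (2ᵣ ⊠_) w≡)
       , (begin
         u ⊠ s ⊠ (w ⊞ w) ⊞ (u ⊠ w ⊞ v) ⊠ β
           ≡⟨ solve 5 (λ u s w v β → u :* s :* (w :+ w) :+ (u :* w :+ v) :* β :=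
                (u :* w) :* ((con 1 :+ (con 1 :+ con 0)) :* s :+ β) :+ v :* β) refl u s w v β ⟩
         (u ⊠ w) ⊠ (2ᵣ ⊠ s ⊞ β) ⊞ v ⊠ β
           ≡⟨ cong (λ x → (u ⊠ w) ⊠ x ⊞ v ⊠ β) eq ⟩
         (u ⊠ w) ⊠ 𝟙 ⊞ v ⊠ β
           ≡⟨ cong (_⊞ v ⊠ β) (⊠-identityʳ (u ⊠ w)) ⟩
         u ⊠ w ⊞ v ⊠ β
           ≡⟨ uw+vβ≡1 ⟩
         𝟙 ∎)) } } } })
    where
    open ≡-Reasoning
    open RingSolver

  spec-bezout : ∀ a b → Spec (bezoutᴾ a b) (λ (u , v) → u ⊠ 2ᵣ ^ᵣ a ⊞ v ⊠ 3ᵣ ^ᵣ b ≡ 𝟙) (b * 3 + a * 4)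
  spec-bezout a b = weaken (λ _ q → q) (≤-reflexive (cong (b * 3 +_) (+-identityʳ (a * 4))))
    (spec-oddBezout b ⟫ λ (β , s) (β≡ , eq) → spec-evenBezout a eq ⟫ λ (u , w , v) (w≡ , eq′) →
     spec-done (subst₂ (λ x y → u ⊠ x ⊞ v ⊠ y ≡ 𝟙) w≡ β≡ eq′))

  private
    module S₂ = Schönhage R 2 (s<s z<s) dilate₂
    module S₃ = Schönhage R 3 (s<s z<s) dilate₃

  ∑₂-slice : ∀ {n l} f g t → n ≤ l → ∑₂ l (slice 𝟘 0 n f) (slice 𝟘 0 n g) t ≡ ∑₂ n f g t
  ∑₂-slice {n} {l} f g t n≤l = trans
    (∑-slice (λ v i → v ⊠ ∑ l (λ j → slice 𝟘 0 n g j ⊠ t (i + j))) f n≤l (λ i → ⊠-zeroˡ _))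
    (∑-ext n (λ i → cong (f i ⊠_) (∑-slice (λ v j → v ⊠ t (i + j)) g n≤l (λ j → ⊠-zeroˡ _))))

  -- The test sequence `δ q` isolates the q-th coefficient.
  coefficient : ∀ {l c n f g h} → (∀ t → ∑ l (λ i → h i ⊠ t i) ≡ c ⊠ ∑₂ n f g t) →
                ∀ q → q < l → h q ≡ c ⊠ conv n f g q
  coefficient {l} {h = h} h-ok q q<l = trans (sym (∑-δ l q h q<l)) (h-ok (δ q))

  2^i≤3^levels₃ : ∀ i → 2 ^ i ≤ 3 ^ levels₃ i
  2^i≤3^levels₃ i = n≤p^⌈log⌉ 3 (2 ^ i) (s<s z<s)

  spec-multiply : ∀ i f g → Spec (mulᴾ i f g) (λ h → ∀ q → q < 2 ^ suc i → h q ≡ conv (2 ^ i) f g q) (mulCost i)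
  spec-multiply i f g =
    spec-bezout a b ⟫ λ (u , v) eq →
    S₂.spec-schönhage (fuel i) i f g ⟫ λ h₂ h₂-ok →
    spec-lit0 (S₃.spec-schönhage (fuel i) (levels₃ i) f′ g′ ⟫ λ h₃ h₃-ok →
    spec-tabulate (2 ^ suc i) (λ q q< →
      spec-mul u (h₂ q) ⟫ λ { _ refl → spec-mul v (h₃ q) ⟫ λ { _ refl → weaken
        (λ { _ refl → begin
          u ⊠ h₂ q ⊞ v ⊠ h₃ q
            ≡⟨ cong₂ (λ x y → u ⊠ x ⊞ v ⊠ y)
                 (coefficient {n = 2 ^ i} {f} {g} h₂-ok q (<-≤-trans q< (^-monoʳ-≤ 2 (n≤1+n (suc i)))))
                 (trans (coefficient {n = 3 ^ levels₃ i} {f′} {g′} h₃-ok q (<-≤-trans q< 2^suc-i≤)) (cong (3ᵣ ^ᵣ b ⊠_) (∑₂-slice f g (δ q) (2^i≤3^levels₃ i)))) ⟩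
          u ⊠ (2ᵣ ^ᵣ a ⊠ conv (2 ^ i) f g q) ⊞ v ⊠ (3ᵣ ^ᵣ b ⊠ conv (2 ^ i) f g q)
            ≡⟨ solve 5 (λ u x v y c → u :* (x :* c) :+ v :* (y :* c) := (u :* x :+ v :* y) :* c) refl u _ v _ _ ⟩
          (u ⊠ 2ᵣ ^ᵣ a ⊞ v ⊠ 3ᵣ ^ᵣ b) ⊠ conv (2 ^ i) f g q
            ≡⟨ cong (_⊠ conv (2 ^ i) f g q) eq ⟩
          𝟙 ⊠ conv (2 ^ i) f g q
            ≡⟨ ⊠-identityˡ _ ⟩
          conv (2 ^ i) f g q ∎ })
        ≤-refl (spec-add (u ⊠ h₂ q) (v ⊠ h₃ q)) } }))
    where
    open ≡-Reasoning
    open RingSolver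
    a = schönhageExponent (fuel i) i
    b = schönhageExponent (fuel i) (levels₃ i)
    f′ = slice 𝟘 0 (2 ^ i) f
    g′ = slice 𝟘 0 (2 ^ i) g
    2^suc-i≤ : 2 ^ suc i ≤ 3 ^ (2 + levels₃ i)
    2^suc-i≤ = ≤-trans (*-mono-≤ {2} {3} (s≤s (s≤s z≤n)) (2^i≤3^levels₃ i)) (^-monoʳ-≤ 3 (n≤1+n (suc (levels₃ i))))

-- Cost of the division-free multiplication.

n<2^n : ∀ n → n < 2 ^ n
n<2^n zero    = z<s
n<2^n (suc n) = begin
  suc (suc n)      ≤⟨ +-mono-≤ (m^n>0 2 n) (n<2^n n) ⟩
  2 ^ n + 2 ^ n    ≡⟨ cong (2 ^ n +_) (+-identityʳ (2 ^ n)) ⟨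
  2 ^ suc n        ∎
  where open ≤-Reasoning

2^-cancel-≤ : ∀ {m n} → 2 ^ m ≤ 2 ^ n → m ≤ n
2^-cancel-≤ {m} {n} le with m ≤? n
... | yes m≤n = m≤n
... | no m≰n  = ⊥-elim (≤⇒≯ le (^-monoʳ-< 2 (s<s z<s) (≰⇒> m≰n)))

log-bound : ∀ p n .{{_ : NonZero n}} → 1 < p → p ^ ⌈log p ⌉ n ≤ p * n
log-bound p (suc n) = p^⌈log⌉≤p*n p n

private
  mulCost-sum : ∀ {a b c₂ c₃ z w₂ w₃ x x₃} → 1 ≤ x → 1 ≤ z → a ≤ 7 * z → b ≤ 7 * z →
    c₂ ≤ x * (z * w₂) → x₃ ≤ 3 * x → c₃ ≤ x₃ * (z * w₃) →
    b * 3 + a * 4 + (c₂ + (c₃ + 2 * x * 3)) ≤ x * ((w₂ + 3 * w₃ + 55) * z)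
  mulCost-sum {a} {b} {c₂} {c₃} {z} {w₂} {w₃} {x} {x₃} 1≤x 1≤z a≤ b≤ c₂≤ x₃≤ c₃≤ = begin
    b * 3 + a * 4 + (c₂ + (c₃ + 2 * x * 3))
      ≤⟨ +-mono-≤ (+-mono-≤ (*-monoˡ-≤ 3 b≤) (*-monoˡ-≤ 4 a≤)) (+-mono-≤ c₂≤
           (+-monoˡ-≤ (2 * x * 3) (≤-trans c₃≤ (*-monoˡ-≤ (z * w₃) x₃≤)))) ⟩
    7 * z * 3 + 7 * z * 4 + (x * (z * w₂) + (3 * x * (z * w₃) + 2 * x * 3))
      ≡⟨ re₁ x z w₂ w₃ ⟩
    1 * (49 * z) + (x * (z * w₂) + (3 * x * (z * w₃) + x * 6 * 1))
      ≤⟨ +-mono-≤ (*-monoˡ-≤ (49 * z) 1≤x) (+-monoʳ-≤ (x * (z * w₂)) (+-monoʳ-≤ (3 * x * (z * w₃))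
           (*-monoʳ-≤ (x * 6) 1≤z))) ⟩
    x * (49 * z) + (x * (z * w₂) + (3 * x * (z * w₃) + x * 6 * z))
      ≡⟨ re₃ x z w₂ w₃ ⟩
    x * ((w₂ + 3 * w₃ + 55) * z) ∎
    where
    open ≤-Reasoning
    re₁ : ∀ x z w₂ w₃ → 7 * z * 3 + 7 * z * 4 + (x * (z * w₂) + (3 * x * (z * w₃) + 2 * x * 3)) ≡
          1 * (49 * z) + (x * (z * w₂) + (3 * x * (z * w₃) + x * 6 * 1))
    re₁ = ℕSolver.solve-∀
    re₃ : ∀ x z w₂ w₃ → x * (49 * z) + (x * (z * w₂) + (3 * x * (z * w₃) + x * 6 * z)) ≡ x * ((w₂ + 3 * w₃ + 55) * z)
    re₃ = ℕSolver.solve-∀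

suc-i≤2^fuel : ∀ i → suc i ≤ 2 ^ fuel i
suc-i≤2^fuel i = n≤p^⌈log⌉ 2 (suc i) (s<s z<s)

2^fuel≤ : ∀ i → 2 ^ fuel i ≤ 2 * suc i
2^fuel≤ i = log-bound 2 (suc i) (s<s z<s)

levels₃≤ : ∀ i → levels₃ i ≤ 2 + i
levels₃≤ i = 2^-cancel-≤ {levels₃ i} {2 + i} (begin
  2 ^ levels₃ i         ≤⟨ ^-monoˡ-≤ (levels₃ i) (n≤1+n 2) ⟩
  3 ^ levels₃ i         ≤⟨ log-bound 3 (2 ^ i) {{m^n≢0 2 i}} (s<s z<s) ⟩
  3 * 2 ^ i             ≤⟨ *-monoˡ-≤ (2 ^ i) (n≤1+n 3) ⟩
  4 * 2 ^ i             ≡⟨ *-assoc 2 2 (2 ^ i) ⟩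
  2 ^ (2 + i)           ∎)
  where open ≤-Reasoning

-- Bounding 3 by 2² is the origin of the exponent 8. It turns the factor p^(4 t), exponential in the
-- depth, into a power of the logarithm of the length.
3^[4*t]≤ : ∀ t {y} → 2 ^ t ≤ y → 3 ^ (4 * t) ≤ y ^ 8
3^[4*t]≤ t {y} 2^t≤y = begin
  3 ^ (4 * t)          ≤⟨ ^-monoˡ-≤ (4 * t) (n≤1+n 3) ⟩
  (2 ^ 2) ^ (4 * t)    ≡⟨ ^-*-assoc 2 2 (4 * t) ⟩
  2 ^ (2 * (4 * t))    ≡⟨ cong (2 ^_) (re₄ t) ⟩
  2 ^ (t * 8)          ≡⟨ ^-*-assoc 2 t 8 ⟨
  (2 ^ t) ^ 8          ≤⟨ ^-monoˡ-≤ 8 2^t≤y ⟩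
  y ^ 8                ∎
  where
  open ≤-Reasoning
  re₄ : ∀ t → 2 * (4 * t) ≡ t * 8
  re₄ = ℕSolver.solve-∀

-- The radix 3 constant counts three times because the padded length may reach 3 · 2^i. Of the 55,
-- the Bézout coefficients take 7 · 3 + 7 · 4 = 49 and the final combination 6.
mulConstant : ℕ
mulConstant = SchönhageCost.W 2 (s<s z<s) + 3 * SchönhageCost.W 3 (s<s z<s) + 55

mulCost-bound : ∀ i → mulCost i ≤ 2 ^ i * (mulConstant * (2 * suc i) ^ 8)
mulCost-bound i = bound (SchönhageCost.W 2 (s<s z<s)) (SchönhageCost.W 3 (s<s z<s)) (2 * suc i) ((2 * suc i) ^ 8)
  (m^n>0 (2 * suc i) 8) (2^fuel≤ i)
  (≤-trans (≤-reflexive (sym (^-identityʳ (2 * suc i)))) (^-monoʳ-≤ (2 * suc i) {1} {8} (s≤s z≤n)))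
  (3^[4*t]≤ t (2^fuel≤ i))
  (SchönhageCost.schönhageCost-bound 2 (s<s z<s) t i i≤)
  (SchönhageCost.schönhageCost-bound 3 (s<s z<s) t (levels₃ i) levels₃≤′)
  where
  t = fuel i
  i≤ : i ≤ 2 ^ t + 4
  i≤ = ≤-trans (n≤1+n i) (≤-trans (suc-i≤2^fuel i) (m≤m+n _ 4))
  levels₃≤′ : levels₃ i ≤ 2 ^ t + 4
  levels₃≤′ = ≤-trans (levels₃≤ i) (≤-trans (s≤s (suc-i≤2^fuel i))
    (≤-trans (≤-reflexive (+-comm 1 (2 ^ t))) (+-monoʳ-≤ (2 ^ t) (s≤s z≤n))))
  bound : ∀ w₂ w₃ y z → 1 ≤ z → 2 ^ t ≤ y → y ≤ z → 3 ^ (4 * t) ≤ z →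
    schönhageCost 2 t i ≤ 2 ^ i * (2 ^ (4 * t) * w₂) →
    schönhageCost 3 t (levels₃ i) ≤ 3 ^ levels₃ i * (3 ^ (4 * t) * w₃) →
    mulCost i ≤ 2 ^ i * ((w₂ + 3 * w₃ + 55) * z)
  bound w₂ w₃ y z 1≤z 2^t≤y y≤z 3^4t≤z c₂≤ c₃≤ = mulCost-sum {z = z} (m^n>0 2 i) 1≤z
    (exponent≤ i i≤) (exponent≤ (levels₃ i) levels₃≤′)
    (≤-trans c₂≤ (*-monoʳ-≤ (2 ^ i) (*-monoˡ-≤ w₂ (≤-trans (^-monoˡ-≤ (4 * t) (n≤1+n 2)) 3^4t≤z))))
    (log-bound 3 (2 ^ i) {{m^n≢0 2 i}} (s<s z<s))
    (≤-trans c₃≤ (*-monoʳ-≤ (3 ^ levels₃ i) (*-monoˡ-≤ w₃ 3^4t≤z)))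
    where
    exponent≤ : ∀ k → k ≤ 2 ^ t + 4 → schönhageExponent t k ≤ 7 * z
    exponent≤ k k≤ = begin
      schönhageExponent t k       ≤⟨ schönhageExponent-bound t k k≤ ⟩
      2 ^ suc t + 5 * t           ≤⟨ +-monoʳ-≤ (2 ^ suc t) (*-monoʳ-≤ 5 (<⇒≤ (n<2^n t))) ⟩
      2 * 2 ^ t + 5 * 2 ^ t       ≡⟨ *-distribʳ-+ (2 ^ t) 2 5 ⟨
      7 * 2 ^ t                   ≤⟨ *-monoʳ-≤ 7 (≤-trans 2^t≤y y≤z) ⟩
      7 * z                       ∎
      where open ≤-Reasoning

-- Product trees and multipoint evaluation

data Tree (V : Set) : ℕ → Set where
  leaf : (ℕ → V) → Tree V 0
  node : ∀ {L} → (ℕ → V) → Tree V L → Tree V L → Tree V (suc L)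

root : ∀ {V L} → Tree V L → ℕ → V
root (leaf f)     = f
root (node f _ _) = f

prepend : {A : Set} → A → (ℕ → A) → ℕ → A
prepend a f zero    = a
prepend a f (suc i) = f i

append : {A : Set} → ℕ → (ℕ → A) → (ℕ → A) → ℕ → A
append n f g i with i <? n
... | yes _ = f i
... | no _  = g (i ∸ n)

module _ {V : Set} where

  -- The polynomials at the leaves have length 2^w.
  treeᴾ : ℕ → (L : ℕ) → (ℕ → ℕ → V) → Program V (Tree V L)
  treeᴾ w zero    f = done (leaf (f 0))
  treeᴾ w (suc L) f =
    treeᴾ w L f ≫ λ l → treeᴾ w L (λ i → f (2 ^ L + i)) ≫ λ r →
    mulᴾ (L + w) (root l) (root r) ≫ λ h → done (node h l r)

  -- With n = 2^j, the sum of the q i t (k + i) is the coefficient n - 1 + k in the product of t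
  -- with the reversal of q. Twice the length is used because indices of t up to 2 n - 2 occur.
  transposedMulᴾ : ℕ → (q t : ℕ → V) → Program V (ℕ → V)
  transposedMulᴾ j q t = lit0 λ z →
    mulᴾ (suc j) (slice z 0 (2 ^ j) (λ i → q (2 ^ j ∸ suc i))) t ≫ λ h →
    done (λ k → h (pred (2 ^ j) + k))

  -- The precision doubles in every round: (1 - e₀) · I = 1 - e, where e = e₀^(2^r) after r rounds.
  inverseLoopᴾ : ℕ → ℕ → (e I : ℕ → V) → Program V (ℕ → V)
  inverseLoopᴾ J zero    e I = done I
  inverseLoopᴾ J (suc r) e I =
    lit1 λ o → mulᴾ J I (prepend o (e ∘ suc)) ≫ λ I′ → mulᴾ J e e ≫ λ e′ → inverseLoopᴾ J r e′ I′

  inverseᴾ : ℕ → (ℕ → V) → Program V (ℕ → V)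
  inverseᴾ J q = lit0 λ z → lit1 λ o →
    tabulateᴾ (2 ^ J) (λ i → sub′ z (q (suc i))) ≫ λ e →
    inverseLoopᴾ J J (prepend z e) (prepend o (λ _ → z))

  descendᴾ : ∀ {L} → Tree V L → (ℕ → V) → Program V (ℕ → V)
  descendᴾ     (leaf _)           t = done (λ _ → t 0)
  descendᴾ {L} (node {L = K} _ l r) t =
    transposedMulᴾ L (root r) t ≫ λ tₗ → transposedMulᴾ L (root l) t ≫ λ tᵣ →
    descendᴾ l tₗ ≫ λ a → descendᴾ r tᵣ ≫ λ b → done (append (2 ^ K) a b)

  reversedLinearᴾ : V → Program V (ℕ → V)
  reversedLinearᴾ s = lit0 λ z → lit1 λ o → sub′ z s ≫ λ x → done (prepend o (prepend x (λ _ → z)))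

  evaluateᴾ : ℕ → ℕ → (g s : ℕ → V) → Program V (ℕ → V)
  evaluateᴾ L J g s = lit0 λ z →
    collect s (2 ^ L) (λ i → reversedLinearᴾ (s i)) ≫ λ f →
    treeᴾ 1 L f ≫ λ T →
    -- `IsTree` says nothing about entries of the root beyond its length, whereas the inversion
    -- reads 2^J of them.
    inverseᴾ J (slice z 0 (2 ^ (L + 1)) (root T)) ≫ λ I →
    transposedMulᴾ J I (slice z 0 (2 ^ J) g) ≫ λ t →
    descendᴾ T t

treeCost : ℕ → ℕ → ℕ
treeCost w zero    = 0
treeCost w (suc L) = treeCost w L + (treeCost w L + mulCost (L + w))

inverseCost : ℕ → ℕ
inverseCost J = 2 ^ J * 1 + J * (mulCost J + mulCost J)

descendCost : ℕ → ℕ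
descendCost zero    = 0
descendCost (suc L) = mulCost (2 + L) + (mulCost (2 + L) + (descendCost L + descendCost L))

evaluateCost : ℕ → ℕ → ℕ
evaluateCost L J = 2 ^ L * 1 + (treeCost 1 L + (inverseCost J + (mulCost (suc J) + descendCost L)))

-- Correctness of product trees, power series inversion and evaluation, by their action on
-- sequences.

module Evaluation {V : Set} (R : RingOn V) where
  open RingOn R
  open Sums R
  open Semantics R
  open Multiplication R using (spec-multiply)

  -- This is f(E) t for the shift operator (E t) k = t (1 + k).
  act : ℕ → (f t : ℕ → V) → ℕ → V
  act n f t k = ∑ n (λ i → f i ⊠ t (k + i))

  act-cong : ∀ n {f f′ t t′} k → (∀ i → i < n → f i ≡ f′ i) → (∀ i → i < n → t (k + i) ≡ t′ (k + i)) →
             act n f t k ≡ act n f′ t′ k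
  act-cong n k f≡ t≡ = ∑-cong n (λ i i<n → cong₂ _⊠_ (f≡ i i<n) (t≡ i i<n))

  act-ext : ∀ n f {t t′} → (∀ i → t i ≡ t′ i) → ∀ k → act n f t k ≡ act n f t′ k
  act-ext n f {t} {t′} t≡ k = act-cong n {t = t} {t′} k (λ _ _ → refl) (λ i _ → t≡ (k + i))

  act-⊞ : ∀ n f t u k → act n f (λ i → t i ⊞ u i) k ≡ act n f t k ⊞ act n f u k
  act-⊞ n f t u k = trans (∑-ext n (λ i → ⊠-distribˡ (f i) _ _)) (∑-⊞ n _ _)

  act-slice : ∀ {n l} f t k → n ≤ l → act l (slice 𝟘 0 n f) t k ≡ act n f t k
  act-slice f t k n≤l = ∑-slice (λ v i → v ⊠ t (k + i)) {o = 0} f n≤l (λ i → ⊠-zeroˡ _)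

  act-conv : ∀ n l {f g h} → n + n ≤ l → (∀ q → q < l → h q ≡ conv n f g q) →
             ∀ t k → act l h t k ≡ act n f (act n g t) k
  act-conv n l {f} {g} {h} n+n≤l h≡ t k = begin
    ∑ l (λ q → h q ⊠ t (k + q))
      ≡⟨ ∑-cong l (λ q q<l → cong (_⊠ t (k + q)) (h≡ q q<l)) ⟩
    ∑ l (λ q → conv n f g q ⊠ t (k + q))
      ≡⟨ ∑-conv {n} {l} f g (λ q → t (k + q)) n+n≤l ⟩
    ∑₂ n f g (λ q → t (k + q))
      ≡⟨ ∑-ext n (λ i → cong (f i ⊠_) (∑-ext n (λ j → cong (λ q → g j ⊠ t q) (sym (+-assoc k i j))))) ⟩
    act n f (act n g t) k ∎
    where open ≡-Reasoning

  act-comm : ∀ n f g t k → act n f (act n g t) k ≡ act n g (act n f t) k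
  act-comm n f g t k = begin
    ∑ n (λ i → f i ⊠ ∑ n (λ j → g j ⊠ t (k + i + j)))
      ≡⟨ ∑-ext n (λ i → ∑-⊠ˡ n (f i) _) ⟩
    ∑ n (λ i → ∑ n (λ j → f i ⊠ (g j ⊠ t (k + i + j))))
      ≡⟨ ∑-swap n n _ ⟩
    ∑ n (λ j → ∑ n (λ i → f i ⊠ (g j ⊠ t (k + i + j))))
      ≡⟨ ∑-ext n (λ j → ∑-ext n (λ i → trans
           (solve 3 (λ x y z → x :* (y :* z) := y :* (x :* z)) refl (f i) (g j) _)
           (cong (λ q → g j ⊠ (f i ⊠ t q)) (swap k i j)))) ⟩
    ∑ n (λ j → ∑ n (λ i → g j ⊠ (f i ⊠ t (k + j + i))))
      ≡⟨ ∑-ext n (λ j → ∑-⊠ˡ n (g j) _) ⟨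
    ∑ n (λ j → g j ⊠ ∑ n (λ i → f i ⊠ t (k + j + i))) ∎
    where
    open ≡-Reasoning
    open RingSolver
    swap : ∀ k i j → k + i + j ≡ k + j + i
    swap = ℕSolver.solve-∀

  -- On such sequences E^n = 0, so an inverse of a power series modulo x^n acts as an exact inverse.
  Vanishes : ℕ → (ℕ → V) → Set
  Vanishes n t = ∀ k → n ≤ k → t k ≡ 𝟘

  act-vanishes : ∀ {n} m f {t} → Vanishes n t → Vanishes n (act m f t)
  act-vanishes m f v k n≤k = ∑-zero m (λ i _ → trans (cong (f i ⊠_) (v (k + i) (≤-trans n≤k (m≤m+n k i)))) (⊠-zeroʳ (f i)))

  act-truncate : ∀ n {l} f {t} → Vanishes n t → n ≤ l → ∀ k → act l f t k ≡ act n f t k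
  act-truncate n {l} f {t} v n≤l k = begin
    act l f t k
      ≡⟨ cong (λ l → act l f t k) (m+[n∸m]≡n n≤l) ⟨
    act (n + (l ∸ n)) f t k
      ≡⟨ ∑-+ n (l ∸ n) _ ⟩
    act n f t k ⊞ ∑ (l ∸ n) (λ i → f (n + i) ⊠ t (k + (n + i)))
      ≡⟨ cong (act n f t k ⊞_) (∑-zero (l ∸ n) (λ i _ → trans
           (cong (f (n + i) ⊠_) (v (k + (n + i)) (≤-trans (m≤m+n n i) (m≤n+m (n + i) k)))) (⊠-zeroʳ _))) ⟩
    act n f t k ⊞ 𝟘
      ≡⟨ ⊞-identityʳ _ ⟩
    act n f t k ∎
    where open ≡-Reasoning

  private
    n+n≤2^suc : ∀ j → 2 ^ j + 2 ^ j ≤ 2 ^ suc j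
    n+n≤2^suc j = ≤-reflexive (cong (2 ^ j +_) (sym (+-identityʳ (2 ^ j))))

  data IsTree (w : ℕ) : ∀ {L} → (ℕ → ℕ → V) → Tree V L → Set where
    leaf : ∀ {f} → IsTree w f (leaf (f 0))
    node : ∀ {L f h} {l r : Tree V L} → IsTree w f l → IsTree w (λ i → f (2 ^ L + i)) r →
           (∀ q → q < 2 ^ suc (L + w) → h q ≡ conv (2 ^ (L + w)) (root l) (root r) q) →
           IsTree w f (node h l r)

  spec-tree : ∀ w L f → Spec (treeᴾ w L f) (IsTree w f) (treeCost w L)
  spec-tree w zero    f = spec-done leaf
  spec-tree w (suc L) f = weaken (λ _ q → q) (≤-reflexive (cong (λ c → treeCost w L + (treeCost w L + c)) (+-identityʳ _)))
    (spec-tree w L f ⟫ λ l l-ok → spec-tree w L (λ i → f (2 ^ L + i)) ⟫ λ r r-ok →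
     spec-multiply (L + w) (root l) (root r) ⟫ λ h h-ok → spec-done (node l-ok r-ok h-ok))

  act-node : ∀ {w L f h} {l r : Tree V L} → IsTree w f (node h l r) →
             ∀ t k → act (2 ^ (suc L + w)) h t k ≡ act (2 ^ (L + w)) (root l) (act (2 ^ (L + w)) (root r) t) k
  act-node {w} {L} (node _ _ h-ok) = act-conv (2 ^ (L + w)) (2 ^ suc (L + w)) (n+n≤2^suc (L + w)) h-ok

  actAll : ℕ → ℕ → (ℕ → ℕ → V) → (ℕ → V) → ℕ → V
  actAll m zero    f t = t
  actAll m (suc n) f t = act m (f 0) (actAll m n (f ∘ suc) t)

  actAll-ext : ∀ m n f {t t′} → (∀ i → t i ≡ t′ i) → ∀ k → actAll m n f t k ≡ actAll m n f t′ k
  actAll-ext m zero    f t≡ k = t≡ k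
  actAll-ext m (suc n) f t≡ k = act-ext m (f 0) (actAll-ext m n (f ∘ suc) t≡) k

  actAll-+ : ∀ m a b f t k → actAll m (a + b) f t k ≡ actAll m a f (actAll m b (λ i → f (a + i)) t) k
  actAll-+ m zero    b f t k = refl
  actAll-+ m (suc a) b f t k = act-ext m (f 0) (actAll-+ m a b (f ∘ suc) t) k

  act-root : ∀ {w L f} {T : Tree V L} → IsTree w f T →
             ∀ t k → act (2 ^ (L + w)) (root T) t k ≡ actAll (2 ^ w) (2 ^ L) f t k
  act-root leaf t k = refl
  act-root {w} {suc L} {f} T-ok@(node {l = l} {r} l-ok r-ok h-ok) t k = begin
    act (2 ^ suc (L + w)) _ t k
      ≡⟨ act-node T-ok t k ⟩
    act (2 ^ (L + w)) (root l) (act (2 ^ (L + w)) (root r) t) k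
      ≡⟨ act-root l-ok _ k ⟩
    actAll (2 ^ w) (2 ^ L) f (act (2 ^ (L + w)) (root r) t) k
      ≡⟨ actAll-ext (2 ^ w) (2 ^ L) f (act-root r-ok t) k ⟩
    actAll (2 ^ w) (2 ^ L) f (actAll (2 ^ w) (2 ^ L) (λ i → f (2 ^ L + i)) t) k
      ≡⟨ actAll-+ (2 ^ w) (2 ^ L) (2 ^ L) f t k ⟨
    actAll (2 ^ w) (2 ^ L + 2 ^ L) f t k
      ≡⟨ cong (λ n → actAll (2 ^ w) (2 ^ L + n) f t k) (+-identityʳ (2 ^ L)) ⟨
    actAll (2 ^ w) (2 ^ suc L) f t k ∎
    where open ≡-Reasoning

  conv-zero : ∀ n .{{_ : NonZero n}} f g → conv n f g 0 ≡ f 0 ⊠ g 0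
  conv-zero n@(suc m) f g = begin
    f 0 ⊠ ∑ n (λ j → g j ⊠ δ 0 j) ⊞ ∑ m (λ i → f (suc i) ⊠ ∑ n (λ j → g j ⊠ 𝟘))
      ≡⟨ cong₂ _⊞_ (cong (f 0 ⊠_) (∑-δ n 0 g z<s)) (∑-zero m (λ i _ → trans
           (cong (f (suc i) ⊠_) (∑-zero n (λ j _ → ⊠-zeroʳ (g j)))) (⊠-zeroʳ _))) ⟩
    f 0 ⊠ g 0 ⊞ 𝟘
      ≡⟨ ⊞-identityʳ _ ⟩
    f 0 ⊠ g 0 ∎
    where open ≡-Reasoning

  -- Constant coefficient 1 is what makes the root invertible as a power series over every ring.
  root-zero : ∀ {w L f} {T : Tree V L} → IsTree w f T → (∀ i → i < 2 ^ L → f i 0 ≡ 𝟙) → root T 0 ≡ 𝟙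
  root-zero leaf f≡ = f≡ 0 z<s
  root-zero {w} {suc L} (node {l = l} {r} l-ok r-ok h-ok) f≡ = trans (h-ok 0 (m^n>0 2 (suc (L + w))))
    (trans (conv-zero (2 ^ (L + w)) {{m^n≢0 2 (L + w)}} (root l) (root r))
      (trans (cong₂ _⊠_ (root-zero l-ok (λ i i< → f≡ i (<-≤-trans i< (m≤m+n _ _))))
                        (root-zero r-ok (λ i i< → f≡ (2 ^ L + i) (<-≤-trans (+-monoʳ-< (2 ^ L) i<) (n+n≤2^suc L)))))
             (⊠-identityˡ 𝟙)))

  spec-transposedMul : ∀ j q t → Spec (transposedMulᴾ j q t) (λ u → ∀ k → k < 2 ^ j → u k ≡ act (2 ^ j) q t k) (mulCost (suc j))
  spec-transposedMul j q t = weaken (λ _ q → q) (≤-reflexive (+-identityʳ _))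
    (spec-lit0 (spec-multiply (suc j) (slice 𝟘 0 n (λ i → q (n ∸ suc i))) t ⟫ λ h h-ok → spec-done λ k k<n → begin
      h (pred n + k)
        ≡⟨ h-ok (pred n + k) (<-≤-trans (+-mono-≤-< pred[n]≤n k<n) (≤-trans (n+n≤2^suc j) (^-monoʳ-≤ 2 (n≤1+n (suc j))))) ⟩
      ∑ (2 ^ suc j) (λ i → slice 𝟘 0 n (λ i → q (n ∸ suc i)) i ⊠ T k i)
        ≡⟨ ∑-slice (λ v i → v ⊠ T k i) {o = 0} _ (^-monoʳ-≤ 2 (n≤1+n j)) (λ i → ⊠-zeroˡ _) ⟩
      ∑ n (λ i → q (n ∸ suc i) ⊠ T k i)
        ≡⟨ ∑-cong n (λ i i<n → cong (λ m → q (n ∸ suc i) ⊠ T k m) (sym (m∸[m∸n]′ i i<n))) ⟩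
      ∑ n (λ i → q (n ∸ suc i) ⊠ T k (n ∸ suc (n ∸ suc i)))
        ≡⟨ ∑-reverse n (λ i → q i ⊠ T k (n ∸ suc i)) ⟨
      ∑ n (λ i → q i ⊠ T k (n ∸ suc i))
        ≡⟨ ∑-cong n (λ i i<n → cong (q i ⊠_) (T-value k i k<n i<n)) ⟩
      ∑ n (λ i → q i ⊠ t (k + i)) ∎))
    where
    open ≡-Reasoning
    n = 2 ^ j
    instance
      nonZero-n : NonZero n
      nonZero-n = m^n≢0 2 j
    T : ℕ → ℕ → V
    T k i = ∑ (2 ^ suc j) (λ j → t j ⊠ δ (pred n + k) (i + j))
    m∸[m∸n]′ : ∀ i → i < n → n ∸ suc (n ∸ suc i) ≡ i
    m∸[m∸n]′ i i<n = trans (cong (n ∸_) (sym (+-∸-assoc 1 i<n))) (m∸[m∸n]≡n (<⇒≤ i<n))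
    T-value : ∀ k i → k < n → i < n → T k (n ∸ suc i) ≡ t (k + i)
    T-value k i k<n i<n = trans
      (∑-ext (2 ^ suc j) (λ l → cong (t l ⊠_) (trans (cong (λ m → δ m (n ∸ suc i + l)) eq) (δ-+ (n ∸ suc i) (k + i) l))))
      (∑-δ (2 ^ suc j) (k + i) t (<-≤-trans (+-mono-<-≤ k<n (<⇒≤ i<n)) (n+n≤2^suc j)))
      where
      eq : pred n + k ≡ n ∸ suc i + (k + i)
      eq = trans (cong (_+ k) pred≡) (rearrange (n ∸ suc i) i k)
        where
        rearrange : ∀ a i k → a + i + k ≡ a + (k + i)
        rearrange = ℕSolver.solve-∀
        pred≡ : pred n ≡ n ∸ suc i + i
        pred≡ = suc-injective (trans (suc-pred n) (trans (sym (m∸n+n≡m i<n)) (+-suc (n ∸ suc i) i)))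

  private
    ⊞-cancelʳ : ∀ x y z → y ⊞ x ≡ z ⊞ x → y ≡ z
    ⊞-cancelʳ = ∙-cancelʳ
      where open Algebra.Properties.AbelianGroup (CommutativeRing.+-abelianGroup commutativeRing)

  act-prepend-one : ∀ n .{{_ : NonZero n}} e → e 0 ≡ 𝟘 → ∀ t k → act n (prepend 𝟙 (e ∘ suc)) t k ≡ t k ⊞ act n e t k
  act-prepend-one (suc n) e e0 t k = begin
    𝟙 ⊠ t (k + 0) ⊞ E                       ≡⟨ cong (_⊞ E) (trans (⊠-identityˡ _) (cong t (+-identityʳ k))) ⟩
    t k ⊞ E                                 ≡⟨ cong (t k ⊞_) (⊞-identityˡ E) ⟨
    t k ⊞ (𝟘 ⊞ E)                           ≡⟨ cong (λ x → t k ⊞ (x ⊞ E)) (trans (cong (_⊠ t (k + 0)) e0) (⊠-zeroˡ _)) ⟨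
    t k ⊞ (e 0 ⊠ t (k + 0) ⊞ E)             ∎
    where
    open ≡-Reasoning
    E = ∑ n (λ i → e (suc i) ⊠ t (k + suc i))

  -- A nonzero term would require i ≥ v, j ≥ v and i + j = q. Squaring thus doubles the valuation,
  -- so J rounds reach precision 2^J.
  conv-valuation : ∀ n v {e} → (∀ i → i < v → e i ≡ 𝟘) → ∀ q → q < v + v → conv n e e q ≡ 𝟘
  conv-valuation n v {e} e≡ q q<v+v = ∑-zero n λ i _ → trans (∑-⊠ˡ n (e i) _) (∑-zero n λ j _ → term i j)
    where
    term : ∀ i j → e i ⊠ (e j ⊠ δ q (i + j)) ≡ 𝟘
    term i j with i <? v | j <? v
    ... | yes i<v | _       = trans (cong (_⊠ (e j ⊠ δ q (i + j))) (e≡ i i<v)) (⊠-zeroˡ _)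
    ... | no _    | yes j<v = trans (cong (λ x → e i ⊠ (x ⊠ δ q (i + j))) (e≡ j j<v)) (trans (cong (e i ⊠_) (⊠-zeroˡ _)) (⊠-zeroʳ _))
    ... | no i≮v  | no j≮v  = trans (cong (λ x → e i ⊠ (e j ⊠ x)) (δ-≢ {q} {i + j} λ { refl → <⇒≱ q<v+v (+-mono-≤ (≮⇒≥ i≮v) (≮⇒≥ j≮v)) }))
      (trans (cong (e i ⊠_) (⊠-zeroʳ _)) (⊠-zeroʳ _))

  module _ (J : ℕ) (q : ℕ → V) where

    private
      n = 2 ^ J
      instance
        nonZero-n : NonZero n
        nonZero-n = m^n≢0 2 J

    record InverseInvariant (r : ℕ) (e I : ℕ → V) : Set where
      field
        valuation : ∀ i → i < 2 ^ r → e i ≡ 𝟘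
        identity  : ∀ t → Vanishes n t → ∀ k → act n q (act n I t) k ⊞ act n e t k ≡ t k

    IsInverse : (ℕ → V) → Set
    IsInverse I = ∀ t → Vanishes n t → ∀ k → act n q (act n I t) k ≡ t k

    spec-inverseLoop : ∀ r m e I → m + r ≡ J → InverseInvariant m e I →
                       Spec (inverseLoopᴾ J r e I) IsInverse (r * (mulCost J + mulCost J))
    spec-inverseLoop zero m e I m≡J inv = spec-done λ t v k → begin
      act n q (act n I t) k
        ≡⟨ ⊞-identityʳ _ ⟨
      act n q (act n I t) k ⊞ 𝟘
        ≡⟨ cong (act n q (act n I t) k ⊞_) (∑-zero n (λ i i<n → trans
             (cong (_⊠ t (k + i)) (valuation i (subst (λ j → i < 2 ^ j) (trans (sym m≡J) (+-identityʳ m)) i<n))) (⊠-zeroˡ _))) ⟨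
      act n q (act n I t) k ⊞ act n e t k
        ≡⟨ identity t v k ⟩
      t k ∎
      where
      open ≡-Reasoning
      open InverseInvariant inv
    spec-inverseLoop (suc r) m e I m+r≡J inv = weaken (λ _ q → q) (≤-reflexive (sym (+-assoc (mulCost J) (mulCost J) _)))
      (spec-lit1 (spec-multiply J I 1+e ⟫ λ I′ I′-ok → spec-multiply J e e ⟫ λ e′ e′-ok →
       spec-inverseLoop r (suc m) e′ I′ (trans (sym (+-suc m r)) m+r≡J) record
         { valuation = λ i i< → trans
             (e′-ok i (<-≤-trans i< (^-monoʳ-≤ 2 (s≤s (≤-trans (m≤m+n m (suc r)) (≤-reflexive m+r≡J))))))
             (conv-valuation n (2 ^ m) valuation i (subst (i <_) (cong (2 ^ m +_) (+-identityʳ (2 ^ m))) i<))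
         ; identity = λ t v k →
             -- The invariant is applied to u = (1 + e) t: it reads q I (1 + e) t + e t + e² t = t +
             -- e t, and e t cancels. This is (1 - e) (1 + e) = 1 - e².
             let u = λ i → t i ⊞ act n e t i
                 u-vanishes : Vanishes n u
                 u-vanishes i n≤i = trans (cong₂ _⊞_ (v i n≤i) (act-vanishes n e v i n≤i)) (⊞-identityˡ 𝟘)
             in ⊞-cancelʳ (act n e t k) _ _ (begin
               (act n q (act n I′ t) k ⊞ act n e′ t k) ⊞ act n e t k
                 ≡⟨ cong (_⊞ act n e t k) (cong₂ _⊞_
                      (act-ext n q (λ i → trans (truncated I 1+e I′ I′-ok t v i)
                        (act-ext n I (act-prepend-one n e (valuation 0 (m^n>0 2 m)) t) i)) k)
                      (truncated e e e′ e′-ok t v k)) ⟩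
               (act n q (act n I u) k ⊞ act n e (act n e t) k) ⊞ act n e t k
                 ≡⟨ solve 3 (λ x y z → (x :+ y) :+ z := x :+ (z :+ y)) refl (act n q (act n I u) k) (act n e (act n e t) k) (act n e t k) ⟩
               act n q (act n I u) k ⊞ (act n e t k ⊞ act n e (act n e t) k)
                 ≡⟨ cong (act n q (act n I u) k ⊞_) (act-⊞ n e t (act n e t) k) ⟨
               act n q (act n I u) k ⊞ act n e u k
                 ≡⟨ identity u u-vanishes k ⟩
               t k ⊞ act n e t k ∎)
         }))
      where
      open ≡-Reasoning
      open RingSolver
      open InverseInvariant inv
      1+e = prepend 𝟙 (e ∘ suc)
      truncated : ∀ f g h → (∀ q → q < 2 ^ suc J → h q ≡ conv n f g q) → ∀ t → Vanishes n t → ∀ k →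
                  act n h t k ≡ act n f (act n g t) k
      truncated f g h h-ok t v k = trans (sym (act-truncate n h v (^-monoʳ-≤ 2 (n≤1+n J)) k))
        (act-conv n (2 ^ suc J) (n+n≤2^suc J) h-ok t k)

    spec-inverse : q 0 ≡ 𝟙 → Spec (inverseᴾ J q) IsInverse (inverseCost J)
    spec-inverse q0≡𝟙 = spec-lit0 (spec-lit1 (
      spec-tabulate n (λ i _ → spec-sub 𝟘 (q (suc i))) ⟫ λ e e≡ →
      spec-inverseLoop J 0 (prepend 𝟘 e) (prepend 𝟙 (λ _ → 𝟘)) refl record
        { valuation = λ { zero _ → refl ; (suc i) (s<s ()) }
        ; identity = λ t v k → begin
            act n q (act n (prepend 𝟙 (λ _ → 𝟘)) t) k ⊞ act n (prepend 𝟘 e) t k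
              ≡⟨ cong (_⊞ act n (prepend 𝟘 e) t k) (act-ext n q (λ i → unit t i) k) ⟩
            act n q t k ⊞ act n (prepend 𝟘 e) t k
              ≡⟨ ∑-⊞ n _ _ ⟨
            ∑ n (λ i → q i ⊠ t (k + i) ⊞ prepend 𝟘 e i ⊠ t (k + i))
              ≡⟨ ∑-cong n (λ i i<n → trans (sym (⊠-distribʳ (t (k + i)) (q i) _)) (cong (_⊠ t (k + i)) (complement e e≡ i i<n))) ⟩
            act n (prepend 𝟙 (λ _ → 𝟘)) t k
              ≡⟨ unit t k ⟩
            t k ∎
        }))
      where
      open ≡-Reasoning
      unit : ∀ t k → act n (prepend 𝟙 (λ _ → 𝟘)) t k ≡ t k
      unit t k = trans (act-prepend-one n (λ _ → 𝟘) refl t k)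
        (trans (cong (t k ⊞_) (∑-zero n (λ i _ → ⊠-zeroˡ _))) (⊞-identityʳ (t k)))
      complement : ∀ e → (∀ i → i < n → e i ≡ 𝟘 ⊟ q (suc i)) → ∀ i → i < n → q i ⊞ prepend 𝟘 e i ≡ prepend 𝟙 (λ _ → 𝟘) i
      complement e e≡ zero    _   = trans (⊞-identityʳ (q 0)) q0≡𝟙
      complement e e≡ (suc i) i<n = trans
        (cong (q (suc i) ⊞_) (trans (e≡ i (<-trans (n<1+n i) i<n)) (trans (⊟-def 𝟘 _) (⊞-identityˡ _))))
        (-ᵣ-inverseʳ (q (suc i)))

  append-elim : ∀ {A : Set} (Q : ℕ → A → Set) n {m} {f g : ℕ → A} → (∀ i → i < n → Q i (f i)) →
                (∀ i → i < m → Q (n + i) (g i)) → ∀ i → i < n + m → Q i (append n f g i)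
  append-elim Q n {m} {f} {g} qf qg i i<n+m with i <? n
  ... | yes i<n = qf i i<n
  ... | no i≮n  = subst (λ j → Q j (g (i ∸ n))) (m+[n∸m]≡n n≤i)
      (qg (i ∸ n) (+-cancelˡ-< n (i ∸ n) m (subst (_< n + m) (sym (m+[n∸m]≡n n≤i)) i<n+m)))
    where n≤i = ≮⇒≥ i≮n

  -- The value at s of the polynomial with coefficients G is τ 0, where τ is the
  -- sequence (1 - s E)⁻¹ G; at a node of the tree it is replaced by Q(E)⁻¹ G.
  IsValue : ℕ → (ℕ → V) → (ℕ → V) → V → Set
  IsValue n G f v = ∃[ τ ] (Vanishes n τ × v ≡ τ 0 × (∀ k → act 2 f τ k ≡ G k))

  -- `τ` is the exact sequence Q(E)⁻¹ G, of which the program holds only the first 2^(L+1) entries,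
  -- in `t`. Applying a polynomial of half that length leaves half of the entries known, which is
  -- just what a child requires.
  spec-descend : ∀ {n L f} {T : Tree V L} {G} t τ → IsTree 1 f T → Vanishes n τ →
    (∀ k → k < 2 ^ (L + 1) → t k ≡ τ k) → (∀ k → act (2 ^ (L + 1)) (root T) τ k ≡ G k) →
    Spec (descendᴾ T t) (λ a → ∀ i → i < 2 ^ L → IsValue n G (f i) (a i)) (descendCost L)
  spec-descend t τ leaf v t≡τ τ-ok = spec-done λ { zero _ → τ , v , t≡τ 0 z<s , τ-ok ; (suc i) (s<s ()) }
  spec-descend {n} {suc L} {f} {node h l r} {G} t τ T-ok@(node l-ok r-ok _) v t≡τ τ-ok =
    weaken (λ _ q → q) (≤-reflexive (cong (λ c → mulCost (2 + L) + (mulCost (2 + L) + (descendCost L + c))) (+-identityʳ (descendCost L))))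
    (spec-transposedMul (suc L) (root r) t ⟫ λ tₗ tₗ≡ →
     spec-transposedMul (suc L) (root l) t ⟫ λ tᵣ tᵣ≡ →
     spec-descend tₗ (act m (root r) τ) l-ok (act-vanishes m (root r) v)
       (λ k k<m → trans (tₗ≡ k (subst (k <_) m≡ k<m)) (restrict (root r) k (subst (k <_) m≡ k<m)))
       (λ k → trans (sym (act-node T-ok τ k)) (τ-ok k)) ⟫ λ a a-ok →
     spec-descend tᵣ (act m (root l) τ) r-ok (act-vanishes m (root l) v)
       (λ k k<m → trans (tᵣ≡ k (subst (k <_) m≡ k<m)) (restrict (root l) k (subst (k <_) m≡ k<m)))
       (λ k → trans (act-comm m (root r) (root l) τ k) (trans (sym (act-node T-ok τ k)) (τ-ok k))) ⟫ λ b b-ok →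
     spec-done λ i i< → append-elim (λ i → IsValue n G (f i)) (2 ^ L) a-ok b-ok i
       (subst (i <_) (cong (2 ^ L +_) (+-identityʳ (2 ^ L))) i<))
    where
    m = 2 ^ (L + 1)
    m≡ : m ≡ 2 ^ suc L
    m≡ = cong (2 ^_) (+-comm L 1)
    restrict : ∀ f k → k < 2 ^ suc L → act (2 ^ suc L) f t k ≡ act m f τ k
    restrict f k k< = trans
      (act-cong (2 ^ suc L) {t = t} {τ} k (λ _ _ → refl) (λ i i< → t≡τ (k + i)
        (<-≤-trans (+-mono-<-≤ k< (<⇒≤ i<)) (≤-trans (n+n≤2^suc (suc L)) (≤-reflexive (cong (λ j → 2 ^ suc j) (+-comm 1 L)))))))
      (cong (λ m → act m f τ k) (sym m≡))

  spec-evaluate : ∀ L J g s → L + 1 ≤ J →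
    Spec (evaluateᴾ L J g s)
      (λ a → ∀ i → i < 2 ^ L → IsValue (2 ^ J) (slice 𝟘 0 (2 ^ J) g) (prepend 𝟙 (prepend (𝟘 ⊟ s i) (λ _ → 𝟘))) (a i))
      (evaluateCost L J)
  spec-evaluate L J g s L<J = spec-lit0 (
    spec-collect s (2 ^ L) {Q = λ i f → f ≡ linear i} (λ i _ → spec-lit0 (spec-lit1 (spec refl ≤-refl))) ⟫ λ f f≡ →
    spec-tree 1 L f ⟫ λ T T-ok →
    spec-inverse J (q T) (trans (slice-inside {o = 0} (m^n>0 2 (L + 1)))
      (root-zero T-ok (λ i i< → cong (λ h → h 0) (f≡ i i<)))) ⟫ λ I I-ok →
    spec-transposedMul J I G ⟫ λ t t≡ →
    weaken (λ a a-ok i i< → subst (λ h → IsValue n G h (a i)) (f≡ i i<) (a-ok i i<)) ≤-refl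
      (spec-descend t (act n I G) T-ok (act-vanishes n I G-vanishes)
        (λ k k< → t≡ k (<-≤-trans k< 2^[L+1]≤n))
        (λ k → trans (sym (act-slice (root T) (act n I G) k 2^[L+1]≤n)) (I-ok G G-vanishes k))))
    where
    n = 2 ^ J
    G = slice 𝟘 0 n g
    linear : ℕ → ℕ → V
    linear i = prepend 𝟙 (prepend (𝟘 ⊟ s i) (λ _ → 𝟘))
    q : Tree V L → ℕ → V
    q T = slice 𝟘 0 (2 ^ (L + 1)) (root T)
    2^[L+1]≤n : 2 ^ (L + 1) ≤ n
    2^[L+1]≤n = ^-monoʳ-≤ 2 L<J
    G-vanishes : Vanishes n G
    G-vanishes k n≤k = slice-above {o = 0} n≤k

-- Cost estimates

module TotalCost (L U : ℕ) (mul≤ : ∀ i → i ≤ 2 + L → mulCost i ≤ 2 ^ i * U) (1≤U : 1 ≤ U) where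

  treeCost≤ : ∀ K → K ≤ L → treeCost 1 K ≤ K * 2 ^ K * U
  treeCost≤ zero    K≤L = z≤n
  treeCost≤ (suc K) K<L = begin
    treeCost 1 K + (treeCost 1 K + mulCost (K + 1))
      ≤⟨ +-mono-≤ ih (+-mono-≤ ih (≤-trans (mul≤ (K + 1) (≤-trans (≤-reflexive (+-comm K 1)) (≤-trans K<L (m≤n+m L 2))))
           (≤-reflexive (cong (λ j → 2 ^ j * U) (+-comm K 1))))) ⟩
    K * 2 ^ K * U + (K * 2 ^ K * U + 2 * 2 ^ K * U)
      ≡⟨ rearrange K (2 ^ K) U ⟩
    suc K * 2 ^ suc K * U ∎
    where
    open ≤-Reasoning
    ih = treeCost≤ K (<⇒≤ K<L)
    rearrange : ∀ k x u → k * x * u + (k * x * u + 2 * x * u) ≡ suc k * (2 * x) * u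
    rearrange = ℕSolver.solve-∀

  descendCost≤ : ∀ K → K ≤ L → descendCost K ≤ 4 * K * 2 ^ K * U
  descendCost≤ zero    K≤L = z≤n
  descendCost≤ (suc K) K<L = begin
    mulCost (2 + K) + (mulCost (2 + K) + (descendCost K + descendCost K))
      ≤⟨ +-mono-≤ m≤ (+-mono-≤ m≤ (+-mono-≤ ih ih)) ⟩
    2 ^ (2 + K) * U + (2 ^ (2 + K) * U + (4 * K * 2 ^ K * U + 4 * K * 2 ^ K * U))
      ≡⟨ rearrange K (2 ^ K) U ⟩
    4 * suc K * 2 ^ suc K * U ∎
    where
    open ≤-Reasoning
    ih = descendCost≤ K (<⇒≤ K<L)
    m≤ = mul≤ (2 + K) (+-monoʳ-≤ 2 (<⇒≤ K<L))
    rearrange : ∀ k x u → 2 * (2 * x) * u + (2 * (2 * x) * u + (4 * k * x * u + 4 * k * x * u)) ≡ 4 * suc k * (2 * x) * u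
    rearrange = ℕSolver.solve-∀

  total≤ : ∀ {d} → d ≤ 2 ^ L → treeCost 1 L + (evaluateCost L (1 + L) + 6 * d) ≤ 2 ^ L * (17 * suc L * U)
  total≤ {d} d≤ = begin
    treeCost 1 L + (2 ^ L * 1 + (treeCost 1 L + (2 ^ (1 + L) * 1 + (1 + L) * (mulCost (1 + L) + mulCost (1 + L)) + (mulCost (2 + L) + descendCost L))) + 6 * d)
      ≤⟨ +-mono-≤ (treeCost≤ L ≤-refl) (+-mono-≤ (+-mono-≤ (*-monoʳ-≤ (2 ^ L) 1≤U) (+-mono-≤ (treeCost≤ L ≤-refl)
           (+-mono-≤ (+-mono-≤ (*-monoʳ-≤ (2 ^ (1 + L)) 1≤U) (*-monoʳ-≤ (1 + L) (+-mono-≤ m≤ m≤)))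
             (+-mono-≤ (mul≤ (2 + L) ≤-refl) (descendCost≤ L ≤-refl))))) 6d≤) ⟩
    L * 2 ^ L * U + (2 ^ L * U + (L * 2 ^ L * U + (2 ^ (1 + L) * U + (1 + L) * (2 ^ (1 + L) * U + 2 ^ (1 + L) * U)
      + (2 ^ (2 + L) * U + 4 * L * 2 ^ L * U))) + 6 * (2 ^ L * U))
      -- The sum is (10 L + 17) 2^L U; the added term makes it a multiple of L + 1.
      ≤⟨ m≤m+n _ (7 * L * (2 ^ L * U)) ⟩
    L * 2 ^ L * U + (2 ^ L * U + (L * 2 ^ L * U + (2 ^ (1 + L) * U + (1 + L) * (2 ^ (1 + L) * U + 2 ^ (1 + L) * U)
      + (2 ^ (2 + L) * U + 4 * L * 2 ^ L * U))) + 6 * (2 ^ L * U)) + 7 * L * (2 ^ L * U)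
      ≡⟨ rearrange L (2 ^ L) U ⟩
    2 ^ L * (17 * suc L * U) ∎
    where
    open ≤-Reasoning
    m≤ = mul≤ (1 + L) (n≤1+n (1 + L))
    6d≤ : 6 * d ≤ 6 * (2 ^ L * U)
    6d≤ = *-monoʳ-≤ 6 (≤-trans (≤-trans d≤ (≤-reflexive (sym (*-identityʳ _)))) (*-monoʳ-≤ (2 ^ L) 1≤U))
    rearrange : ∀ l x u → l * x * u + (x * u + (l * x * u + (2 * x * u + (1 + l) * (2 * x * u + 2 * x * u)
      + (2 * (2 * x) * u + 4 * l * x * u))) + 6 * (x * u)) + 7 * l * (x * u) ≡ x * (17 * suc l * u)
    rearrange = ℕSolver.solve-∀

^-distribʳ-* : ∀ e a b → (a * b) ^ e ≡ a ^ e * b ^ e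
^-distribʳ-* zero    a b = refl
^-distribʳ-* (suc e) a b = trans (cong (a * b *_) (^-distribʳ-* e a b)) ([m*n]*[o*p]≡[m*o]*[n*p] a b (a ^ e) (b ^ e))

-- With y = ⌊L / e⌋, the base is at most (2 e + 6) (y + 1) ≤ (2 e + 6) 2^y, while (2^y)^e ≤ 2^L.
polynomial≤exponential : ∀ e .{{_ : NonZero e}} L → (2 * (3 + L)) ^ e ≤ (2 * e + 6) ^ e * 2 ^ L
polynomial≤exponential e L = begin
  (2 * (3 + L)) ^ e                  ≤⟨ ^-monoˡ-≤ e base≤ ⟩
  ((2 * e + 6) * 2 ^ y) ^ e          ≡⟨ ^-distribʳ-* e (2 * e + 6) (2 ^ y) ⟩
  (2 * e + 6) ^ e * (2 ^ y) ^ e      ≡⟨ cong ((2 * e + 6) ^ e *_) (^-*-assoc 2 y e) ⟩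
  (2 * e + 6) ^ e * 2 ^ (y * e)      ≤⟨ *-monoʳ-≤ ((2 * e + 6) ^ e) (^-monoʳ-≤ 2 (m/n*n≤m L e)) ⟩
  (2 * e + 6) ^ e * 2 ^ L            ∎
  where
  open ≤-Reasoning
  y = L / e
  L≤ : L ≤ suc y * e
  L≤ = begin
    L                ≡⟨ m≡m%n+[m/n]*n L e ⟩
    L % e + y * e    ≤⟨ +-monoˡ-≤ (y * e) (<⇒≤ (m%n<n L e)) ⟩
    e + y * e        ∎
  base≤ : 2 * (3 + L) ≤ (2 * e + 6) * 2 ^ y
  base≤ = begin
    2 * (3 + L)                      ≤⟨ *-monoʳ-≤ 2 (+-monoʳ-≤ 3 L≤) ⟩
    2 * (3 + suc y * e)              ≤⟨ m≤m+n _ (6 * y) ⟩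
    2 * (3 + suc y * e) + 6 * y      ≡⟨ rearrange e y ⟩
    (2 * e + 6) * suc y              ≤⟨ *-monoʳ-≤ (2 * e + 6) (n<2^n y) ⟩
    (2 * e + 6) * 2 ^ y              ∎
    where
    rearrange : ∀ e y → 2 * (3 + suc y * e) + 6 * y ≡ (2 * e + 6) * suc y
    rearrange = ℕSolver.solve-∀

private
  -- Here a x is the polylogarithmic factor. As p ≥ 1, it suffices to bound x^q by a multiple of d,
  -- because d ≤ d^p.
  quasilinear-arithmetic : ∀ c a x Ĉ d p q .{{_ : NonZero q}} .{{_ : NonZero p}} .{{_ : NonZero d}} .{{_ : NonZero Ĉ}} →
    c ≤ d * (a * x) → x ^ q ≤ Ĉ * d → c ^ q ≤ (a * Ĉ) ^ q * d ^ (q + p)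
  quasilinear-arithmetic c a x Ĉ d p q c≤ x^q≤ = begin
    c ^ q                              ≤⟨ ^-monoˡ-≤ q c≤ ⟩
    (d * (a * x)) ^ q                  ≡⟨ trans (^-distribʳ-* q d (a * x)) (cong (d ^ q *_) (^-distribʳ-* q a x)) ⟩
    d ^ q * (a ^ q * x ^ q)            ≤⟨ *-monoʳ-≤ (d ^ q) (*-monoʳ-≤ (a ^ q) x^q≤) ⟩
    d ^ q * (a ^ q * (Ĉ * d))          ≤⟨ *-monoʳ-≤ (d ^ q) (*-monoʳ-≤ (a ^ q) (*-mono-≤ (n≤n^ Ĉ q) (n≤n^ d p))) ⟩
    d ^ q * (a ^ q * (Ĉ ^ q * d ^ p))  ≡⟨ rearrange (d ^ q) (a ^ q) (Ĉ ^ q) (d ^ p) ⟩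
    a ^ q * Ĉ ^ q * (d ^ q * d ^ p)    ≡⟨ cong₂ _*_ (sym (^-distribʳ-* q a Ĉ)) (sym (^-distribˡ-+-* d q p)) ⟩
    (a * Ĉ) ^ q * d ^ (q + p)          ∎
    where
    open ≤-Reasoning
    n≤n^ : ∀ n k .{{_ : NonZero n}} .{{_ : NonZero k}} → n ≤ n ^ k
    n≤n^ n k = ≤-trans (≤-reflexive (sym (^-identityʳ n))) (^-monoʳ-≤ n (>-nonZero⁻¹ k))
    rearrange : ∀ a b c d → a * (b * (c * d)) ≡ b * c * (a * d)
    rearrange = ℕSolver.solve-∀

totalCost : ℕ → ℕ
totalCost d = treeCost 1 L + (evaluateCost L (1 + L) + 6 * d)
  where L = ⌈log 2 ⌉ d

-- Eight logarithmic factors come from a multiplication and the ninth from the depth of the tree and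
-- the rounds of the inversion; 34 is 17 doubled, since 2^L ≤ 2 d.
totalCost-polylog : ∀ d .{{_ : NonZero d}} → totalCost d ≤ d * (34 * mulConstant * (2 * (3 + ⌈log 2 ⌉ d)) ^ 9)
totalCost-polylog d = bound mulConstant (s≤s z≤n) mulCost-bound
  where
  open ≤-Reasoning
  L = ⌈log 2 ⌉ d
  x = 2 * (3 + L)
  bound : ∀ G → 1 ≤ G → (∀ i → mulCost i ≤ 2 ^ i * (G * (2 * suc i) ^ 8)) → totalCost d ≤ d * (34 * G * x ^ 9)
  bound G 1≤G G-bound = begin
    totalCost d
      ≤⟨ TotalCost.total≤ L (G * x ^ 8)
           (λ i i≤ → ≤-trans (G-bound i) (*-monoʳ-≤ (2 ^ i) (*-monoʳ-≤ G (^-monoˡ-≤ 8 (*-monoʳ-≤ 2 (s≤s i≤))))))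
           (*-mono-≤ 1≤G (m^n>0 x 8)) (n≤p^⌈log⌉ 2 d (s<s z<s)) ⟩
    2 ^ L * (17 * suc L * (G * x ^ 8))
      ≤⟨ *-mono-≤ (log-bound 2 d (s<s z<s)) (*-monoˡ-≤ (G * x ^ 8) (*-monoʳ-≤ 17 suc-L≤x)) ⟩
    2 * d * (17 * x * (G * x ^ 8))
      ≡⟨ rearrange d x G (x ^ 8) ⟩
    d * (34 * G * x ^ 9) ∎
    where
    suc-L≤x : suc L ≤ x
    suc-L≤x = ≤-trans (s≤s (m≤n+m L 2)) (m≤n*m (3 + L) 2)
    rearrange : ∀ d x g y → 2 * d * (17 * x * (g * y)) ≡ d * (34 * g * (x * y))
    rearrange = ℕSolver.solve-∀

totalCost-quasilinear : (ε : ℚ) → Positive ε → ∃[ C ] (∀ d c .{{_ : NonZero d}} → c ≤ totalCost d → c ≤ C · d ^1+ ε)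
totalCost-quasilinear ε@(mkℚ (ℤ.+ suc p) q-1 _) _ = 34 * mulConstant * Ĉ , λ d c c≤ →
  quasilinear-arithmetic c (34 * mulConstant) ((2 * (3 + ⌈log 2 ⌉ d)) ^ 9) Ĉ d (suc p) q
    (≤-trans c≤ (totalCost-polylog d)) (begin
      ((2 * (3 + ⌈log 2 ⌉ d)) ^ 9) ^ q        ≡⟨ ^-*-assoc (2 * (3 + ⌈log 2 ⌉ d)) 9 q ⟩
      (2 * (3 + ⌈log 2 ⌉ d)) ^ (9 * q)        ≤⟨ polynomial≤exponential (9 * q) (⌈log 2 ⌉ d) ⟩
      C₀ * 2 ^ ⌈log 2 ⌉ d                     ≤⟨ *-monoʳ-≤ C₀ (log-bound 2 d (s<s z<s)) ⟩
      C₀ * (2 * d)                            ≡⟨ *-assoc C₀ 2 d ⟨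
      Ĉ * d                                   ∎)
  where
  open ≤-Reasoning
  q = suc q-1
  instance
    nz : NonZero (9 * q)
    nz = m*n≢0 9 q
    nz₀ : NonZero (2 * (9 * q) + 6)
    nz₀ = >-nonZero (≤-trans (s≤s z≤n) (m≤n+m 6 (2 * (9 * q))))
  C₀ = (2 * (9 * q) + 6) ^ (9 * q)
  Ĉ = C₀ * 2
  instance
    nz₁ : NonZero Ĉ
    nz₁ = m*n≢0 C₀ 2 {{m^n≢0 (2 * (9 * q) + 6) (9 * q)}}

-- The arithmetic over ℤ/N

coefficients : {V : Set} → V → List V → ℕ → V
coefficients z []      _       = z
coefficients z (a ∷ p) zero    = a
coefficients z (a ∷ p) (suc i) = coefficients z p i

extend : ∀ {A : Set} {d} → A → (Fin d → A) → ℕ → A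
extend {d = zero}  a f i       = a
extend {d = suc d} a f zero    = f zero
extend {d = suc d} a f (suc i) = extend a (f ∘ suc) i

extend-toℕ : ∀ {A : Set} {d} (a : A) (f : Fin d → A) i → extend a f (toℕ i) ≡ f i
extend-toℕ a f zero    = refl
extend-toℕ a f (suc i) = extend-toℕ a (f ∘ suc) i

maxLength : ∀ {V : Set} {d} → (Fin d → List V) → ℕ
maxLength {d = zero}  f = 0
maxLength {d = suc d} f = length (f zero) ⊔ maxLength (f ∘ suc)

opaque

  -- The family is padded by constant polynomials 1 to 2^L members, each read at the common length
  -- 2^w.
  fastProduct : ∀ {V d} → (Fin d → Poly V) → Program V (Poly V)
  fastProduct {V} {d} f = lit0 λ z → lit1 λ o →
    treeᴾ w L (extend (prepend o (λ _ → z)) (λ i → coefficients z (f i))) ≫ λ T →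
    done (applyUpTo (root T) (2 ^ (L + w)))
    where
    w L : ℕ
    w = ⌈log 2 ⌉ (maxLength f)
    L = ⌈log 2 ⌉ d

  fastValues : ∀ {V d} → Poly V → (Fin d → V) → Program V (Fin d → V)
  -- For d = 0 the bound C · d^(1+ε) is 0, so no operation may be spent.
  fastValues {d = zero}  g s = done (λ ())
  fastValues {d = suc d} g s = lit0 λ z →
    evaluateᴾ L (suc L ⊔ ⌈log 2 ⌉ (length g)) (coefficients z g) (extend z s) ≫ λ a → done (a ∘ toℕ)
    where
    L : ℕ
    L = ⌈log 2 ⌉ (suc d)

module _ {N : ℕ} .{{_ : NonZero N}} where

  residueRing : RingOn (Fin N)
  residueRing = record { isCommutativeRing = residue-isCommutativeRing ; ⊟-def = ⊝≡⊕⊖ }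

  open Sums residueRing
  open Semantics residueRing
  open Evaluation residueRing

  run-semantics : ∀ {A} (p : Program (Fin N) A) → run p ≡ (value p , ops p)
  run-semantics (done a)    = refl
  run-semantics (lit0 k)    = run-semantics (k 0ᴺ)
  run-semantics (lit1 k)    = run-semantics (k 1ᴺ)
  run-semantics (add x y k) = cong (λ (a , c) → a , suc c) (run-semantics (k (x ⊕ y)))
  run-semantics (sub x y k) = cong (λ (a , c) → a , suc c) (run-semantics (k (x ⊝ y)))
  run-semantics (mul x y k) = cong (λ (a , c) → a , suc c) (run-semantics (k (x ⊗ y)))

  run-spec : ∀ {A} {p : Program (Fin N) A} {Q c} → Spec p Q c → Q (result (run p)) × cost (run p) ≤ c
  run-spec {p = p} {Q} (spec q b) = subst Q (sym (cong proj₁ (run-semantics p))) q , subst (_≤ _) (sym (cong proj₂ (run-semantics p))) b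

  -- The pairing with sequences for coefficient lists. It connects `∏ₚ`, which is defined by
  -- recursion on lists, with `act`, which works on vectors.
  pairₗ : Poly (Fin N) → (ℕ → Fin N) → Fin N
  pairₗ []      t = 0ᴺ
  pairₗ (a ∷ p) t = a ⊗ t 0 ⊕ pairₗ p (t ∘ suc)

  pairₗ-ext : ∀ p {t t′} → (∀ i → t i ≡ t′ i) → pairₗ p t ≡ pairₗ p t′
  pairₗ-ext []      t≡ = refl
  pairₗ-ext (a ∷ p) t≡ = cong₂ _⊕_ (cong (a ⊗_) (t≡ 0)) (pairₗ-ext p (t≡ ∘ suc))

  pairₗ-zero : ∀ p → pairₗ p (λ _ → 0ᴺ) ≡ 0ᴺ
  pairₗ-zero []      = refl
  pairₗ-zero (a ∷ p) = trans (cong₂ _⊕_ (⊗-zeroʳ a) (pairₗ-zero p)) (⊕-identityˡ 0ᴺ)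

  coeff≡pairₗ : ∀ p k → coeff p k ≡ pairₗ p (δ k)
  coeff≡pairₗ []      k       = refl
  coeff≡pairₗ (a ∷ p) zero    = sym (trans (cong₂ _⊕_ (⊗-identityʳ a) (pairₗ-zero p)) (⊕-identityʳ a))
  coeff≡pairₗ (a ∷ p) (suc k) = trans (coeff≡pairₗ p k)
    (sym (trans (cong (_⊕ pairₗ p (δ k)) (⊗-zeroʳ a)) (⊕-identityˡ _)))

  pairₗ-+ : ∀ p q t → pairₗ (p +ₚ q) t ≡ pairₗ p t ⊕ pairₗ q t
  pairₗ-+ []      q       t = sym (⊕-identityˡ _)
  pairₗ-+ (a ∷ p) []      t = sym (⊕-identityʳ _)
  pairₗ-+ (a ∷ p) (b ∷ q) t = trans (cong ((a ⊕ b) ⊗ t 0 ⊕_) (pairₗ-+ p q (t ∘ suc)))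
    (solve 5 (λ a b t x y → (a :+ b) :* t :+ (x :+ y) := (a :* t :+ x) :+ (b :* t :+ y)) refl a b (t 0) _ _)
    where open RingOn.RingSolver residueRing

  pairₗ-map : ∀ a q t → pairₗ (map (a ⊗_) q) t ≡ a ⊗ pairₗ q t
  pairₗ-map a []      t = sym (⊗-zeroʳ a)
  pairₗ-map a (b ∷ q) t = trans (cong₂ _⊕_ (⊗-assoc a b (t 0)) (pairₗ-map a q (t ∘ suc))) (sym (⊗-distribˡ-⊕ a _ _))

  pairₗ-* : ∀ p q t → pairₗ (p *ₚ q) t ≡ pairₗ p (λ i → pairₗ q (λ j → t (i + j)))
  pairₗ-* []      q t = refl
  pairₗ-* (a ∷ p) q t = trans (pairₗ-+ (map (a ⊗_) q) (0ᴺ ∷ p *ₚ q) t) (cong₂ _⊕_ (pairₗ-map a q t)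
    (trans (cong₂ _⊕_ (⊗-zeroˡ (t 0)) (pairₗ-* p q (t ∘ suc))) (⊕-identityˡ _)))

  pairₗ-coefficients : ∀ n p t → length p ≤ n → ∑ n (λ i → coefficients 0ᴺ p i ⊗ t i) ≡ pairₗ p t
  pairₗ-coefficients n       []      t _       = ∑-zero n (λ i _ → ⊗-zeroˡ (t i))
  pairₗ-coefficients (suc n) (a ∷ p) t (s≤s ≤n) = cong (a ⊗ t 0 ⊕_) (pairₗ-coefficients n p (t ∘ suc) ≤n)

  pairₗ-applyUpTo : ∀ f n t → pairₗ (applyUpTo f n) t ≡ ∑ n (λ i → f i ⊗ t i)
  pairₗ-applyUpTo f zero    t = refl
  pairₗ-applyUpTo f (suc n) t = cong (f 0 ⊗ t 0 ⊕_) (pairₗ-applyUpTo (f ∘ suc) n (t ∘ suc))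

  one : ℕ → Fin N
  one = prepend 1ᴺ (λ _ → 0ᴺ)

  act-one : ∀ n .{{_ : NonZero n}} t k → act n one t k ≡ t k
  act-one n t k = trans (act-prepend-one n (λ _ → 0ᴺ) refl t k)
    (trans (cong (t k ⊕_) (∑-zero n (λ i _ → ⊗-zeroˡ _))) (⊕-identityʳ (t k)))

  actAll-one : ∀ m .{{_ : NonZero m}} n t k → actAll m n (λ _ → one) t k ≡ t k
  actAll-one m zero    t k = refl
  actAll-one m (suc n) t k = trans (act-one m (actAll m n (λ _ → one) t) k) (actAll-one m n t k)

  actAll-∏ₚ : ∀ m .{{_ : NonZero m}} {d} n (f : Fin d → Poly (Fin N)) → d ≤ n → maxLength f ≤ m → ∀ t k →
    actAll m n (extend one (λ i → coefficients 0ᴺ (f i))) t k ≡ pairₗ (∏ₚ f) (λ i → t (k + i))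
  actAll-∏ₚ m {zero} n f _ _ t k = begin
    actAll m n (λ _ → one) t k      ≡⟨ actAll-one m n t k ⟩
    t k                             ≡⟨ cong t (+-identityʳ k) ⟨
    t (k + 0)                       ≡⟨ trans (⊕-identityʳ _) (⊗-identityˡ _) ⟨
    1ᴺ ⊗ t (k + 0) ⊕ 0ᴺ             ∎
    where open ≡-Reasoning
  actAll-∏ₚ m {suc d} (suc n) f (s≤s d≤n) ≤m t k = begin
    act m (coefficients 0ᴺ (f zero)) (actAll m n (extend one (λ i → coefficients 0ᴺ (f (suc i)))) t) k
      ≡⟨ act-ext m (coefficients 0ᴺ (f zero)) (actAll-∏ₚ m n (f ∘ suc) d≤n (≤-trans (m≤n⊔m (length (f zero)) _) ≤m) t) k ⟩
    act m (coefficients 0ᴺ (f zero)) (λ k → pairₗ (∏ₚ (f ∘ suc)) (λ i → t (k + i))) k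
      ≡⟨ pairₗ-coefficients m (f zero) _ (≤-trans (m≤m⊔n _ (maxLength (f ∘ suc))) ≤m) ⟩
    pairₗ (f zero) (λ i → pairₗ (∏ₚ (f ∘ suc)) (λ j → t (k + i + j)))
      ≡⟨ pairₗ-ext (f zero) (λ i → pairₗ-ext (∏ₚ (f ∘ suc)) (λ j → cong t (+-assoc k i j))) ⟩
    pairₗ (f zero) (λ i → pairₗ (∏ₚ (f ∘ suc)) (λ j → t (k + (i + j))))
      ≡⟨ pairₗ-* (f zero) (∏ₚ (f ∘ suc)) (λ i → t (k + i)) ⟨
    pairₗ (∏ₚ f) (λ i → t (k + i)) ∎
    where open ≡-Reasoning

  opaque
    unfolding fastProduct

    spec-fastProduct : ∀ {d} (f : Fin d → Poly (Fin N)) → Spec (fastProduct f)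
      (λ g → (∀ k → coeff g k ≡ coeff (∏ₚ f) k) × length g ≡ 2 ^ (⌈log 2 ⌉ d + ⌈log 2 ⌉ (maxLength f)))
      (treeCost (⌈log 2 ⌉ (maxLength f)) (⌈log 2 ⌉ d))
    spec-fastProduct {d} f = weaken (λ _ q → q) (≤-reflexive (+-identityʳ _))
      (spec-lit0 (spec-lit1 (spec-tree w L _ ⟫ λ T T-ok → spec-done ((λ k → begin
        coeff (applyUpTo (root T) n) k
          ≡⟨ coeff≡pairₗ (applyUpTo (root T) n) k ⟩
        pairₗ (applyUpTo (root T) n) (δ k)
          ≡⟨ pairₗ-applyUpTo (root T) n (δ k) ⟩
        act n (root T) (δ k) 0
          ≡⟨ act-root T-ok (δ k) 0 ⟩
        actAll (2 ^ w) (2 ^ L) _ (δ k) 0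
          ≡⟨ actAll-∏ₚ (2 ^ w) {{m^n≢0 2 w}} (2 ^ L) f (n≤p^⌈log⌉ 2 d (s<s z<s)) (n≤p^⌈log⌉ 2 (maxLength f) (s<s z<s)) (δ k) 0 ⟩
        pairₗ (∏ₚ f) (δ k)
          ≡⟨ coeff≡pairₗ (∏ₚ f) k ⟨
        coeff (∏ₚ f) k ∎) , length-applyUpTo (root T) n))))
      where
      open ≡-Reasoning
      w L n : ℕ
      w = ⌈log 2 ⌉ (maxLength f)
      L = ⌈log 2 ⌉ d
      n = 2 ^ (L + w)

  private
    -- The recurrence runs backwards: vanishing from n + 1 on gives vanishing from n on.
    recurrence-zero : ∀ n s τ → Vanishes n τ → (∀ k → τ k ≡ 0ᴺ ⊕ s ⊗ τ (suc k)) → ∀ k → τ k ≡ 0ᴺ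
    recurrence-zero zero    s τ v rec k = v k z≤n
    recurrence-zero (suc n) s τ v rec k = recurrence-zero n s τ v′ rec k
      where
      τ≡0 : ∀ k → n ≤ k → τ (suc k) ≡ 0ᴺ
      τ≡0 k n≤k = v (suc k) (s≤s n≤k)
      v′ : Vanishes n τ
      v′ k n≤k = trans (rec k) (trans (⊕-identityˡ _) (trans (cong (s ⊗_) (τ≡0 k n≤k)) (⊗-zeroʳ s)))

  -- τ k is the intermediate value of Horner's scheme once the coefficients from k on have been
  -- absorbed. Beyond the end of g, vanishing far out forces τ to be 0.
  horner-recurrence : ∀ n g s τ → Vanishes n τ → (∀ k → τ k ≡ coefficients 0ᴺ g k ⊕ s ⊗ τ (suc k)) → τ 0 ≡ evaluate g s
  horner-recurrence n []      s τ v rec = recurrence-zero n s τ v rec 0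
  horner-recurrence n (a ∷ g) s τ v rec = trans (rec 0) (cong (λ x → a ⊕ s ⊗ x)
    (horner-recurrence n g s (τ ∘ suc) (λ k n≤k → v (suc k) (≤-trans n≤k (n≤1+n k))) (rec ∘ suc)))

  coefficients-above : ∀ (g : Poly (Fin N)) k → length g ≤ k → coefficients 0ᴺ g k ≡ 0ᴺ
  coefficients-above []      k       _        = refl
  coefficients-above (a ∷ g) (suc k) (s≤s ≤k) = coefficients-above g k ≤k

  slice-coefficients : ∀ n (g : Poly (Fin N)) → length g ≤ n → ∀ k → slice 0ᴺ 0 n (coefficients 0ᴺ g) k ≡ coefficients 0ᴺ g k
  slice-coefficients n g ≤n k with k <? n
  ... | yes k<n = slice-inside {o = 0} k<n
  ... | no k≮n = trans (slice-above {o = 0} (≮⇒≥ k≮n)) (sym (coefficients-above g k (≤-trans ≤n (≮⇒≥ k≮n))))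

  isValue⇒evaluate : ∀ n g s v → length g ≤ n →
    IsValue n (slice 0ᴺ 0 n (coefficients 0ᴺ g)) (prepend 1ᴺ (prepend (0ᴺ ⊝ s) (λ _ → 0ᴺ))) v → v ≡ evaluate g s
  isValue⇒evaluate n g s v ≤n (τ , vanishes , v≡ , τ-ok) = trans v≡ (horner-recurrence n g s τ vanishes λ k → begin
    τ k
      ≡⟨ trans (cong (τ k ⊕_) (⊗-zeroˡ _)) (⊕-identityʳ _) ⟨
    τ k ⊕ 0ᴺ ⊗ τ (suc k)
      ≡⟨ cong (λ x → τ k ⊕ x ⊗ τ (suc k)) (⊖-inverseˡ s) ⟨
    τ k ⊕ (⊖ s ⊕ s) ⊗ τ (suc k)
      ≡⟨ solve 4 (λ x y n s → x :+ (n :+ s) :* y := (con 1 :* x :+ (n :* y :+ con 0)) :+ s :* y) refl (τ k) (τ (suc k)) (⊖ s) s ⟩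
    (1ᴺ ⊗ τ k ⊕ (⊖ s ⊗ τ (suc k) ⊕ 0ᴺ)) ⊕ s ⊗ τ (suc k)
      ≡⟨ cong₂ (λ i j → (1ᴺ ⊗ τ i ⊕ (⊖ s ⊗ τ j ⊕ 0ᴺ)) ⊕ s ⊗ τ (suc k)) (sym (+-identityʳ k)) (+-comm 1 k) ⟩
    act 2 (prepend 1ᴺ (prepend (⊖ s) (λ _ → 0ᴺ))) τ k ⊕ s ⊗ τ (suc k)
      ≡⟨ cong (_⊕ s ⊗ τ (suc k)) (trans (τ-ok k) (slice-coefficients n g ≤n k)) ⟩
    coefficients 0ᴺ g k ⊕ s ⊗ τ (suc k) ∎)
    where
    open ≡-Reasoning
    open RingOn.RingSolver residueRing

  opaque
    unfolding fastProduct

    spec-fastValues : ∀ {d} g (s : Fin (suc d) → Fin N) → Spec (fastValues g s) (λ a → ∀ j → a j ≡ evaluate g (s j))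
      (evaluateCost (⌈log 2 ⌉ (suc d)) (suc (⌈log 2 ⌉ (suc d)) ⊔ ⌈log 2 ⌉ (length g)))
    spec-fastValues {d} g s = weaken (λ _ q → q) (≤-reflexive (+-identityʳ _))
      (spec-lit0 (spec-evaluate L K (coefficients 0ᴺ g) (extend 0ᴺ s) (≤-trans (≤-reflexive (+-comm L 1)) (m≤m⊔n (suc L) (⌈log 2 ⌉ (length g)))) ⟫ λ a a-ok →
       spec-done λ j → trans
         (isValue⇒evaluate (2 ^ K) g (extend 0ᴺ s (toℕ j)) (a (toℕ j)) length≤
           (a-ok (toℕ j) (<-≤-trans (toℕ<n j) (n≤p^⌈log⌉ 2 (suc d) (s<s z<s)))))
         (cong (evaluate g) (extend-toℕ 0ᴺ s j))))
      where
      L K : ℕ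
      L = ⌈log 2 ⌉ (suc d)
      K = suc L ⊔ ⌈log 2 ⌉ (length g)
      length≤ : length g ≤ 2 ^ K
      length≤ = ≤-trans (n≤p^⌈log⌉ 2 (length g) (s<s z<s)) (^-monoʳ-≤ 2 (m≤n⊔m (suc L) (⌈log 2 ⌉ (length g))))

  opaque
    unfolding fastProduct ⌈log_⌉

    fastProduct-empty-cost : (f : Fin 0 → Poly (Fin N)) → cost (run (fastProduct f)) ≡ 0
    fastProduct-empty-cost f = refl

    fastValues-empty-cost : ∀ g (s : Fin 0 → Fin N) → cost (run (fastValues g s)) ≡ 0
    fastValues-empty-cost g s = refl

  values-correct : ∀ {d} g (s : Fin d → Fin N) j → result (run (fastValues g s)) j ≡ evaluate g (s j)
  values-correct {suc d} g s = proj₁ (run-spec (spec-fastValues g s))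

fastArithmetic : PolynomialArithmetic
fastArithmetic = record
  { productOf         = fastProduct
  ; valuesOf          = fastValues
  ; productOf-correct = λ f → proj₁ (proj₁ (run-spec (spec-fastProduct f)))
  ; valuesOf-correct  = values-correct
  }

-- Cost of the whole algorithm.

module _ {N : ℕ} .{{_ : NonZero N}} where

  maxLength-linear : ∀ {d} (b : Fin d → Fin N) → maxLength (λ i → X- b i) ≤ 2
  maxLength-linear {zero}  b = z≤n
  maxLength-linear {suc d} b = ⊔-lub ≤-refl (maxLength-linear (b ∘ suc))

  -- The polynomials X - b have length 2, so w = 1 and the product has length 2^(L+1). Hence the
  -- evaluation runs at precision exponent 1 + L.
  fast-cost : ∀ {d} (b s : Fin (suc d) → Fin N) →
    let g = result (run (fastProduct (λ i → X- b i)))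
        L = ⌈log 2 ⌉ (suc d)
    in cost (run (fastProduct (λ i → X- b i))) + cost (run (fastValues g s)) ≤ treeCost 1 L + evaluateCost L (1 + L)
  fast-cost {d} b s = +-mono-≤
    (≤-trans (proj₂ product) (≤-reflexive (cong (λ w → treeCost w L) w≡1)))
    (≤-trans (proj₂ (run-spec (spec-fastValues (result (run (fastProduct f))) s)))
      (≤-reflexive (cong (evaluateCost L) (m≥n⇒m⊔n≡m (⌈log⌉-least 2 _ (suc L) (s<s z<s) (≤-reflexive
        (trans (proj₂ (proj₁ product)) (cong (2 ^_) (trans (cong (L +_) w≡1) (+-comm L 1))))))))))
    where
    f = λ i → X- b i
    L = ⌈log 2 ⌉ (suc d)
    product = run-spec (spec-fastProduct f)
    w≡1 : ⌈log 2 ⌉ (maxLength f) ≡ 1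
    w≡1 = trans (cong ⌈log 2 ⌉ (≤-antisym (maxLength-linear b) (m≤m⊔n 2 (maxLength (λ i → X- b (suc i)))))) ⌈log⌉-base

  private
    cost-if : ∀ {A} b {x y : Counted A} {c} → cost x ≤ c → cost y ≤ c → cost (if b then x else y) ≤ c
    cost-if true  x≤ y≤ = x≤
    cost-if false x≤ y≤ = y≤

  -- Horner's scheme on a list of length 2 takes four operations, the gcd a fifth.
  steps5-6-cost : ∀ {d} (b : Fin d → Fin N) sⱼ is → cost (steps5-6 (λ i → X- b i) sⱼ is) ≤ 5 * length is
  steps5-6-cost b sⱼ []       = z≤n
  steps5-6-cost b sⱼ (i ∷ is) = ≤-trans
    (+-monoʳ-≤ 5 (cost-if (does (H ≟ 1)) ih (cost-if (does (H ≟ N)) ih z≤n)))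
    (≤-reflexive (sym (*-suc 5 (length is))))
    where
    H = gcd (toℕ (result (horner (X- b i) sⱼ))) N
    ih = steps5-6-cost b sⱼ is

  -- Control never returns from the inner loop to the outer one, so the inner loop is paid for at
  -- most once.
  steps3-6-cost : ∀ {d} (b s y : Fin d → Fin N) js →
                  cost (steps3-6 (λ i → X- b i) s y js) ≤ length js + 5 * d
  steps3-6-cost         b s y []       = z≤n
  steps3-6-cost {d} b s y (j ∷ js) = s≤s (cost-if (does (G ≟ 1)) (steps3-6-cost b s y js)
    (cost-if (does (G ≟ N)) (≤-trans (≤-trans (steps5-6-cost b (s j) (allFin d))
      (≤-reflexive (cong (5 *_) (length-tabulate {n = d} id)))) (m≤n+m (5 * d) (length js))) z≤n))
    where G = gcd (toℕ (y j)) N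

  module _ (P : PolynomialArithmetic) where
    open PolynomialArithmetic P

    algorithm-cost : ∀ {d} f (s : Fin d → Fin N) →
      let g = run (productOf f); y = run (valuesOf (result g) s) in
      cost (algorithm P f s) ≡ cost g + cost y + cost (steps3-6 f s (result y) (allFin d))
    algorithm-cost f s = sym (+-assoc (cost (run (productOf f))) _ _)

  fast-algorithm-cost : ∀ {d} (b s : Fin (suc d) → Fin N) →
                        cost (algorithm fastArithmetic (λ i → X- b i) s) ≤ totalCost (suc d)
  fast-algorithm-cost {d} b s = ≤-trans (≤-reflexive (algorithm-cost fastArithmetic (λ i → X- b i) s))
    (≤-trans (+-mono-≤ (fast-cost b s) (c≤ (result (run (fastValues (result (run (fastProduct (λ i → X- b i)))) s))))) (≤-reflexive (+-assoc (treeCost 1 L) (evaluateCost L (1 + L)) (6 * suc d))))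
    where
    L = ⌈log 2 ⌉ (suc d)
    c≤ : ∀ y → cost (steps3-6 (λ i → X- b i) s y (allFin (suc d))) ≤ 6 * suc d
    c≤ y = ≤-trans (steps3-6-cost b s y (allFin (suc d)))
      (≤-reflexive (cong (_+ 5 * suc d) (length-tabulate {n = suc d} id)))

fast-algorithm-quasilinear : (ε : ℚ) → Positive ε → ∃[ C ]
  ((N d : ℕ) .{{_ : NonZero N}} (b s : Fin d → Fin N) → cost (algorithm fastArithmetic (λ i → X- b i) s) ≤ C · d ^1+ ε)
fast-algorithm-quasilinear ε@(mkℚ (pos (suc p)) q-1 _) ε>0 = proj₁ (totalCost-quasilinear ε ε>0) , bound
  where
  bound : (N d : ℕ) .{{_ : NonZero N}} (b s : Fin d → Fin N) →
          cost (algorithm fastArithmetic (λ i → X- b i) s) ≤ proj₁ (totalCost-quasilinear ε ε>0) · d ^1+ ε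
  bound N zero    b s = subst (λ c → c ≤ proj₁ (totalCost-quasilinear ε ε>0) · 0 ^1+ ε) (sym (trans (algorithm-cost fastArithmetic (λ i → X- b i) s)
    (cong₂ (λ c c′ → c + c′ + 0) (fastProduct-empty-cost (λ i → X- b i)) (fastValues-empty-cost (result (run (fastProduct (λ i → X- b i)))) s)))) z≤n
  bound N (suc d) b s = proj₂ (totalCost-quasilinear ε ε>0) (suc d) _ (fast-algorithm-cost b s)

-- Correctness of the algorithm

module _ {N : ℕ} .{{_ : NonZero N}} where

  evaluate-coeff : ∀ p q x → (∀ k → coeff p k ≡ coeff q k) → evaluate p x ≡ evaluate q x
  evaluate-coeff []      []      x eq = refl
  evaluate-coeff []      (b ∷ q) x eq = sym (trans (cong₂ (λ u v → u ⊕ x ⊗ v) (sym (eq 0)) (sym (evaluate-coeff [] q x (eq ∘ suc))))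
    (trans (⊕-identityˡ _) (⊗-zeroʳ x)))
  evaluate-coeff (a ∷ p) []      x eq = trans (cong₂ (λ u v → u ⊕ x ⊗ v) (eq 0) (evaluate-coeff p [] x (eq ∘ suc)))
    (trans (⊕-identityˡ _) (⊗-zeroʳ x))
  evaluate-coeff (a ∷ p) (b ∷ q) x eq = cong₂ (λ u v → u ⊕ x ⊗ v) (eq 0) (evaluate-coeff p q x (eq ∘ suc))

  private
    module S = RingOn.RingSolver (residueRing {N})

  evaluate-+ : ∀ p q x → evaluate (p +ₚ q) x ≡ evaluate p x ⊕ evaluate q x
  evaluate-+ []      q       x = sym (⊕-identityˡ _)
  evaluate-+ (a ∷ p) []      x = sym (⊕-identityʳ _)
  evaluate-+ (a ∷ p) (b ∷ q) x = trans (cong (λ u → a ⊕ b ⊕ x ⊗ u) (evaluate-+ p q x))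
    (S.solve 5 (λ a b x u v → a S.:+ b S.:+ x S.:* (u S.:+ v) S.:= (a S.:+ x S.:* u) S.:+ (b S.:+ x S.:* v)) refl a b x _ _)

  evaluate-map : ∀ a q x → evaluate (map (a ⊗_) q) x ≡ a ⊗ evaluate q x
  evaluate-map a []      x = sym (⊗-zeroʳ a)
  evaluate-map a (b ∷ q) x = trans (cong (λ u → a ⊗ b ⊕ x ⊗ u) (evaluate-map a q x))
    (S.solve 4 (λ a b x u → a S.:* b S.:+ x S.:* (a S.:* u) S.:= a S.:* (b S.:+ x S.:* u)) refl a b x _)

  evaluate-* : ∀ p q x → evaluate (p *ₚ q) x ≡ evaluate p x ⊗ evaluate q x
  evaluate-* []      q x = sym (⊗-zeroˡ _)
  evaluate-* (a ∷ p) q x = trans (evaluate-+ (map (a ⊗_) q) (0ᴺ ∷ p *ₚ q) x)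
    (trans (cong₂ (λ u v → u ⊕ (0ᴺ ⊕ x ⊗ v)) (evaluate-map a q x) (evaluate-* p q x))
      (S.solve 4 (λ a x u v → a S.:* v S.:+ (S.con 0 S.:+ x S.:* (u S.:* v)) S.:= (a S.:+ x S.:* u) S.:* v) refl a x (evaluate p x) (evaluate q x)))

  evaluate-X- : ∀ b x → evaluate (X- b) x ≡ x ⊝ b
  evaluate-X- b x = trans
    (S.solve 2 (λ n x → n S.:+ x S.:* (S.con 1 S.:+ x S.:* S.con 0) S.:= x S.:+ n) refl (⊖ b) x) (sym (⊝≡⊕⊖ x b))

  horner-result : ∀ p x → result (horner p x) ≡ evaluate p x
  horner-result []      x = refl
  horner-result (a ∷ p) x = cong (λ v → a ⊕ x ⊗ v) (horner-result p x)

  module _ {q : ℕ} (q∣N : q ∣ N) where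

    private
      q∣kN : ∀ k → pos q ℤ∣.∣ k ℤ.* pos N
      q∣kN k = ℤ∣.∣n⇒∣m*n k (ℤ∣.∣ᵤ⇒∣ q∣N)

    -- Reduction modulo N changes z by a multiple of N, hence of q.
    ∣⇒∣residue : ∀ z → q ∣ ℤ.∣ z ∣ → q ∣ toℕ (residue {N} z)
    ∣⇒∣residue z q∣z with residue-split z
    ... | k , z≡ = ℤ∣.∣⇒∣ᵤ {pos q} {rep (residue z)} (ℤ∣.∣m+n∣n⇒∣m {m = rep (residue z)} (subst (pos q ℤ∣.∣_) z≡ (ℤ∣.∣ᵤ⇒∣ q∣z)) (q∣kN k))

    ∣residue⇒∣ : ∀ z → q ∣ toℕ (residue {N} z) → q ∣ ℤ.∣ z ∣
    ∣residue⇒∣ z q∣r with residue-split z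
    ... | k , z≡ = ℤ∣.∣⇒∣ᵤ {pos q} {z} (subst (pos q ℤ∣.∣_) (sym z≡) (ℤ∣.∣m∣n⇒∣m+n {m = rep (residue z)} (ℤ∣.∣ᵤ⇒∣ {pos q} {rep (residue z)} q∣r) (q∣kN k)))

    private
      ∣rep*rep∣ : ∀ (x y : Fin N) → ℤ.∣ rep x ℤ.* rep y ∣ ≡ toℕ x * toℕ y
      ∣rep*rep∣ x y = ℤ.∣i*j∣≡∣i∣*∣j∣ (rep x) (rep y)

    ∣-⊗ˡ : ∀ x y → q ∣ toℕ x → q ∣ toℕ (x ⊗ y)
    ∣-⊗ˡ x y q∣x = ∣⇒∣residue (rep x ℤ.* rep y) (subst (q ∣_) (sym (∣rep*rep∣ x y)) (∣m⇒∣m*n (toℕ y) q∣x))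

    ∣-⊗ʳ : ∀ x y → q ∣ toℕ y → q ∣ toℕ (x ⊗ y)
    ∣-⊗ʳ x y q∣y = subst (λ z → q ∣ toℕ z) (⊗-comm y x) (∣-⊗ˡ y x q∣y)

    ∣-⊗⇒ : Prime q → ∀ x y → q ∣ toℕ (x ⊗ y) → q ∣ toℕ x ⊎ q ∣ toℕ y
    ∣-⊗⇒ q-prime x y q∣xy = euclidsLemma (toℕ x) (toℕ y) q-prime
      (subst (q ∣_) (∣rep*rep∣ x y) (∣residue⇒∣ (rep x ℤ.* rep y) q∣xy))

    ∣-∏ₚ : ∀ {d} (f : Fin d → Poly (Fin N)) x i → q ∣ toℕ (evaluate (f i) x) → q ∣ toℕ (evaluate (∏ₚ f) x)
    ∣-∏ₚ f x zero    q∣ = subst (λ z → q ∣ toℕ z) (sym (evaluate-* (f zero) _ x)) (∣-⊗ˡ _ (evaluate (∏ₚ (f ∘ suc)) x) q∣)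
    ∣-∏ₚ f x (suc i) q∣ = subst (λ z → q ∣ toℕ z) (sym (evaluate-* (f zero) _ x)) (∣-⊗ʳ (evaluate (f zero) x) _ (∣-∏ₚ (f ∘ suc) x i q∣))

    ∣-∏ₚ⇒ : Prime q → ∀ {d} (f : Fin d → Poly (Fin N)) x → q ∣ toℕ (evaluate (∏ₚ f) x) → ∃[ i ] q ∣ toℕ (evaluate (f i) x)
    ∣-∏ₚ⇒ q-prime {zero} f x q∣ = ⊥-elim (nonTrivial⇒≢1 {{prime⇒nonTrivial q-prime}} (∣1⇒≡1 (∣residue⇒∣ (pos 1)
      (subst (λ z → q ∣ toℕ z) (trans (cong (1ᴺ ⊕_) (⊗-zeroʳ x)) (⊕-identityʳ 1ᴺ)) q∣))))
    ∣-∏ₚ⇒ q-prime {suc d} f x q∣ with ∣-⊗⇒ q-prime _ _ (subst (λ z → q ∣ toℕ z) (evaluate-* (f zero) (∏ₚ (f ∘ suc)) x) q∣)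
    ... | inj₁ q∣f₀ = zero , q∣f₀
    ... | inj₂ q∣∏ with ∣-∏ₚ⇒ q-prime (f ∘ suc) x q∣∏
    ...   | i , q∣fᵢ = suc i , q∣fᵢ

    ≡mod⇒∣evaluate : ∀ b s → toℕ b ≡ toℕ s [mod q ] → q ∣ toℕ (evaluate (X- b) s)
    ≡mod⇒∣evaluate b s b≡s = subst (λ z → q ∣ toℕ z) (sym (evaluate-X- b s))
      (∣⇒∣residue (rep s ℤ.- rep b) (subst (q ∣_) (ℤ.∣i-j∣≡∣j-i∣ (rep b) (rep s)) b≡s))

  N∣evaluate⇒≡ : ∀ b s → N ∣ toℕ (evaluate (X- b) s) → b ≡ s
  N∣evaluate⇒≡ b s N∣ = begin
    b                      ≡⟨ S.solve 1 (λ b → b S.:= S.con 0 S.:+ b) refl b ⟩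
    0ᴺ ⊕ b                 ≡⟨ cong (_⊕ b) s⊝b≡0 ⟨
    (s ⊝ b) ⊕ b            ≡⟨ cong (_⊕ b) (⊝≡⊕⊖ s b) ⟩
    (s ⊕ ⊖ b) ⊕ b          ≡⟨ ⊕-assoc s (⊖ b) b ⟩
    s ⊕ (⊖ b ⊕ b)          ≡⟨ cong (s ⊕_) (⊖-inverseˡ b) ⟩
    s ⊕ 0ᴺ                 ≡⟨ ⊕-identityʳ s ⟩
    s                      ∎
    where
    open ≡-Reasoning
    small : ∀ {m} → m < N → N ∣ m → m ≡ 0
    small {zero}  _   _   = refl
    small {suc m} m<N N∣m = ⊥-elim (<⇒≱ m<N (∣⇒≤ N∣m))
    s⊝b≡0 : s ⊝ b ≡ 0ᴺ
    s⊝b≡0 = trans (sym (residue-rep (s ⊝ b))) (cong (residue ∘ pos)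
      (small (toℕ<n (s ⊝ b)) (subst (λ z → N ∣ toℕ z) (evaluate-X- b s) N∣)))

  IsFactorOutput : Counted Output → Set
  IsFactorOutput c = ∃[ g ] (result c ≡ factor g × g ∣ N × 1 < g × g < N)

  private
    if-dec : ∀ {A B : Set} (Q : A → Set) (D : Dec B) {x y} → (B → Q x) → (¬ B → Q y) → Q (if does D then x else y)
    if-dec Q (yes b) qx qy = qx b
    if-dec Q (no ¬b) qx qy = qy ¬b

  proper-gcd : ∀ m → gcd m N ≢ 1 → gcd m N ≢ N → gcd m N ∣ N × 1 < gcd m N × gcd m N < N
  proper-gcd m ≢1 ≢N = g∣N , ≤∧≢⇒< (n≢0⇒n>0 λ g≡0 → ≢-nonZero⁻¹ N (0∣⇒≡0 (subst (_∣ N) g≡0 g∣N))) (≢1 ∘ sym) , ≤∧≢⇒< (∣⇒≤ g∣N) ≢N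
    where g∣N = gcd[m,n]∣n m N

  -- As no gcd equals N, an index is passed over only if its gcd is 1. The loop therefore stops at i
  -- at the latest, and every stop yields a proper factor.
  steps5-6-factor : ∀ {d} (f : Fin d → Poly (Fin N)) x is →
    (∀ i → gcd (toℕ (evaluate (f i) x)) N ≢ N) → ∀ i → i ∈ is → gcd (toℕ (evaluate (f i) x)) N ≢ 1 →
    IsFactorOutput (steps5-6 f x is)
  steps5-6-factor f x (k ∷ is) ≢N i i∈ ≢1 = if-dec IsFactorOutput (H ≟ 1)
    (λ H≡1 → steps5-6-factor f x is ≢N i (tail i∈ H≡1) ≢1)
    (λ H≢1 → if-dec IsFactorOutput (H ≟ N) (λ H≡N → ⊥-elim (H≢N H≡N))
      (λ _ → H , refl , proper-gcd (toℕ (result (horner (f k) x))) H≢1 H≢N))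
    where
    H = gcd (toℕ (result (horner (f k) x))) N
    H≡ : H ≡ gcd (toℕ (evaluate (f k) x)) N
    H≡ = cong (λ v → gcd (toℕ v) N) (horner-result (f k) x)
    H≢N : H ≢ N
    H≢N = ≢N k ∘ trans (sym H≡)
    tail : i ∈ k ∷ is → H ≡ 1 → i ∈ is
    tail (here refl) H≡1 = ⊥-elim (≢1 (trans (sym H≡) H≡1))
    tail (there i∈)  _   = i∈

  steps3-6-factor : ∀ {d} (f : Fin d → Poly (Fin N)) (s y : Fin d → Fin N) js →
    (∀ j → gcd (toℕ (y j)) N ≡ N → IsFactorOutput (steps5-6 f (s j) (allFin d))) →
    ∀ j → j ∈ js → gcd (toℕ (y j)) N ≢ 1 → IsFactorOutput (steps3-6 f s y js)
  steps3-6-factor f s y (k ∷ js) inner j j∈ ≢1 = if-dec IsFactorOutput (G ≟ 1)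
    (λ G≡1 → steps3-6-factor f s y js inner j (tail j∈ G≡1) ≢1)
    (λ G≢1 → if-dec IsFactorOutput (G ≟ N) (inner k) (λ G≢N → G , refl , proper-gcd (toℕ (y k)) G≢1 G≢N))
    where
    G = gcd (toℕ (y k)) N
    tail : j ∈ k ∷ js → G ≡ 1 → j ∈ js
    tail (here refl) G≡1 = ⊥-elim (≢1 G≡1)
    tail (there j∈)  _   = j∈

  steps3-6-errorA : ∀ {d} (f : Fin d → Poly (Fin N)) (s y : Fin d → Fin N) js →
    (∀ j → gcd (toℕ (y j)) N ≡ 1) → result (steps3-6 f s y js) ≡ errorA
  steps3-6-errorA f s y []       ≡1 = refl
  steps3-6-errorA f s y (j ∷ js) ≡1 = if-dec (λ c → result c ≡ errorA) (gcd (toℕ (y j)) N ≟ 1)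
    (λ _ → steps3-6-errorA f s y js ≡1) (λ ≢1 → ⊥-elim (≢1 (≡1 j)))

  prime∣⇒gcd≢1 : ∀ {q m} → Prime q → q ∣ N → q ∣ m → gcd m N ≢ 1
  prime∣⇒gcd≢1 q-prime q∣N q∣m g≡1 =
    nonTrivial⇒≢1 {{prime⇒nonTrivial q-prime}} (∣1⇒≡1 (subst (_ ∣_) g≡1 (gcd-greatest q∣m q∣N)))

  gcd≡N⇒N∣ : ∀ {m} → gcd m N ≡ N → N ∣ m
  gcd≡N⇒N∣ {m} g≡N = subst (_∣ m) g≡N (gcd[m,n]∣m m N)

  module _ (P : PolynomialArithmetic) {d} (b s : Fin d → Fin N) (solution : CoveringSolution N d b s) where
    open PolynomialArithmetic P
    open CoveringSolution solution

    private
      f : Fin d → Poly (Fin N)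
      f i = X- b i
      g : Poly (Fin N)
      g = result (run (productOf f))
      y : Fin d → Fin N
      y = result (run (valuesOf g s))

      y≡ : ∀ j → y j ≡ evaluate (∏ₚ f) (s j)
      y≡ j = trans (valuesOf-correct g s j) (evaluate-coeff g (∏ₚ f) (s j) (productOf-correct f))

    -- The outer loop may stop at some k before the j given by `covering`. If its gcd there is N,
    -- the prime q divides y k as well, hence some s k - b l, so the inner loop meets a gcd
    -- different from 1 at this k too.
    factor-of-composite : Composite N → IsFactorOutput (algorithm P f s)
    factor-of-composite N-composite with covering N-composite
    ... | i , j , q , q-prime , q∣N , bᵢ≡sⱼ = steps3-6-factor f s y (allFin d) inner j (∈-allFin j)
      (prime∣⇒gcd≢1 q-prime q∣N (subst (λ z → q ∣ toℕ z) (sym (y≡ j))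
        (∣-∏ₚ q∣N f (s j) i (≡mod⇒∣evaluate q∣N (b i) (s j) bᵢ≡sⱼ))))
      where
      inner : ∀ k → gcd (toℕ (y k)) N ≡ N → IsFactorOutput (steps5-6 f (s k) (allFin d))
      inner k G≡N with ∣-∏ₚ⇒ q∣N q-prime f (s k) (subst (λ z → q ∣ toℕ z) (y≡ k) (∣-trans q∣N (gcd≡N⇒N∣ {toℕ (y k)} G≡N)))
      ... | l , q∣ = steps5-6-factor f (s k) (allFin d)
        (λ i′ H≡N → disjoint i′ k (N∣evaluate⇒≡ (b i′) (s k) (gcd≡N⇒N∣ {toℕ (evaluate (f i′) (s k))} H≡N)))
        l (∈-allFin l) (prime∣⇒gcd≢1 q-prime q∣N q∣)

    -- A gcd with N other than 1 would be N itself. As a prime, N would then divide one factor s j -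
    -- b i, that is, b i = s j.
    errorA-of-prime : Prime N → result (algorithm P f s) ≡ errorA
    errorA-of-prime N-prime = steps3-6-errorA f s y (allFin d) λ j →
      [ id , (λ G≡N → ⊥-elim (N∤y j (gcd≡N⇒N∣ {toℕ (y j)} G≡N))) ]′ (prime⇒irreducible N-prime (gcd[m,n]∣n (toℕ (y j)) N))
      where
      N∤y : ∀ j → ¬ (N ∣ toℕ (y j))
      N∤y j N∣y with ∣-∏ₚ⇒ ∣-refl N-prime f (s j) (subst (λ z → N ∣ toℕ z) (y≡ j) N∣y)
      ... | i , N∣ = disjoint i j (N∣evaluate⇒≡ (b i) (s j) N∣)

theorem3p4 : (∃[ P ] ((ε : ℚ) → Positive ε → ∃[ C ]
    ((N d : ℕ) .{{_ : NonZero N}} (b s : Fin d → Fin N) → CoveringSolution N d b s →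
    cost (algorithm P (λ i → X- (b i)) s) ≤ C · d ^1+ ε)))
    ×
    ((P : PolynomialArithmetic) (N d : ℕ) .{{_ : NonZero N}} (b s : Fin d → Fin N) → CoveringSolution N d b s →
    (Composite N → ∃[ g ] (result (algorithm P (λ i → X- (b i)) s) ≡ factor g × g ∣ N × 1 < g × g < N))
    ×
    (Prime N → result (algorithm P (λ i → X- (b i)) s) ≡ errorA))
theorem3p4 =
  (fastArithmetic , λ ε ε>0 → proj₁ (fast-algorithm-quasilinear ε ε>0) ,
    λ N d b s _ → proj₂ (fast-algorithm-quasilinear ε ε>0) N d b s) ,
  λ P N d b s solution → factor-of-composite P b s solution , errorA-of-prime P b s solution
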